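{- Let $k\in\{3,4\}$ and let $n\geq 2k+1$ be an integer. Then the toughness of the Kneser graph $K(n,k)$ equals $$t(K(n,k))=\frac{n}{k}-1.$$ Moreover, any vertex cut $S$ of $K(n,k)$ satisfying $t(K(n,k))=\frac{|S|}{c(K(n,k)\setminus S)}$ must be the complement of a maximum independent set in $K(n,k)$.
   Context: For integers $n\ge 2k+1$, the Kneser graph $K(n,k)$ has as vertices the $k$-element subsets of $[n]=\{1,\dots,n\}$, two vertices being adjacent iff the subsets are disjoint. For a connected graph $G$, a vertex cut is a set $S$ of vertices whose removal disconnects $G$; $c(G\setminus S)$ denotes the number of connected components of the graph obtained by deleting $S$. The toughness is $t(G)=\min_S \frac{|S|}{c(G\setminus S)}$, the minimum over all vertex cuts $S$. -}

module Defs where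

open import Data.Nat using (ℕ; zero; suc)
open import Data.Bool using (Bool; true; false; not; _≟_)
open import Data.Fin.Subset using (Subset; ∣_∣; _∩_; Empty; inside; outside)
open import Data.Vec using (_∷_; [])
open import Data.List using (List; []; _∷_; map; _++_; filter; length)
open import Data.List.Relation.Unary.All using (All)
open import Data.List.Relation.Unary.Any using (Any)
open import Data.List.Relation.Unary.AllPairs using (AllPairs)
open import Data.Product using (Σ; _×_; ∃)
open import Data.Integer using (+_)
open import Data.Rational using (ℚ; _/_; 0ℚ) renaming (_≤_ to _≤ℚ_)
open import Relation.Binary.PropositionalEquality using (_≡_)
open import Relation.Nullary using (¬_)
import Data.Nat as N

allSubsets : (n : ℕ) → List (Subset n)
allSubsets zero = [] ∷ []
allSubsets (suc n) = map (inside ∷_) (allSubsets n) ++ map (outside ∷_) (allSubsets n)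

module Kneser (n k : ℕ) where

  IsVertex : Subset n → Set
  IsVertex A = ∣ A ∣ ≡ k

  vertices : List (Subset n)
  vertices = filter (λ A → ∣ A ∣ N.≟ k) (allSubsets n)

  Adj : Subset n → Subset n → Set
  Adj A B = Empty (A ∩ B)

  -- a set of vertices, given by its (decidable) membership predicate;
  -- only its values on k-subsets matter
  VSet : Set
  VSet = Subset n → Bool

  card : VSet → ℕ
  card S = length (filter (λ A → S A ≟ true) vertices)

  Remaining : VSet → Subset n → Set
  Remaining S A = IsVertex A × S A ≡ false

  data Conn (S : VSet) : Subset n → Subset n → Set where
    here : ∀ {A} → Remaining S A → Conn S A A
    step : ∀ {A B C} → Conn S A B → Remaining S C → Adj B C → Conn S A C

  -- K(n,k) \ S has exactly c connected components: there are c representatives,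
  -- pairwise in distinct components, covering every remaining vertex
  HasComponents : VSet → ℕ → Set
  HasComponents S c = Σ (List (Subset n)) λ reps →
    length reps ≡ c × All (Remaining S) reps ×
    AllPairs (λ A B → ¬ Conn S A B) reps ×
    (∀ A → Remaining S A → Any (λ R → Conn S R A) reps)

  VertexCut : VSet → ℕ → Set
  VertexCut S c = HasComponents S c × 2 N.≤ c

  Independent : VSet → Set
  Independent I = ∀ A B → IsVertex A → IsVertex B →
    I A ≡ true → I B ≡ true → ¬ Adj A B

  MaximumIndependent : VSet → Set
  MaximumIndependent I = Independent I × (∀ J → Independent J → card J N.≤ card I)

  ComplementOf : VSet → VSet → Set
  ComplementOf S I = ∀ A → IsVertex A → S A ≡ not (I A)

-- the rational a / d (only used with d ≥ 1)
frac : ℕ → ℕ → ℚ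
frac a zero = 0ℚ
frac a (suc d) = (+ a) / suc d

IsToughness : ℕ → ℕ → ℚ → Set
IsToughness n k t =
  (∀ S c → VertexCut S c → t ≤ℚ frac (card S) c) ×
  (∃ λ S → ∃ λ c → VertexCut S c × t ≡ frac (card S) c)
  where open Kneser n k

{-# OPTIONS --safe #-}
module Submission where

-- With d = C(n−k,k) and ℓ = C(n−k−1,k−1), the adjacency matrix Z of K(n,k) satisfies
-- Hoffman's inequality  N (⟨f,Zf⟩ + ℓ⟨f,f⟩) ≥ (d + ℓ)(Σ f)²,  where N = C(n,k).
-- Let C₁,…,C_c be the components left by a cut, Cᵢ having mᵢ vertices and eᵢ
-- ordered edges.  Taking f constant on each component, with value inversely
-- proportional to bᵢ ≥ N(eᵢ/mᵢ + ℓ), gives  Σ mᵢ/bᵢ ≤ 1/(d + ℓ).  If moreover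
-- bᵢ (k mᵢ + n − k) ≤ N mᵢ n ℓ  for every i, then  Σ (k mᵢ + n − k) ≤ kN,  which is the
-- toughness bound c (n − k) ≤ k|S|.  Singletons give equality; a larger component gives
-- strict inequality, by eᵢ ≤ mᵢ(mᵢ − 1) if mᵢ is small, and by the expander mixing bound
-- N eᵢ ≤ N θ mᵢ + (d − θ) mᵢ²  with θ = C(n−k−2,k−2) together with mᵢ + d + 1 ≤ N
-- otherwise.  A few sizes for n = 2k + 1 need slightly sharper estimates.
-- The spectrum of Z is obtained from the action of sl₂ on functions on the Boolean cube.

open import Defs

-- By Cauchy-Schwarz, 1/b is the best value on a component: it makes Σ m f and Σ m b f² the same
-- sum. Since k d = (n - k) ℓ, one has k (d + ℓ) = n ℓ, so the condition on the single components
-- adds up to Σ (k m + n - k) ≤ N n ℓ Σ m/b ≤ k N. The left side is k (N - |S|) + c (n - k), which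
-- is how it encodes toughness. The obstacle is that condition itself. The degree bound m - 1 serves
-- for m < d - d/ℓ, and the mixing bound from there up to N - d - 1. No component is larger, because
-- a vertex of another component and its d neighbours all lie outside it. The two ranges meet as
-- soon as d/ℓ ≥ 3/2, θ/ℓ ≤ 3/5 and ℓ ≥ 6. Here d/ℓ = (n - k)/k and θ/ℓ = (k - 1)/(n - k - 1), so
-- for k = 3, 4 only K(7,3) and K(9,4) are left over. Of the spectrum only inequalities between
-- quadratic forms are needed. Hence there is no eigenbasis and no dimension count: harmonic parts
-- are peeled off a function one at a time. Everything is cleared of denominators and stays in ℤ.

module Development where

  open import Data.Bool using (Bool; true; false; not)
  import Data.Bool as Bool
  import Data.Bool.Properties as Bool
  open import Data.Empty using (⊥)
  open import Data.Fin as Fin using (Fin; zero; suc)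
  open import Data.Fin.Subset using (Subset; ∣_∣; Empty; _∩_; _∪_)
  open import Data.Fin.Subset.Properties using (∣p∣≤n; ∩-comm; drop-∷-Empty)
  open import Data.Integer as ℤ using (ℤ; +_; -[1+_]; 0ℤ; 1ℤ; -1ℤ; _+_; _*_; _-_; -_; _≤_; _<_; +≤+; +<+; positive; nonNegative)
  open import Data.Integer.Properties
  open import Data.Integer.Tactic.RingSolver using (solve-∀)
  open import Data.List using (List; []; _∷_; map; _++_; filter; length; lookup)
  open import Data.List.Membership.Propositional using (_∈_)
  open import Data.List.Membership.Propositional.Properties
    using (∈-lookup; ∈-++⁺ˡ; ∈-++⁺ʳ; ∈-map⁺; ∈-map⁻; ∈-filter⁺)
  open import Data.List.Properties using (length-map)
  open import Data.List.Relation.Unary.All as All using (All; []; _∷_)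
  import Data.List.Relation.Unary.All.Properties as All
  open import Data.List.Relation.Unary.AllPairs as AllPairs using (AllPairs; []; _∷_)
  open import Data.List.Relation.Unary.Any as Any using (Any; here; there; index)
  open import Data.List.Relation.Unary.Any.Properties using (lookup-index)
  open import Data.List.Relation.Unary.Unique.Propositional using (Unique)
  import Data.List.Relation.Unary.Unique.Propositional.Properties as Unique
  open import Data.Maybe using (Maybe; just; nothing)
  open import Data.Nat as ℕ using (ℕ; zero; suc; _!)
  import Data.Nat.Properties as ℕ
  open import Data.Product using (_,_; _×_; Σ; ∃; proj₁; proj₂)
  open import Data.Rational using (1ℚ; toℚᵘ; fromℚᵘ) renaming (_-_ to _-ℚ_; -_ to -ℚ_; _≤_ to _≤ℚ_)
  import Data.Rational.Properties as ℚ
  open import Data.Rational.Unnormalised as ℚᵘ using (ℚᵘ; mkℚᵘ; *≡*; *≤*)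
  import Data.Rational.Unnormalised.Properties as ℚᵘ
  open import Data.Sum using (_⊎_; inj₁; inj₂)
  open import Data.Vec using ([]; _∷_; here; there)
  open import Data.Vec.Properties using (∷-injectiveʳ)
  open import Relation.Binary.PropositionalEquality
    using (_≡_; _≢_; refl; sym; trans; cong; cong₂; subst; subst₂; _≗_; module ≡-Reasoning)
  open import Relation.Nullary using (¬_; Dec; yes; no; does; contradiction; _×-dec_)
  open import Relation.Nullary.Decidable using (dec-true; dec-false)
  open import Relation.Unary using (Decidable)
  open ≡-Reasoning

  private
    variable
      n : ℕ

  -- Functions on the Boolean cube and their inner product.

  Fn : ℕ → Set
  Fn n = Subset n → ℤ

  infixl 9 _₁ _₀

  _₁ _₀ : Fn (suc n) → Fn n
  (f ₁) A = f (true ∷ A)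
  (f ₀) A = f (false ∷ A)

  ∑ : Fn n → ℤ
  ∑ {zero} f = f []
  ∑ {suc n} f = ∑ (f ₁) + ∑ (f ₀)

  ⟪_,_⟫ : Fn n → Fn n → ℤ
  ⟪ f , g ⟫ = ∑ (λ A → f A * g A)

  ∑-cong : {f g : Fn n} → f ≗ g → ∑ f ≡ ∑ g
  ∑-cong {zero} e = e []
  ∑-cong {suc n} e = cong₂ _+_ (∑-cong (λ A → e (true ∷ A))) (∑-cong (λ A → e (false ∷ A)))

  ∑-lin : ∀ a b (f g : Fn n) → ∑ (λ A → a * f A + b * g A) ≡ a * ∑ f + b * ∑ g
  ∑-lin {zero} a b f g = refl
  ∑-lin {suc n} a b f g = trans (cong₂ _+_ (∑-lin a b (f ₁) (g ₁)) (∑-lin a b (f ₀) (g ₀)))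
    (rearrange a b (∑ (f ₁)) (∑ (g ₁)) (∑ (f ₀)) (∑ (g ₀)))
    where
    rearrange : ∀ a b x y z w → a * x + b * y + (a * z + b * w) ≡ a * (x + z) + b * (y + w)
    rearrange = solve-∀

  ∑-0 : ∑ {n} (λ _ → 0ℤ) ≡ 0ℤ
  ∑-0 {zero} = refl
  ∑-0 {suc n} = cong₂ _+_ (∑-0 {n}) (∑-0 {n})

  ∑-scale : ∀ a (f : Fn n) → ∑ (λ A → a * f A) ≡ a * ∑ f
  ∑-scale {zero} a f = refl
  ∑-scale {suc n} a f = trans (cong₂ _+_ (∑-scale a (f ₁)) (∑-scale a (f ₀)))
    (sym (*-distribˡ-+ a (∑ (f ₁)) (∑ (f ₀))))

  ⟪⟫-cong : {f g f′ g′ : Fn n} → f ≗ f′ → g ≗ g′ → ⟪ f , g ⟫ ≡ ⟪ f′ , g′ ⟫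
  ⟪⟫-cong e e′ = ∑-cong (λ A → cong₂ _*_ (e A) (e′ A))

  ⟪⟫-comm : (f g : Fn n) → ⟪ f , g ⟫ ≡ ⟪ g , f ⟫
  ⟪⟫-comm f g = ∑-cong (λ A → *-comm (f A) (g A))

  ⟪⟫-linʳ : ∀ a b (h f g : Fn n) → ⟪ h , (λ A → a * f A + b * g A) ⟫ ≡ a * ⟪ h , f ⟫ + b * ⟪ h , g ⟫
  ⟪⟫-linʳ a b h f g = trans (∑-cong (λ A → rearrange a b (h A) (f A) (g A)))
    (∑-lin a b (λ A → h A * f A) (λ A → h A * g A))
    where
    rearrange : ∀ a b h x y → h * (a * x + b * y) ≡ a * (h * x) + b * (h * y)
    rearrange = solve-∀

  ⟪⟫-linˡ : ∀ a b (f g h : Fn n) → ⟪ (λ A → a * f A + b * g A) , h ⟫ ≡ a * ⟪ f , h ⟫ + b * ⟪ g , h ⟫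
  ⟪⟫-linˡ a b f g h = trans (⟪⟫-comm _ h) (trans (⟪⟫-linʳ a b h f g)
    (cong₂ (λ x y → a * x + b * y) (⟪⟫-comm h f) (⟪⟫-comm h g)))

  ⟪⟫-scaleʳ : ∀ a (h f : Fn n) → ⟪ h , (λ A → a * f A) ⟫ ≡ a * ⟪ h , f ⟫
  ⟪⟫-scaleʳ a h f = trans (∑-cong (λ A → rearrange a (h A) (f A))) (∑-scale a (λ A → h A * f A))
    where
    rearrange : ∀ a h x → h * (a * x) ≡ a * (h * x)
    rearrange = solve-∀

  -- Group-like and derivation-like actions of 2×2 matrices.

  data Mat : Set where
    mat : (p q r s : ℤ) → Mat

  infixl 7 _⊗_
  -- The ordinary matrix product, not a tensor product. Entries are listed row by row, with `true`
  -- (element present) before `false`.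
  _⊗_ : Mat → Mat → Mat
  mat p q r s ⊗ mat p′ q′ r′ s′ =
    mat (p * p′ + q * r′) (p * q′ + q * s′) (r * p′ + s * r′) (r * q′ + s * s′)

  _ᵀ : Mat → Mat
  mat p q r s ᵀ = mat p r q s

  -- On Fn n = (ℤ²)^⊗n: T M acts as M ⊗ … ⊗ M, and ∂ M as the derivation
  -- Σ 1 ⊗ … ⊗ M ⊗ … ⊗ 1.
  T : Mat → Fn n → Fn n
  T {zero} M f [] = f []
  T {suc n} M@(mat p q r s) f (true ∷ A) = p * T M (f ₁) A + q * T M (f ₀) A
  T {suc n} M@(mat p q r s) f (false ∷ A) = r * T M (f ₁) A + s * T M (f ₀) A

  ∂ : Mat → Fn n → Fn n
  ∂ {zero} M f [] = 0ℤ
  ∂ {suc n} M@(mat p q r s) f (true ∷ A) = ∂ M (f ₁) A + (p * f (true ∷ A) + q * f (false ∷ A))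
  ∂ {suc n} M@(mat p q r s) f (false ∷ A) = ∂ M (f ₀) A + (r * f (true ∷ A) + s * f (false ∷ A))

  T-cong : ∀ M {f g : Fn n} → f ≗ g → T M f ≗ T M g
  T-cong M e [] = e []
  T-cong M@(mat p q r s) e (true ∷ A) =
    cong₂ (λ x y → p * x + q * y) (T-cong M (λ B → e (true ∷ B)) A) (T-cong M (λ B → e (false ∷ B)) A)
  T-cong M@(mat p q r s) e (false ∷ A) =
    cong₂ (λ x y → r * x + s * y) (T-cong M (λ B → e (true ∷ B)) A) (T-cong M (λ B → e (false ∷ B)) A)

  ∂-cong : ∀ M {f g : Fn n} → f ≗ g → ∂ M f ≗ ∂ M g
  ∂-cong M e [] = refl
  ∂-cong M@(mat p q r s) e (true ∷ A) = cong₂ _+_ (∂-cong M (λ B → e (true ∷ B)) A)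
    (cong₂ (λ x y → p * x + q * y) (e (true ∷ A)) (e (false ∷ A)))
  ∂-cong M@(mat p q r s) e (false ∷ A) = cong₂ _+_ (∂-cong M (λ B → e (false ∷ B)) A)
    (cong₂ (λ x y → r * x + s * y) (e (true ∷ A)) (e (false ∷ A)))

  module _ where
    private
      swap : ∀ a b p q x y z w →
        p * (a * x + b * y) + q * (a * z + b * w) ≡ a * (p * x + q * z) + b * (p * y + q * w)
      swap = solve-∀

    T-lin : ∀ M a b (f g : Fn n) → T M (λ A → a * f A + b * g A) ≗ (λ A → a * T M f A + b * T M g A)
    T-lin M a b f g [] = refl
    T-lin M@(mat p q r s) a b f g (true ∷ A) = trans
      (cong₂ (λ x y → p * x + q * y) (T-lin M a b (f ₁) (g ₁) A) (T-lin M a b (f ₀) (g ₀) A))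
      (swap a b p q (T M (f ₁) A) (T M (g ₁) A) (T M (f ₀) A) (T M (g ₀) A))
    T-lin M@(mat p q r s) a b f g (false ∷ A) = trans
      (cong₂ (λ x y → r * x + s * y) (T-lin M a b (f ₁) (g ₁) A) (T-lin M a b (f ₀) (g ₀) A))
      (swap a b r s (T M (f ₁) A) (T M (g ₁) A) (T M (f ₀) A) (T M (g ₀) A))

  module _ where
    private
      swap : ∀ a b p q u v x y z w →
        a * u + b * v + (p * (a * x + b * y) + q * (a * z + b * w)) ≡
        a * (u + (p * x + q * z)) + b * (v + (p * y + q * w))
      swap = solve-∀
      nil : ∀ a b → 0ℤ ≡ a * 0ℤ + b * 0ℤ
      nil = solve-∀

    ∂-lin : ∀ M a b (f g : Fn n) → ∂ M (λ A → a * f A + b * g A) ≗ (λ A → a * ∂ M f A + b * ∂ M g A)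
    ∂-lin M a b f g [] = nil a b
    ∂-lin M@(mat p q r s) a b f g (true ∷ A) = trans (cong (_+ _) (∂-lin M a b (f ₁) (g ₁) A))
      (swap a b p q (∂ M (f ₁) A) (∂ M (g ₁) A) ((f ₁) A) ((g ₁) A) ((f ₀) A) ((g ₀) A))
    ∂-lin M@(mat p q r s) a b f g (false ∷ A) = trans (cong (_+ _) (∂-lin M a b (f ₀) (g ₀) A))
      (swap a b r s (∂ M (f ₀) A) (∂ M (g ₀) A) ((f ₁) A) ((g ₁) A) ((f ₀) A) ((g ₀) A))

  module _ where
    private
      mul : ∀ p q a b c d x y → p * (a * x + b * y) + q * (c * x + d * y) ≡ (p * a + q * c) * x + (p * b + q * d) * y
      mul = solve-∀

    T-∘ : ∀ M N (f : Fn n) → T M (T N f) ≗ T (M ⊗ N) f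
    T-∘ M N f [] = refl
    T-∘ M@(mat p q r s) N@(mat a b c d) f (true ∷ A) = trans
      (cong₂ (λ x y → p * x + q * y)
        (trans (T-lin M a b (T N (f ₁)) (T N (f ₀)) A) (cong₂ (λ x y → a * x + b * y) (T-∘ M N (f ₁) A) (T-∘ M N (f ₀) A)))
        (trans (T-lin M c d (T N (f ₁)) (T N (f ₀)) A) (cong₂ (λ x y → c * x + d * y) (T-∘ M N (f ₁) A) (T-∘ M N (f ₀) A))))
      (mul p q a b c d (T (M ⊗ N) (f ₁) A) (T (M ⊗ N) (f ₀) A))
    T-∘ M@(mat p q r s) N@(mat a b c d) f (false ∷ A) = trans
      (cong₂ (λ x y → r * x + s * y)
        (trans (T-lin M a b (T N (f ₁)) (T N (f ₀)) A) (cong₂ (λ x y → a * x + b * y) (T-∘ M N (f ₁) A) (T-∘ M N (f ₀) A)))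
        (trans (T-lin M c d (T N (f ₁)) (T N (f ₀)) A) (cong₂ (λ x y → c * x + d * y) (T-∘ M N (f ₁) A) (T-∘ M N (f ₀) A))))
      (mul r s a b c d (T (M ⊗ N) (f ₁) A) (T (M ⊗ N) (f ₀) A))

  T-adjoint : ∀ M (f g : Fn n) → ⟪ T M f , g ⟫ ≡ ⟪ f , T (M ᵀ) g ⟫
  T-adjoint {zero} M f g = refl
  T-adjoint {suc n} M@(mat p q r s) f g = begin
    ⟪ (λ A → p * F₁ A + q * F₀ A) , g ₁ ⟫ + ⟪ (λ A → r * F₁ A + s * F₀ A) , g ₀ ⟫
      ≡⟨ cong₂ _+_ (⟪⟫-linˡ p q F₁ F₀ (g ₁)) (⟪⟫-linˡ r s F₁ F₀ (g ₀)) ⟩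
    p * ⟪ F₁ , g ₁ ⟫ + q * ⟪ F₀ , g ₁ ⟫ + (r * ⟪ F₁ , g ₀ ⟫ + s * ⟪ F₀ , g ₀ ⟫)
      ≡⟨ cong₂ _+_ (cong₂ (λ x y → p * x + q * y) (ih (f ₁) (g ₁)) (ih (f ₀) (g ₁)))
                   (cong₂ (λ x y → r * x + s * y) (ih (f ₁) (g ₀)) (ih (f ₀) (g ₀))) ⟩
    p * ⟪ f ₁ , G₁ ⟫ + q * ⟪ f ₀ , G₁ ⟫ + (r * ⟪ f ₁ , G₀ ⟫ + s * ⟪ f ₀ , G₀ ⟫)
      ≡⟨ shuffle (p * ⟪ f ₁ , G₁ ⟫) (q * ⟪ f ₀ , G₁ ⟫) (r * ⟪ f ₁ , G₀ ⟫) (s * ⟪ f ₀ , G₀ ⟫) ⟩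
    p * ⟪ f ₁ , G₁ ⟫ + r * ⟪ f ₁ , G₀ ⟫ + (q * ⟪ f ₀ , G₁ ⟫ + s * ⟪ f ₀ , G₀ ⟫)
      ≡⟨ sym (cong₂ _+_ (⟪⟫-linʳ p r (f ₁) G₁ G₀) (⟪⟫-linʳ q s (f ₀) G₁ G₀)) ⟩
    ⟪ f ₁ , (λ A → p * G₁ A + r * G₀ A) ⟫ + ⟪ f ₀ , (λ A → q * G₁ A + s * G₀ A) ⟫ ∎
    where
    F₁ = T M (f ₁)
    F₀ = T M (f ₀)
    G₁ = T (M ᵀ) (g ₁)
    G₀ = T (M ᵀ) (g ₀)
    ih : (a b : Fn n) → ⟪ T M a , b ⟫ ≡ ⟪ a , T (M ᵀ) b ⟫
    ih = T-adjoint M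
    shuffle : ∀ a b c d → a + b + (c + d) ≡ a + c + (b + d)
    shuffle = solve-∀

  ∂-adjoint : ∀ M (f g : Fn n) → ⟪ ∂ M f , g ⟫ ≡ ⟪ f , ∂ (M ᵀ) g ⟫
  ∂-adjoint {zero} M f g = sym (*-zeroʳ (f []))
  ∂-adjoint {suc n} M@(mat p q r s) f g = begin
    ⟪ (λ A → ∂ M (f ₁) A + (p * f₁ A + q * f₀ A)) , g ₁ ⟫ + ⟪ (λ A → ∂ M (f ₀) A + (r * f₁ A + s * f₀ A)) , g ₀ ⟫
      ≡⟨ cong₂ _+_ (expandˡ (∂ M f₁) f₁ f₀ g₁ p q) (expandˡ (∂ M f₀) f₁ f₀ g₀ r s) ⟩
    ⟪ ∂ M f₁ , g₁ ⟫ + (p * ⟪ f₁ , g₁ ⟫ + q * ⟪ f₀ , g₁ ⟫) + (⟪ ∂ M f₀ , g₀ ⟫ + (r * ⟪ f₁ , g₀ ⟫ + s * ⟪ f₀ , g₀ ⟫))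
      ≡⟨ cong₂ (λ x y → x + (p * ⟪ f₁ , g₁ ⟫ + q * ⟪ f₀ , g₁ ⟫) + (y + (r * ⟪ f₁ , g₀ ⟫ + s * ⟪ f₀ , g₀ ⟫)))
           (∂-adjoint M f₁ g₁) (∂-adjoint M f₀ g₀) ⟩
    ⟪ f₁ , ∂ (M ᵀ) g₁ ⟫ + (p * ⟪ f₁ , g₁ ⟫ + q * ⟪ f₀ , g₁ ⟫) + (⟪ f₀ , ∂ (M ᵀ) g₀ ⟫ + (r * ⟪ f₁ , g₀ ⟫ + s * ⟪ f₀ , g₀ ⟫))
      ≡⟨ shuffle ⟪ f₁ , ∂ (M ᵀ) g₁ ⟫ (p * ⟪ f₁ , g₁ ⟫) (q * ⟪ f₀ , g₁ ⟫) ⟪ f₀ , ∂ (M ᵀ) g₀ ⟫ (r * ⟪ f₁ , g₀ ⟫) (s * ⟪ f₀ , g₀ ⟫) ⟩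
    ⟪ f₁ , ∂ (M ᵀ) g₁ ⟫ + (p * ⟪ f₁ , g₁ ⟫ + r * ⟪ f₁ , g₀ ⟫) + (⟪ f₀ , ∂ (M ᵀ) g₀ ⟫ + (q * ⟪ f₀ , g₁ ⟫ + s * ⟪ f₀ , g₀ ⟫))
      ≡⟨ sym (cong₂ _+_ (expandʳ (∂ (M ᵀ) g₁) g₁ g₀ f₁ p r) (expandʳ (∂ (M ᵀ) g₀) g₁ g₀ f₀ q s)) ⟩
    ⟪ f₁ , (λ A → ∂ (M ᵀ) g₁ A + (p * g₁ A + r * g₀ A)) ⟫ + ⟪ f₀ , (λ A → ∂ (M ᵀ) g₀ A + (q * g₁ A + s * g₀ A)) ⟫ ∎
    where
    f₁ = f ₁
    f₀ = f ₀
    g₁ = g ₁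
    g₀ = g ₀
    expandʳ : (u v w h : Fn n) (a b : ℤ) →
      ⟪ h , (λ A → u A + (a * v A + b * w A)) ⟫ ≡ ⟪ h , u ⟫ + (a * ⟪ h , v ⟫ + b * ⟪ h , w ⟫)
    expandʳ u v w h a b = begin
      ⟪ h , (λ A → u A + (a * v A + b * w A)) ⟫
        ≡⟨ ⟪⟫-cong {f = h} (λ _ → refl) (λ A → ones (u A) (a * v A + b * w A)) ⟩
      ⟪ h , (λ A → 1ℤ * u A + 1ℤ * (a * v A + b * w A)) ⟫
        ≡⟨ ⟪⟫-linʳ 1ℤ 1ℤ h u (λ A → a * v A + b * w A) ⟩
      1ℤ * ⟪ h , u ⟫ + 1ℤ * ⟪ h , (λ A → a * v A + b * w A) ⟫
        ≡⟨ sym (ones ⟪ h , u ⟫ ⟪ h , (λ A → a * v A + b * w A) ⟫) ⟩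
      ⟪ h , u ⟫ + ⟪ h , (λ A → a * v A + b * w A) ⟫
        ≡⟨ cong (λ z → ⟪ h , u ⟫ + z) (⟪⟫-linʳ a b h v w) ⟩
      ⟪ h , u ⟫ + (a * ⟪ h , v ⟫ + b * ⟪ h , w ⟫) ∎
      where
      ones : ∀ x y → x + y ≡ 1ℤ * x + 1ℤ * y
      ones = solve-∀
    expandˡ : (u v w h : Fn n) (a b : ℤ) →
      ⟪ (λ A → u A + (a * v A + b * w A)) , h ⟫ ≡ ⟪ u , h ⟫ + (a * ⟪ v , h ⟫ + b * ⟪ w , h ⟫)
    expandˡ u v w h a b = trans (⟪⟫-comm _ h) (trans (expandʳ u v w h a b)
      (cong₂ _+_ (⟪⟫-comm h u) (cong₂ (λ x y → a * x + b * y) (⟪⟫-comm h v) (⟪⟫-comm h w))))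
    shuffle : ∀ x a b y c d → x + (a + b) + (y + (c + d)) ≡ x + (a + c) + (y + (b + d))
    shuffle = solve-∀

  private
    ∂-lin₃ : ∀ M a b (u v w : Fn n) →
      ∂ M (λ A → u A + (a * v A + b * w A)) ≗ (λ A → ∂ M u A + (a * ∂ M v A + b * ∂ M w A))
    ∂-lin₃ M a b u v w A = begin
      ∂ M (λ B → u B + (a * v B + b * w B)) A ≡⟨ ∂-cong M (λ B → ones (u B) (a * v B + b * w B)) A ⟩
      ∂ M (λ B → 1ℤ * u B + 1ℤ * (a * v B + b * w B)) A ≡⟨ ∂-lin M 1ℤ 1ℤ u (λ B → a * v B + b * w B) A ⟩
      1ℤ * ∂ M u A + 1ℤ * ∂ M (λ B → a * v B + b * w B) A ≡⟨ sym (ones (∂ M u A) (∂ M (λ B → a * v B + b * w B) A)) ⟩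
      ∂ M u A + ∂ M (λ B → a * v B + b * w B) A ≡⟨ cong (λ z → ∂ M u A + z) (∂-lin M a b v w A) ⟩
      ∂ M u A + (a * ∂ M v A + b * ∂ M w A) ∎
      where
      ones : ∀ x y → x + y ≡ 1ℤ * x + 1ℤ * y
      ones = solve-∀

    T-lin₃ : ∀ M a b (u v w : Fn n) →
      T M (λ A → u A + (a * v A + b * w A)) ≗ (λ A → T M u A + (a * T M v A + b * T M w A))
    T-lin₃ M a b u v w A = begin
      T M (λ B → u B + (a * v B + b * w B)) A ≡⟨ T-cong M (λ B → ones (u B) (a * v B + b * w B)) A ⟩
      T M (λ B → 1ℤ * u B + 1ℤ * (a * v B + b * w B)) A ≡⟨ T-lin M 1ℤ 1ℤ u (λ B → a * v B + b * w B) A ⟩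
      1ℤ * T M u A + 1ℤ * T M (λ B → a * v B + b * w B) A ≡⟨ sym (ones (T M u A) (T M (λ B → a * v B + b * w B) A)) ⟩
      T M u A + T M (λ B → a * v B + b * w B) A ≡⟨ cong (λ z → T M u A + z) (T-lin M a b v w A) ⟩
      T M u A + (a * T M v A + b * T M w A) ∎
      where
      ones : ∀ x y → x + y ≡ 1ℤ * x + 1ℤ * y
      ones = solve-∀

  -- Intertwining and commutation relations.

  entry₁ entry₂ entry₃ entry₄ : Mat → ℤ
  entry₁ (mat p q r s) = p
  entry₂ (mat p q r s) = q
  entry₃ (mat p q r s) = r
  entry₄ (mat p q r s) = s

  T-0 : ∀ M → T {n} M (λ _ → 0ℤ) ≗ (λ _ → 0ℤ)
  T-0 M [] = refl
  T-0 M@(mat p q r s) (true ∷ A) rewrite T-0 M A = cong₂ _+_ (*-zeroʳ p) (*-zeroʳ q)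
  T-0 M@(mat p q r s) (false ∷ A) rewrite T-0 M A = cong₂ _+_ (*-zeroʳ r) (*-zeroʳ s)

  -- In the tensor factor where the derivation acts this is M N = N′ M, and the other factors agree
  -- on both sides. Thus N′ stands for the conjugate of N by M without any inverse being formed.
  T-∂ : ∀ M N N′ → M ⊗ N ≡ N′ ⊗ M → (f : Fn n) → T M (∂ N f) ≗ ∂ N′ (T M f)
  T-∂ M N N′ eq f [] = refl
  T-∂ M@(mat p q r s) N@(mat a b c d) N′@(mat a′ b′ c′ d′) eq f (true ∷ A) = begin
    p * T M (∂ N f ₁) A + q * T M (∂ N f ₀) A
      ≡⟨ cong₂ (λ x y → p * x + q * y)
           (trans (T-lin₃ M a b (∂ N (f ₁)) (f ₁) (f ₀) A) (cong (_+ _) (T-∂ M N N′ eq (f ₁) A)))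
           (trans (T-lin₃ M c d (∂ N (f ₀)) (f ₁) (f ₀) A) (cong (_+ _) (T-∂ M N N′ eq (f ₀) A))) ⟩
    p * (∂ N′ F₁ A + (a * F₁ A + b * F₀ A)) + q * (∂ N′ F₀ A + (c * F₁ A + d * F₀ A))
      ≡⟨ collect p q a b c d (∂ N′ F₁ A) (∂ N′ F₀ A) (F₁ A) (F₀ A) ⟩
    p * ∂ N′ F₁ A + q * ∂ N′ F₀ A + ((p * a + q * c) * F₁ A + (p * b + q * d) * F₀ A)
      ≡⟨ cong₂ (λ x y → p * ∂ N′ F₁ A + q * ∂ N′ F₀ A + (x * F₁ A + y * F₀ A)) (cong entry₁ eq) (cong entry₂ eq) ⟩
    p * ∂ N′ F₁ A + q * ∂ N′ F₀ A + ((a′ * p + b′ * r) * F₁ A + (a′ * q + b′ * s) * F₀ A)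
      ≡⟨ cong₂ _+_ (sym (∂-lin N′ p q F₁ F₀ A)) (sym (mul a′ b′ p q r s (F₁ A) (F₀ A))) ⟩
    ∂ N′ (λ B → p * F₁ B + q * F₀ B) A + (a′ * (p * F₁ A + q * F₀ A) + b′ * (r * F₁ A + s * F₀ A)) ∎
    where
    F₁ = T M (f ₁)
    F₀ = T M (f ₀)
    collect : ∀ p q a b c d u v x y →
      p * (u + (a * x + b * y)) + q * (v + (c * x + d * y)) ≡
      p * u + q * v + ((p * a + q * c) * x + (p * b + q * d) * y)
    collect = solve-∀
    mul : ∀ a b p q r s x y → a * (p * x + q * y) + b * (r * x + s * y) ≡ (a * p + b * r) * x + (a * q + b * s) * y
    mul = solve-∀
  T-∂ M@(mat p q r s) N@(mat a b c d) N′@(mat a′ b′ c′ d′) eq f (false ∷ A) = begin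
    r * T M (∂ N f ₁) A + s * T M (∂ N f ₀) A
      ≡⟨ cong₂ (λ x y → r * x + s * y)
           (trans (T-lin₃ M a b (∂ N (f ₁)) (f ₁) (f ₀) A) (cong (_+ _) (T-∂ M N N′ eq (f ₁) A)))
           (trans (T-lin₃ M c d (∂ N (f ₀)) (f ₁) (f ₀) A) (cong (_+ _) (T-∂ M N N′ eq (f ₀) A))) ⟩
    r * (∂ N′ F₁ A + (a * F₁ A + b * F₀ A)) + s * (∂ N′ F₀ A + (c * F₁ A + d * F₀ A))
      ≡⟨ collect r s a b c d (∂ N′ F₁ A) (∂ N′ F₀ A) (F₁ A) (F₀ A) ⟩
    r * ∂ N′ F₁ A + s * ∂ N′ F₀ A + ((r * a + s * c) * F₁ A + (r * b + s * d) * F₀ A)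
      ≡⟨ cong₂ (λ x y → r * ∂ N′ F₁ A + s * ∂ N′ F₀ A + (x * F₁ A + y * F₀ A)) (cong entry₃ eq) (cong entry₄ eq) ⟩
    r * ∂ N′ F₁ A + s * ∂ N′ F₀ A + ((c′ * p + d′ * r) * F₁ A + (c′ * q + d′ * s) * F₀ A)
      ≡⟨ cong₂ _+_ (sym (∂-lin N′ r s F₁ F₀ A)) (sym (mul c′ d′ p q r s (F₁ A) (F₀ A))) ⟩
    ∂ N′ (λ B → r * F₁ B + s * F₀ B) A + (c′ * (p * F₁ A + q * F₀ A) + d′ * (r * F₁ A + s * F₀ A)) ∎
    where
    F₁ = T M (f ₁)
    F₀ = T M (f ₀)
    collect : ∀ p q a b c d u v x y →
      p * (u + (a * x + b * y)) + q * (v + (c * x + d * y)) ≡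
      p * u + q * v + ((p * a + q * c) * x + (p * b + q * d) * y)
    collect = solve-∀
    mul : ∀ a b p q r s x y → a * (p * x + q * y) + b * (r * x + s * y) ≡ (a * p + b * r) * x + (a * q + b * s) * y
    mul = solve-∀

  [_,_] : Mat → Mat → Mat
  [ mat p q r s , mat a b c d ] = mat
    (p * a + q * c - (a * p + b * r)) (p * b + q * d - (a * q + b * s))
    (r * a + s * c - (c * p + d * r)) (r * b + s * d - (c * q + d * s))

  -- Derivations in different tensor factors commute, so only the commutator within one factor
  -- survives: `∂` is a representation of the Lie algebra gl₂.
  ∂-commutator : ∀ M N (f : Fn n) → ∂ M (∂ N f) ≗ (λ A → ∂ N (∂ M f) A + ∂ [ M , N ] f A)
  ∂-commutator M@(mat p q r s) N@(mat a b c d) f [] = refl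
  ∂-commutator M@(mat p q r s) N@(mat a b c d) f (true ∷ A) = begin
    ∂ M (λ B → ∂ N f₁ B + (a * f₁ B + b * f₀ B)) A + (p * (∂ N f₁ A + (a * f₁ A + b * f₀ A)) + q * (∂ N f₀ A + (c * f₁ A + d * f₀ A)))
      ≡⟨ cong₂ _+_ (trans (∂-lin₃ M a b (∂ N f₁) f₁ f₀ A) (cong₂ _+_ (∂-commutator M N f₁ A) refl)) refl ⟩
    ∂ N (∂ M f₁) A + ∂ C f₁ A + (a * ∂ M f₁ A + b * ∂ M f₀ A) + (p * (∂ N f₁ A + (a * f₁ A + b * f₀ A)) + q * (∂ N f₀ A + (c * f₁ A + d * f₀ A)))
      ≡⟨ collect p q r s a b c d (∂ N (∂ M f₁) A) (∂ C f₁ A) (∂ M f₁ A) (∂ M f₀ A) (∂ N f₁ A) (∂ N f₀ A) (f₁ A) (f₀ A) ⟩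
    ∂ N (∂ M f₁) A + (p * ∂ N f₁ A + q * ∂ N f₀ A)
      + (a * (∂ M f₁ A + (p * f₁ A + q * f₀ A)) + b * (∂ M f₀ A + (r * f₁ A + s * f₀ A)))
      + (∂ C f₁ A + ((p * a + q * c - (a * p + b * r)) * f₁ A + (p * b + q * d - (a * q + b * s)) * f₀ A))
      ≡⟨ cong₂ _+_ (cong₂ _+_ (sym (∂-lin₃ N p q (∂ M f₁) f₁ f₀ A)) refl) refl ⟩
    ∂ N (λ B → ∂ M f₁ B + (p * f₁ B + q * f₀ B)) A
      + (a * (∂ M f₁ A + (p * f₁ A + q * f₀ A)) + b * (∂ M f₀ A + (r * f₁ A + s * f₀ A)))
      + (∂ C f₁ A + ((p * a + q * c - (a * p + b * r)) * f₁ A + (p * b + q * d - (a * q + b * s)) * f₀ A)) ∎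
    where
    f₁ = f ₁
    f₀ = f ₀
    C = [ M , N ]
    collect : ∀ p q r s a b c d u v m₁ m₀ n₁ n₀ x y →
      u + v + (a * m₁ + b * m₀) + (p * (n₁ + (a * x + b * y)) + q * (n₀ + (c * x + d * y))) ≡
      u + (p * n₁ + q * n₀) + (a * (m₁ + (p * x + q * y)) + b * (m₀ + (r * x + s * y)))
        + (v + ((p * a + q * c - (a * p + b * r)) * x + (p * b + q * d - (a * q + b * s)) * y))
    collect = solve-∀
  ∂-commutator M@(mat p q r s) N@(mat a b c d) f (false ∷ A) = begin
    ∂ M (λ B → ∂ N f₀ B + (c * f₁ B + d * f₀ B)) A + (r * (∂ N f₁ A + (a * f₁ A + b * f₀ A)) + s * (∂ N f₀ A + (c * f₁ A + d * f₀ A)))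
      ≡⟨ cong₂ _+_ (trans (∂-lin₃ M c d (∂ N f₀) f₁ f₀ A) (cong₂ _+_ (∂-commutator M N f₀ A) refl)) refl ⟩
    ∂ N (∂ M f₀) A + ∂ C f₀ A + (c * ∂ M f₁ A + d * ∂ M f₀ A) + (r * (∂ N f₁ A + (a * f₁ A + b * f₀ A)) + s * (∂ N f₀ A + (c * f₁ A + d * f₀ A)))
      ≡⟨ collect p q r s a b c d (∂ N (∂ M f₀) A) (∂ C f₀ A) (∂ M f₁ A) (∂ M f₀ A) (∂ N f₁ A) (∂ N f₀ A) (f₁ A) (f₀ A) ⟩
    ∂ N (∂ M f₀) A + (r * ∂ N f₁ A + s * ∂ N f₀ A)
      + (c * (∂ M f₁ A + (p * f₁ A + q * f₀ A)) + d * (∂ M f₀ A + (r * f₁ A + s * f₀ A)))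
      + (∂ C f₀ A + ((r * a + s * c - (c * p + d * r)) * f₁ A + (r * b + s * d - (c * q + d * s)) * f₀ A))
      ≡⟨ cong₂ _+_ (cong₂ _+_ (sym (∂-lin₃ N r s (∂ M f₀) f₁ f₀ A)) refl) refl ⟩
    ∂ N (λ B → ∂ M f₀ B + (r * f₁ B + s * f₀ B)) A
      + (c * (∂ M f₁ A + (p * f₁ A + q * f₀ A)) + d * (∂ M f₀ A + (r * f₁ A + s * f₀ A)))
      + (∂ C f₀ A + ((r * a + s * c - (c * p + d * r)) * f₁ A + (r * b + s * d - (c * q + d * s)) * f₀ A)) ∎
    where
    f₁ = f ₁
    f₀ = f ₀
    C = [ M , N ]
    collect : ∀ p q r s a b c d u v m₁ m₀ n₁ n₀ x y →
      u + v + (c * m₁ + d * m₀) + (r * (n₁ + (a * x + b * y)) + s * (n₀ + (c * x + d * y))) ≡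
      u + (r * n₁ + s * n₀) + (c * (m₁ + (p * x + q * y)) + d * (m₀ + (r * x + s * y)))
        + (v + ((r * a + s * c - (c * p + d * r)) * x + (r * b + s * d - (c * q + d * s)) * y))
    collect = solve-∀

  -- (Z f)(A) = Σ_{B ∩ A = ∅} f(B), so on functions supported on k-sets Z is the adjacency
  -- operator of K(n,k).  U and D are the up and down operators, L multiplies by ∣ A ∣.
  U D L Z E P : Fn n → Fn n
  U = ∂ (mat 0ℤ 1ℤ 0ℤ 0ℤ)
  D = ∂ (mat 0ℤ 0ℤ 1ℤ 0ℤ)
  L = ∂ (mat 1ℤ 0ℤ 0ℤ 0ℤ)
  Z = T (mat 0ℤ 1ℤ 1ℤ 1ℤ)
  E = T (mat 1ℤ 0ℤ 1ℤ 1ℤ)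
  P = T (mat -1ℤ 0ℤ 0ℤ 1ℤ)

  -- The gl₂ relations as operator identities.

  # : Subset n → ℤ
  # A = + ∣ A ∣

  -- A diagonal matrix multiplies by p for each element of A and by s for each element outside. This
  -- lets a 2×2 computation be read as a relation between `U`, `D` and the size of the set.
  ∂-expand : ∀ p q r s (f : Fn n) (A : Subset n) →
    ∂ (mat p q r s) f A ≡ (p * # A + s * (+ n - # A)) * f A + (q * U f A + r * D f A)
  ∂-expand p q r s f [] = nil p q r s (f [])
    where
    nil : ∀ p q r s x → 0ℤ ≡ (p * 0ℤ + s * (0ℤ - 0ℤ)) * x + (q * 0ℤ + r * 0ℤ)
    nil = solve-∀
  ∂-expand {suc n} p q r s f (true ∷ A) = trans (cong (_+ _) (∂-expand p q r s (f ₁) A))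
    (step p q r s (# A) (+ n) (f (true ∷ A)) (f (false ∷ A)) (U (f ₁) A) (D (f ₁) A))
    where
    step : ∀ p q r s a m x y u v →
      (p * a + s * (m - a)) * x + (q * u + r * v) + (p * x + q * y) ≡
      (p * (1ℤ + a) + s * ((1ℤ + m) - (1ℤ + a))) * x
        + (q * (u + (0ℤ * x + 1ℤ * y)) + r * (v + (0ℤ * x + 0ℤ * y)))
    step = solve-∀
  ∂-expand {suc n} p q r s f (false ∷ A) = trans (cong (_+ _) (∂-expand p q r s (f ₀) A))
    (step p q r s (# A) (+ n) (f (true ∷ A)) (f (false ∷ A)) (U (f ₀) A) (D (f ₀) A))
    where
    step : ∀ p q r s a m x y u v →
      (p * a + s * (m - a)) * y + (q * u + r * v) + (r * x + s * y) ≡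
      (p * a + s * ((1ℤ + m) - a)) * y
        + (q * (u + (0ℤ * x + 0ℤ * y)) + r * (v + (1ℤ * x + 0ℤ * y)))
    step = solve-∀

  L≗ : (f : Fn n) → L f ≗ (λ A → # A * f A)
  L≗ {n} f A = trans (∂-expand 1ℤ 0ℤ 0ℤ 0ℤ f A) (tidy (# A) (+ n) (f A) (U f A) (D f A))
    where
    tidy : ∀ a m x u v → (1ℤ * a + 0ℤ * (m - a)) * x + (0ℤ * u + 0ℤ * v) ≡ a * x
    tidy = solve-∀

  -- The sl₂ relation: the commutator of D and U is the weight operator diag(-1, 1), which
  -- multiplies by n - 2∣ A ∣.
  DU : (f : Fn n) (A : Subset n) → D (U f) A ≡ U (D f) A + (+ n - + 2 * # A) * f A
  DU {n} f A = trans (∂-commutator (mat 0ℤ 0ℤ 1ℤ 0ℤ) (mat 0ℤ 1ℤ 0ℤ 0ℤ) f A)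
    (cong (λ z → U (D f) A + z) (trans (∂-expand -1ℤ 0ℤ 0ℤ 1ℤ f A) (tidy (# A) (+ n) (f A) (U f A) (D f A))))
    where
    tidy : ∀ a m x u v → (-1ℤ * a + 1ℤ * (m - a)) * x + (0ℤ * u + 0ℤ * v) ≡ (m - + 2 * a) * x
    tidy = solve-∀

  LU : (f : Fn n) → L (U f) ≗ (λ A → U (L f) A + U f A)
  LU f A = ∂-commutator (mat 1ℤ 0ℤ 0ℤ 0ℤ) (mat 0ℤ 1ℤ 0ℤ 0ℤ) f A

  LD : (f : Fn n) → L (D f) ≗ (λ A → D (L f) A - D f A)
  LD {n} f A = trans (∂-commutator (mat 1ℤ 0ℤ 0ℤ 0ℤ) (mat 0ℤ 0ℤ 1ℤ 0ℤ) f A)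
    (cong (λ z → D (L f) A + z) (trans (∂-expand 0ℤ 0ℤ -1ℤ 0ℤ f A) (tidy (# A) (+ n) (f A) (U f A) (D f A))))
    where
    tidy : ∀ a m x u v → (0ℤ * a + 0ℤ * (m - a)) * x + (0ℤ * u + -1ℤ * v) ≡ - v
    tidy = solve-∀

  -- Conjugation by `Z` permutes the derivations. In this identity and the similar ones for `Z` and
  -- `E` below, `refl` checks one product of 2×2 integer matrices.
  ZU : (f : Fn n) → Z (U f) ≗ D (Z f)
  ZU f = T-∂ _ _ _ refl f

  ZL : (f : Fn n) (A : Subset n) → Z (L f) A ≡ (+ n - # A) * Z f A - D (Z f) A
  ZL {n} f A = trans (T-∂ _ _ (mat 0ℤ 0ℤ -1ℤ 1ℤ) refl f A)
    (trans (∂-expand 0ℤ 0ℤ -1ℤ 1ℤ (Z f) A) (tidy (# A) (+ n) (Z f A) (U (Z f) A) (D (Z f) A)))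
    where
    tidy : ∀ a m x u v → (0ℤ * a + 1ℤ * (m - a)) * x + (0ℤ * u + -1ℤ * v) ≡ (m - a) * x - v
    tidy = solve-∀

  ZD : (f : Fn n) (A : Subset n) → Z (D f) A ≡ U (Z f) A - D (Z f) A + (+ n - + 2 * # A) * Z f A
  ZD {n} f A = trans (T-∂ _ _ (mat -1ℤ 1ℤ -1ℤ 1ℤ) refl f A)
    (trans (∂-expand -1ℤ 1ℤ -1ℤ 1ℤ (Z f) A) (tidy (# A) (+ n) (Z f A) (U (Z f) A) (D (Z f) A)))
    where
    tidy : ∀ a m x u v → (-1ℤ * a + 1ℤ * (m - a)) * x + (1ℤ * u + -1ℤ * v) ≡ u - v + (m - + 2 * a) * x
    tidy = solve-∀

  ED : (f : Fn n) → E (D f) ≗ D (E f)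
  ED f = T-∂ _ _ _ refl f

  EL : (f : Fn n) (A : Subset n) → E (L f) A ≡ # A * E f A + D (E f) A
  EL {n} f A = trans (T-∂ _ _ (mat 1ℤ 0ℤ 1ℤ 0ℤ) refl f A)
    (trans (∂-expand 1ℤ 0ℤ 1ℤ 0ℤ (E f) A) (tidy (# A) (+ n) (E f A) (U (E f) A) (D (E f) A)))
    where
    tidy : ∀ a m x u v → (1ℤ * a + 0ℤ * (m - a)) * x + (0ℤ * u + 1ℤ * v) ≡ a * x + v
    tidy = solve-∀

  Z-adjoint : (f g : Fn n) → ⟪ Z f , g ⟫ ≡ ⟪ f , Z g ⟫
  Z-adjoint = T-adjoint (mat 0ℤ 1ℤ 1ℤ 1ℤ)

  U-adjoint : (f g : Fn n) → ⟪ U f , g ⟫ ≡ ⟪ f , D g ⟫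
  U-adjoint = ∂-adjoint (mat 0ℤ 1ℤ 0ℤ 0ℤ)

  -- Inclusion–exclusion: Z = Eᵀ P E, where (E f)(J) = Σ_{B ⊇ J} f(B).
  Z-form : (f g : Fn n) → ⟪ f , Z g ⟫ ≡ ⟪ E f , P (E g) ⟫
  Z-form f g = sym (trans (T-adjoint (mat 1ℤ 0ℤ 1ℤ 1ℤ) f (P (E g)))
    (⟪⟫-cong {f = f} (λ _ → refl) (λ A → trans (T-cong _ (T-∘ _ _ g) A) (T-∘ _ _ g A))))

  -- Harmonic functions and the spectrum of K(n,k)

  *-nonneg : ∀ {a b} → 0ℤ ≤ a → 0ℤ ≤ b → 0ℤ ≤ a * b
  *-nonneg {+ a} {+ b} _ _ = subst (0ℤ ≤_) (pos-* a b) (+≤+ ℕ.z≤n)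

  *-pos : ∀ {a b} → 0ℤ < a → 0ℤ < b → 0ℤ < a * b
  *-pos {+ suc a} {+ suc b} _ _ = +<+ ℕ.z<s
  *-pos {+ zero} (+<+ ()) _
  *-pos {+ suc a} {+ zero} _ (+<+ ())

  +-nonneg : ∀ {a b} → 0ℤ ≤ a → 0ℤ ≤ b → 0ℤ ≤ a + b
  +-nonneg = +-mono-≤

  square-nonneg : ∀ a → 0ℤ ≤ a * a
  square-nonneg (+ a) = *-nonneg {+ a} {+ a} (+≤+ ℕ.z≤n) (+≤+ ℕ.z≤n)
  square-nonneg -[1+ a ] = +≤+ ℕ.z≤n

  cancel-nonneg : ∀ {a b} → 0ℤ < a → 0ℤ ≤ a * b → 0ℤ ≤ b
  cancel-nonneg {a} {b} a>0 ab≥0 =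
    *-cancelˡ-≤-pos 0ℤ b a {{positive a>0}} (subst (_≤ a * b) (sym (*-zeroʳ a)) ab≥0)

  ∑-nonneg : {f : Fn n} → (∀ A → 0ℤ ≤ f A) → 0ℤ ≤ ∑ f
  ∑-nonneg {zero} p = p []
  ∑-nonneg {suc n} p = +-nonneg (∑-nonneg (λ A → p (true ∷ A))) (∑-nonneg (λ A → p (false ∷ A)))

  ∂-0 : ∀ M → ∂ {n} M (λ _ → 0ℤ) ≗ (λ _ → 0ℤ)
  ∂-0 M [] = refl
  ∂-0 M@(mat p q r s) (true ∷ A) rewrite ∂-0 M A = cong₂ (λ x y → 0ℤ + (x + y)) (*-zeroʳ p) (*-zeroʳ q)
  ∂-0 M@(mat p q r s) (false ∷ A) rewrite ∂-0 M A = cong₂ (λ x y → 0ℤ + (x + y)) (*-zeroʳ r) (*-zeroʳ s)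

  ∂-scale : ∀ M a (f : Fn n) → ∂ M (λ A → a * f A) ≗ (λ A → a * ∂ M f A)
  ∂-scale M a f A = trans (∂-cong M (λ B → pad a (f B)) A)
    (trans (∂-lin M a 0ℤ f f A) (sym (pad a (∂ M f A))))
    where
    pad : ∀ a x → a * x ≡ a * x + 0ℤ * x
    pad = solve-∀

  T-scale : ∀ M a (f : Fn n) → T M (λ A → a * f A) ≗ (λ A → a * T M f A)
  T-scale M a f A = trans (T-cong M (λ B → pad a (f B)) A)
    (trans (T-lin M a 0ℤ f f A) (sym (pad a (T M f A))))
    where
    pad : ∀ a x → a * x ≡ a * x + 0ℤ * x
    pad = solve-∀

  -- An eigenvalue equation for `L` rather than a support condition, so that `U` and `D` shift
  -- levels by the commutation relations alone. `level-vanish` recovers the support.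
  record Level (l : ℤ) (f : Fn n) : Set where
    constructor level
    field at : ∀ A → # A * f A ≡ l * f A
  open Level

  Harmonic : Fn n → Set
  Harmonic f = D f ≗ (λ _ → 0ℤ)

  level-vanish : ∀ {i} {f : Fn n} → Level (+ i) f → ∀ A → ∣ A ∣ ≡ i ⊎ f A ≡ 0ℤ
  level-vanish {i = i} {f} lf A with ∣ A ∣ ℕ.≟ i
  ... | yes e = inj₁ e
  ... | no ne with i*j≡0⇒i≡0∨j≡0 (# A - + i) {f A} (trans (expand (# A) (+ i) (f A)) (i≡j⇒i-j≡0 (at lf A)))
    where
    expand : ∀ a b x → (a - b) * x ≡ a * x - b * x
    expand = solve-∀
  ...   | inj₁ e = contradiction (+-injective (i-j≡0⇒i≡j (# A) (+ i) e)) ne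
  ...   | inj₂ e = inj₂ e

  vanish-level : ∀ {i} {f : Fn n} → (∀ A → ∣ A ∣ ≢ i → f A ≡ 0ℤ) → Level (+ i) f
  vanish-level {n} {i = i} {f} v = level go
    where
    go : ∀ A → # A * f A ≡ + i * f A
    go A with ∣ A ∣ ℕ.≟ i
    ... | yes refl = refl
    ... | no ne = trans (cong (# A *_) (v A ne)) (trans (*-zeroʳ (# A)) (sym (trans (cong (+ i *_) (v A ne)) (*-zeroʳ (+ i)))))

  Level-U : ∀ {l} {f : Fn n} → Level l f → Level (1ℤ + l) (U f)
  Level-U {l = l} {f} lf = level λ A → begin
    # A * U f A ≡⟨ sym (L≗ (U f) A) ⟩
    L (U f) A ≡⟨ LU f A ⟩
    U (L f) A + U f A ≡⟨ cong (_+ U f A) (trans (∂-cong _ (λ B → trans (L≗ f B) (at lf B)) A) (∂-scale _ l f A)) ⟩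
    l * U f A + U f A ≡⟨ tidy l (U f A) ⟩
    (1ℤ + l) * U f A ∎
    where
    tidy : ∀ l x → l * x + x ≡ (1ℤ + l) * x
    tidy = solve-∀

  Level-D : ∀ {l} {f : Fn n} → Level (1ℤ + l) f → Level l (D f)
  Level-D {l = l} {f} lf = level λ A → begin
    # A * D f A ≡⟨ sym (L≗ (D f) A) ⟩
    L (D f) A ≡⟨ LD f A ⟩
    D (L f) A - D f A ≡⟨ cong (_- D f A) (trans (∂-cong _ (λ B → trans (L≗ f B) (at lf B)) A) (∂-scale _ (1ℤ + l) f A)) ⟩
    (1ℤ + l) * D f A - D f A ≡⟨ tidy l (D f A) ⟩
    l * D f A ∎
    where
    tidy : ∀ l x → (1ℤ + l) * x - x ≡ l * x
    tidy = solve-∀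

  -- `U^` grows on the outside and `D^` on the inside, which makes `U^-adjoint` a plain induction.
  U^ D^ : ℕ → Fn n → Fn n
  U^ zero f = f
  U^ (suc r) f = U (U^ r f)
  D^ zero f = f
  D^ (suc r) f = D^ r (D f)

  D^-cong : ∀ r {f g : Fn n} → f ≗ g → D^ r f ≗ D^ r g
  D^-cong zero e = e
  D^-cong (suc r) e = D^-cong r (∂-cong _ e)

  D^-lin : ∀ r a b (f g : Fn n) → D^ r (λ A → a * f A + b * g A) ≗ (λ A → a * D^ r f A + b * D^ r g A)
  D^-lin zero a b f g A = refl
  D^-lin (suc r) a b f g A = trans (D^-cong r (∂-lin _ a b f g) A) (D^-lin r a b (D f) (D g) A)

  D^-scale : ∀ r a (f : Fn n) → D^ r (λ A → a * f A) ≗ (λ A → a * D^ r f A)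
  D^-scale zero a f A = refl
  D^-scale (suc r) a f A = trans (D^-cong r (∂-scale _ a f) A) (D^-scale r a (D f) A)

  D-D^ : ∀ r (f : Fn n) → D (D^ r f) ≗ D^ r (D f)
  D-D^ zero f A = refl
  D-D^ (suc r) f A = D-D^ r (D f) A

  U^-adjoint : ∀ r (f g : Fn n) → ⟪ U^ r f , g ⟫ ≡ ⟪ f , D^ r g ⟫
  U^-adjoint zero f g = refl
  U^-adjoint (suc r) f g = trans (U-adjoint (U^ r f) g) (U^-adjoint r f (D g))

  Level-U^ : ∀ r {i} {f : Fn n} → Level (+ i) f → Level (+ (r ℕ.+ i)) (U^ r f)
  Level-U^ zero lf = lf
  Level-U^ (suc r) lf = Level-U (Level-U^ r lf)

  Level-D^ : ∀ r {i} {f : Fn n} → Level (+ (r ℕ.+ i)) f → Level (+ i) (D^ r f)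
  Level-D^ zero lf = lf
  Level-D^ (suc r) lf = Level-D^ r (Level-D lf)

  module _ {n i : ℕ} {y : Fn n} (ly : Level (+ i) y) (hy : Harmonic y) where

    -- The lowest weight computation for sl₂: moving D through the factors U collects the weights n
    -- - 2(i + j) for j = 0, ..., r, whose sum is (r + 1)(n - 2i - r).
    D-U^ : ∀ r → D (U^ (suc r) y) ≗ (λ A → + suc r * (+ n - + 2 * + i - + r) * U^ r y A)
    D-U^ zero A = begin
      D (U y) A ≡⟨ DU y A ⟩
      U (D y) A + (+ n - + 2 * # A) * y A ≡⟨ cong₂ _+_ (trans (∂-cong _ hy A) (∂-0 _ A)) (push (+ n) (# A) (y A)) ⟩
      0ℤ + (+ n * y A - + 2 * (# A * y A)) ≡⟨ cong (λ z → 0ℤ + (+ n * y A - + 2 * z)) (at ly A) ⟩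
      0ℤ + (+ n * y A - + 2 * (+ i * y A)) ≡⟨ pull (+ n) (+ i) (y A) ⟩
      1ℤ * (+ n - + 2 * + i - 0ℤ) * y A ∎
      where
      push : ∀ m a x → (m - + 2 * a) * x ≡ m * x - + 2 * (a * x)
      push = solve-∀
      pull : ∀ m a x → 0ℤ + (m * x - + 2 * (a * x)) ≡ 1ℤ * (m - + 2 * a - 0ℤ) * x
      pull = solve-∀
    D-U^ (suc r) A = begin
      D (U u) A ≡⟨ DU u A ⟩
      U (D u) A + (+ n - + 2 * # A) * u A
        ≡⟨ cong₂ _+_ (trans (∂-cong _ (D-U^ r) A) (∂-scale _ (+ suc r * (+ n - + 2 * + i - + r)) (U^ r y) A)) (push (+ n) (# A) (u A)) ⟩
      + suc r * (+ n - + 2 * + i - + r) * u A + (+ n * u A - + 2 * (# A * u A))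
        ≡⟨ cong (λ z → + suc r * (+ n - + 2 * + i - + r) * u A + (+ n * u A - + 2 * z)) (at (Level-U^ (suc r) ly) A) ⟩
      + suc r * (+ n - + 2 * + i - + r) * u A + (+ n * u A - + 2 * (+ (suc r ℕ.+ i) * u A))
        ≡⟨ pull (+ n) (+ i) (+ r) (u A) ⟩
      + suc (suc r) * (+ n - + 2 * + i - + suc r) * u A ∎
      where
      u = U^ (suc r) y
      push : ∀ m a x → (m - + 2 * a) * x ≡ m * x - + 2 * (a * x)
      push = solve-∀
      pull : ∀ m i r x → (1ℤ + r) * (m - + 2 * i - r) * x + (m * x - + 2 * ((1ℤ + r + i) * x)) ≡
        (1ℤ + (1ℤ + r)) * (m - + 2 * i - (1ℤ + r)) * x
      pull = solve-∀

    -- This is r! times the falling factorial of n - 2i, the ratio of the squared norms of `U^ r y`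
    -- and y. It appears as a multiplier wherever a projection would divide by it.
    κ : ℕ → ℤ
    κ zero = 1ℤ
    κ (suc r) = + suc r * (+ n - + 2 * + i - + r) * κ r

    D^-U^ : ∀ r → D^ r (U^ r y) ≗ (λ A → κ r * y A)
    D^-U^ zero A = sym (*-identityˡ (y A))
    D^-U^ (suc r) A = begin
      D^ r (D (U^ (suc r) y)) A ≡⟨ D^-cong r (D-U^ r) A ⟩
      D^ r (λ B → c * U^ r y B) A ≡⟨ D^-scale r c (U^ r y) A ⟩
      c * D^ r (U^ r y) A ≡⟨ cong (c *_) (D^-U^ r A) ⟩
      c * (κ r * y A) ≡⟨ sym (*-assoc c (κ r) (y A)) ⟩
      c * κ r * y A ∎
      where c = + suc r * (+ n - + 2 * + i - + r)

    κ-pos : ∀ r → 2 ℕ.* i ℕ.+ r ℕ.≤ n → 0ℤ < κ r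
    κ-pos zero _ = +<+ ℕ.z<s
    κ-pos (suc r) le = *-pos (*-pos {+ suc r} (+<+ ℕ.z<s) gap)
      (κ-pos r (ℕ.≤-trans (ℕ.+-monoʳ-≤ (2 ℕ.* i) (ℕ.n≤1+n r)) le))
      where
      regroup : 1ℤ + (+ n - + (2 ℕ.* i ℕ.+ suc r)) ≡ + n - + 2 * + i - + r
      regroup = trans (cong (λ z → 1ℤ + (+ n - z)) (trans (pos-+ (2 ℕ.* i) (suc r)) (cong (_+ + suc r) (pos-* 2 i))))
        (ring (+ n) (+ 2 * + i) (+ r))
        where
        ring : ∀ a b c → 1ℤ + (a - (b + (1ℤ + c))) ≡ a - b - c
        ring = solve-∀
      gap : 0ℤ < + n - + 2 * + i - + r
      gap = subst (0ℤ <_) regroup (+-mono-<-≤ (+<+ ℕ.z<s) (i≤j⇒0≤j-i (+≤+ le)))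

  -- Binomial coefficients and falling factorials.

  bin : ℕ → ℕ → ℕ
  bin m zero = 1
  bin zero (suc r) = 0
  bin (suc m) (suc r) = bin m r ℕ.+ bin m (suc r)

  -- Stated over ℤ, where m - r is a true difference; beyond r = m both sides vanish with `bin`.
  bin-absorb : ∀ m r → + suc r * + bin m (suc r) ≡ (+ m - + r) * + bin m r
  bin-absorb zero zero = refl
  bin-absorb zero (suc r) = trans (*-zeroʳ (+ suc (suc r))) (sym (*-zeroʳ (0ℤ - + suc r)))
  bin-absorb (suc m) zero = trans (cong (λ z → 1ℤ * (1ℤ + z)) (trans (sym (*-identityˡ (+ bin m 1))) (bin-absorb m 0)))
    (ring (+ m))
    where
    ring : ∀ m → 1ℤ * (1ℤ + (m - 0ℤ) * 1ℤ) ≡ (1ℤ + m - 0ℤ) * 1ℤ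
    ring = solve-∀
  bin-absorb (suc m) (suc r) = begin
    + suc (suc r) * (+ bin m (suc r) + + bin m (suc (suc r))) ≡⟨ *-distribˡ-+ (+ suc (suc r)) (+ bin m (suc r)) (+ bin m (suc (suc r))) ⟩
    + suc (suc r) * + bin m (suc r) + + suc (suc r) * + bin m (suc (suc r)) ≡⟨ cong (λ z → + suc (suc r) * + bin m (suc r) + z) (bin-absorb m (suc r)) ⟩
    + suc (suc r) * + bin m (suc r) + (+ m - + suc r) * + bin m (suc r) ≡⟨ ring₁ (+ m) (+ r) (+ bin m (suc r)) ⟩
    + suc r * + bin m (suc r) + (+ m - + r) * + bin m (suc r) ≡⟨ cong (_+ (+ m - + r) * + bin m (suc r)) (bin-absorb m r) ⟩
    (+ m - + r) * + bin m r + (+ m - + r) * + bin m (suc r) ≡⟨ ring₂ (+ m) (+ r) (+ bin m r) (+ bin m (suc r)) ⟩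
    (+ suc m - + suc r) * (+ bin m r + + bin m (suc r)) ∎
    where
    ring₁ : ∀ m r x → (1ℤ + (1ℤ + r)) * x + (m - (1ℤ + r)) * x ≡ (1ℤ + r) * x + (m - r) * x
    ring₁ = solve-∀
    ring₂ : ∀ m r x y → (m - r) * x + (m - r) * y ≡ (1ℤ + m - (1ℤ + r)) * (x + y)
    ring₂ = solve-∀

  falling : ℤ → ℕ → ℤ
  falling m zero = 1ℤ
  falling m (suc r) = (m - + r) * falling m r

  falling-bin : ∀ m r → falling (+ m) r ≡ + bin m r * + (r !)
  falling-bin m zero = refl
  falling-bin m (suc r) = begin
    (+ m - + r) * falling (+ m) r ≡⟨ cong ((+ m - + r) *_) (falling-bin m r) ⟩
    (+ m - + r) * (+ bin m r * + (r !)) ≡⟨ sym (*-assoc (+ m - + r) (+ bin m r) (+ (r !))) ⟩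
    (+ m - + r) * + bin m r * + (r !) ≡⟨ cong (_* + (r !)) (sym (bin-absorb m r)) ⟩
    + suc r * + bin m (suc r) * + (r !) ≡⟨ ring (+ suc r) (+ bin m (suc r)) (+ (r !)) ⟩
    + bin m (suc r) * (+ suc r * + (r !)) ≡⟨ cong (+ bin m (suc r) *_) (sym (pos-* (suc r) (r !))) ⟩
    + bin m (suc r) * + (suc r !) ∎
    where
    ring : ∀ a b c → a * b * c ≡ b * (a * c)
    ring = solve-∀

  -- Double counting: a set B of size l disjoint from A stays disjoint from A ∪ {x} for exactly the
  -- n - ∣ A ∣ - l elements x outside A ∪ B. Algebraically it is `ZL` with `L f` replaced by l f.
  DZ : ∀ {l} {f : Fn n} → Level l f → ∀ A → D (Z f) A ≡ (+ n - # A - l) * Z f A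
  DZ {n} {l} {f} lf A = begin
    D (Z f) A ≡⟨ ring₁ (+ n - # A) (Z f A) (D (Z f) A) ⟩
    (+ n - # A) * Z f A - ((+ n - # A) * Z f A - D (Z f) A) ≡⟨ cong (λ z → (+ n - # A) * Z f A - z) (sym (ZL f A)) ⟩
    (+ n - # A) * Z f A - Z (L f) A ≡⟨ cong (λ z → (+ n - # A) * Z f A - z)
       (trans (T-cong _ (λ B → trans (L≗ f B) (at lf B)) A) (T-scale _ l f A)) ⟩
    (+ n - # A) * Z f A - l * Z f A ≡⟨ ring₂ (+ n - # A) (Z f A) l ⟩
    (+ n - # A - l) * Z f A ∎
    where
    ring₁ : ∀ a x y → y ≡ a * x - (a * x - y)
    ring₁ = solve-∀
    ring₂ : ∀ a x l → a * x - l * x ≡ (a - l) * x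
    ring₂ = solve-∀

  Z-U^ : ∀ r {i} {f : Fn n} → Level (+ i) f → ∀ A → Z (U^ r f) A ≡ falling (+ n - # A - + i) r * Z f A
  Z-U^ zero {f = f} lf A = sym (*-identityˡ (Z f A))
  Z-U^ {n} (suc r) {i} {f} lf A = begin
    Z (U (U^ r f)) A ≡⟨ ZU (U^ r f) A ⟩
    D (Z (U^ r f)) A ≡⟨ DZ (Level-U^ r lf) A ⟩
    (+ n - # A - + (r ℕ.+ i)) * Z (U^ r f) A ≡⟨ cong ((+ n - # A - + (r ℕ.+ i)) *_) (Z-U^ r lf A) ⟩
    (+ n - # A - (+ r + + i)) * (falling (+ n - # A - + i) r * Z f A) ≡⟨ ring (+ n - # A) (+ r) (+ i) (falling (+ n - # A - + i) r) (Z f A) ⟩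
    (+ n - # A - + i - + r) * falling (+ n - # A - + i) r * Z f A ∎
    where
    ring : ∀ a r i x y → (a - (r + i)) * (x * y) ≡ (a - i - r) * x * y
    ring = solve-∀

  -- Sums over supersets and the eigenvalues of harmonic functions.

  sgn : ℕ → ℤ
  sgn zero = 1ℤ
  sgn (suc i) = - sgn i

  P≗ : (f : Fn n) → P f ≗ (λ A → sgn ∣ A ∣ * f A)
  P≗ f [] = sym (*-identityˡ (f []))
  P≗ f (true ∷ A) = trans (cong₂ (λ x y → -1ℤ * x + 0ℤ * y) (P≗ (f ₁) A) (P≗ (f ₀) A))
    (ring (sgn ∣ A ∣) ((f ₁) A) ((f ₀) A))
    where
    ring : ∀ s x y → -1ℤ * (s * x) + 0ℤ * (s * y) ≡ - s * x
    ring = solve-∀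
  P≗ f (false ∷ A) = trans (cong₂ (λ x y → 0ℤ * x + 1ℤ * y) (P≗ (f ₁) A) (P≗ (f ₀) A))
    (ring (sgn ∣ A ∣) ((f ₁) A) ((f ₀) A))
    where
    ring : ∀ s x y → 0ℤ * (s * x) + 1ℤ * (s * y) ≡ s * y
    ring = solve-∀

  E-zero : {f : Fn n} → f ≗ (λ _ → 0ℤ) → E f ≗ (λ _ → 0ℤ)
  E-zero e A = trans (T-cong (mat 1ℤ 0ℤ 1ℤ 1ℤ) e A) (T-0 (mat 1ℤ 0ℤ 1ℤ 1ℤ) A)

  -- A set with more than i elements has no superset of size i.
  E-above : ∀ {i} (f : Fn n) → (∀ A → i ℕ.< ∣ A ∣ → f A ≡ 0ℤ) →
    (∀ A → ∣ A ∣ ℕ.< i → f A ≡ 0ℤ) → ∀ A → i ℕ.< ∣ A ∣ → E f A ≡ 0ℤ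
  E-above f above below [] ()
  E-above {i = zero} f above below (true ∷ A) _ = trans (cong (λ x → 1ℤ * x + 0ℤ * E (f ₀) A) (E-zero (λ B → above (true ∷ B) ℕ.z<s) A)) (ring (E (f ₀) A))
    where
    ring : ∀ x → 1ℤ * 0ℤ + 0ℤ * x ≡ 0ℤ
    ring = solve-∀
  E-above {i = suc i} f above below (true ∷ A) (ℕ.s≤s lt) = trans (cong (λ x → 1ℤ * x + 0ℤ * E (f ₀) A)
      (E-above (f ₁) (λ B p → above (true ∷ B) (ℕ.s≤s p)) (λ B p → below (true ∷ B) (ℕ.s≤s p)) A lt)) (ring (E (f ₀) A))
    where
    ring : ∀ x → 1ℤ * 0ℤ + 0ℤ * x ≡ 0ℤ
    ring = solve-∀
  E-above {i = zero} f above below (false ∷ A) lt = cong₂ (λ x y → 1ℤ * x + 1ℤ * y)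
    (E-zero (λ B → above (true ∷ B) ℕ.z<s) A)
    (E-above (f ₀) (λ B → above (false ∷ B)) (λ B → below (false ∷ B)) A lt)
  E-above {i = suc i} f above below (false ∷ A) lt = cong₂ (λ x y → 1ℤ * x + 1ℤ * y)
    (E-above (f ₁) (λ B p → above (true ∷ B) (ℕ.s≤s p)) (λ B p → below (true ∷ B) (ℕ.s≤s p)) A (ℕ.<-trans (ℕ.n<1+n i) lt))
    (E-above (f ₀) (λ B → above (false ∷ B)) (λ B → below (false ∷ B)) A lt)

  -- The only superset of A of the same size is A.
  E-same : ∀ {i} (f : Fn n) → (∀ A → ∣ A ∣ ≢ i → f A ≡ 0ℤ) → ∀ A → ∣ A ∣ ≡ i → E f A ≡ f A
  E-same f off [] refl = refl
  E-same {i = suc i} f off (true ∷ A) e = trans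
    (cong (λ x → 1ℤ * x + 0ℤ * E (f ₀) A)
      (E-same (f ₁) (λ B ne → off (true ∷ B) (λ e → ne (ℕ.suc-injective e))) A (ℕ.suc-injective e)))
    (ring ((f ₁) A) (E (f ₀) A))
    where
    ring : ∀ x y → 1ℤ * x + 0ℤ * y ≡ x
    ring = solve-∀
  E-same {i = zero} f off (false ∷ A) e = trans
    (cong₂ (λ x y → 1ℤ * x + 1ℤ * y)
      (E-zero (λ B → off (true ∷ B) λ ()) A)
      (E-same (f ₀) (λ B → off (false ∷ B)) A e))
    (ring (f (false ∷ A)))
    where
    ring : ∀ x → 1ℤ * 0ℤ + 1ℤ * x ≡ x
    ring = solve-∀
  E-same {i = suc i} f off (false ∷ A) e = trans
    (cong₂ (λ x y → 1ℤ * x + 1ℤ * y)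
      (E-above (f ₁) (λ B p → off₁ B (λ e → ℕ.<⇒≢ p (sym e))) (λ B p → off₁ B (ℕ.<⇒≢ p)) A (subst (i ℕ.<_) (sym e) (ℕ.n<1+n i)))
      (E-same (f ₀) (λ B → off (false ∷ B)) A e))
    (ring (f (false ∷ A)))
    where
    off₁ : ∀ B → ∣ B ∣ ≢ i → (f ₁) B ≡ 0ℤ
    off₁ B ne = off (true ∷ B) (λ e → ne (ℕ.suc-injective e))
    ring : ∀ x → 1ℤ * 0ℤ + 1ℤ * x ≡ x
    ring = solve-∀

  level-off : ∀ {i} {f : Fn n} → Level (+ i) f → ∀ A → ∣ A ∣ ≢ i → f A ≡ 0ℤ
  level-off lf A ne with level-vanish lf A
  ... | inj₁ e = contradiction e ne
  ... | inj₂ e = e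

  module _ {n i : ℕ} {y : Fn n} (ly : Level (+ i) y) (hy : Harmonic y) where

    -- `E` commutes with `D`, so `E y` is again harmonic and the D-term of `EL` drops out. In other
    -- words, a harmonic y also sums to zero over the supersets of any set smaller than i.
    E-harmonic : Level (+ i) (E y)
    E-harmonic = level λ A → begin
      # A * E y A ≡⟨ sym (trans (cong (λ z → # A * E y A + z) (DE A)) (+-identityʳ (# A * E y A))) ⟩
      # A * E y A + D (E y) A ≡⟨ sym (EL y A) ⟩
      E (L y) A ≡⟨ T-cong _ (λ B → trans (L≗ y B) (at ly B)) A ⟩
      E (λ B → + i * y B) A ≡⟨ T-scale _ (+ i) y A ⟩
      + i * E y A ∎
      where
      DE : ∀ A → D (E y) A ≡ 0ℤ
      DE A = trans (sym (ED y A)) (E-zero hy A)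

    -- In `Z-form` only sets of size i contribute, by `E-harmonic`. There `E` is the identity and
    -- `P` the sign, so on its own level y has eigenvalue (-1)^i.
    Z-harmonic-same : (h : Fn n) → Level (+ i) h → ⟪ h , Z y ⟫ ≡ sgn i * ⟪ h , y ⟫
    Z-harmonic-same h lh = trans (Z-form h y) (trans (∑-cong pointwise) (∑-scale (sgn i) (λ A → h A * y A)))
      where
      ring₀ : ∀ a s → a * (s * 0ℤ) ≡ 0ℤ
      ring₀ = solve-∀
      ring₀′ : ∀ a s → s * (a * 0ℤ) ≡ 0ℤ
      ring₀′ = solve-∀
      ring₁ : ∀ a s b → a * (s * b) ≡ s * (a * b)
      ring₁ = solve-∀
      pointwise : ∀ A → E h A * P (E y) A ≡ sgn i * (h A * y A)
      pointwise A with ∣ A ∣ ℕ.≟ i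
      ... | yes e = trans (cong₂ _*_ (E-same h (level-off lh) A e)
              (trans (P≗ (E y) A) (cong₂ _*_ (cong sgn e) (E-same y (level-off ly) A e))))
              (ring₁ (h A) (sgn i) (y A))
      ... | no ne = trans (cong (E h A *_) (trans (P≗ (E y) A) (cong (sgn ∣ A ∣ *_) (level-off E-harmonic A ne))))
              (trans (ring₀ (E h A) (sgn ∣ A ∣))
                (sym (trans (cong (λ z → sgn i * (h A * z)) (level-off ly A ne)) (ring₀′ (h A) (sgn i)))))

    -- `ZD` expresses `Z (D y)`, which is zero, by U and D applied to `Z y`. The D-term is known
    -- from `DZ`, and what remains is solved for the U-term.
    UZ : ∀ A → U (Z y) A ≡ (# A - + i) * Z y A
    UZ A = begin
      U (Z y) A ≡⟨ ring₁ (U (Z y) A) (D (Z y) A) ((+ n - + 2 * # A) * Z y A) ⟩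
      (U (Z y) A - D (Z y) A + (+ n - + 2 * # A) * Z y A) + D (Z y) A - (+ n - + 2 * # A) * Z y A
        ≡⟨ cong₂ (λ u v → u + v - (+ n - + 2 * # A) * Z y A) (trans (sym (ZD y A)) (trans (T-cong _ hy A) (T-0 _ A))) (DZ ly A) ⟩
      0ℤ + (+ n - # A - + i) * Z y A - (+ n - + 2 * # A) * Z y A
        ≡⟨ ring₂ (+ n) (# A) (+ i) (Z y A) ⟩
      (# A - + i) * Z y A ∎
      where
      ring₁ : ∀ u d c → u ≡ (u - d + c) + d - c
      ring₁ = solve-∀
      ring₂ : ∀ m a i z → 0ℤ + (m - a - i) * z - (m - + 2 * a) * z ≡ (a - i) * z
      ring₂ = solve-∀

    -- By adjunction each D becomes a U acting on `Z y`, and `UZ` turns that U into the excess of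
    -- the current level over i. These factors multiply to r!.
    D^-Z : ∀ r (g : Fn n) → Level (+ (r ℕ.+ i)) g → ⟪ D^ r g , Z y ⟫ ≡ + (r !) * ⟪ g , Z y ⟫
    D^-Z zero g lg = sym (*-identityˡ ⟪ g , Z y ⟫)
    D^-Z (suc r) g lg = begin
      ⟪ D^ r (D g) , Z y ⟫ ≡⟨ D^-Z r (D g) (Level-D lg) ⟩
      + (r !) * ⟪ D g , Z y ⟫ ≡⟨ cong (+ (r !) *_) (trans (⟪⟫-comm (D g) (Z y)) (trans (sym (U-adjoint (Z y) g)) (⟪⟫-comm (U (Z y)) g))) ⟩
      + (r !) * ⟪ g , U (Z y) ⟫ ≡⟨ cong (+ (r !) *_) (trans (∑-cong pointwise) (∑-scale (+ suc r) (λ A → g A * Z y A))) ⟩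
      + (r !) * (+ suc r * ⟪ g , Z y ⟫) ≡⟨ ring (+ (r !)) (+ suc r) ⟪ g , Z y ⟫ ⟩
      + suc r * + (r !) * ⟪ g , Z y ⟫ ≡⟨ cong (_* ⟪ g , Z y ⟫) (sym (pos-* (suc r) (r !))) ⟩
      + (suc r !) * ⟪ g , Z y ⟫ ∎
      where
      ring : ∀ a b c → a * (b * c) ≡ b * a * c
      ring = solve-∀
      ring₁ : ∀ a i g z → g * ((a - i) * z) ≡ (a * g) * z - i * (g * z)
      ring₁ = solve-∀
      ring₂ : ∀ r i g z → (1ℤ + (r + i)) * g * z - i * (g * z) ≡ (1ℤ + r) * (g * z)
      ring₂ = solve-∀
      pointwise : ∀ A → g A * U (Z y) A ≡ + suc r * (g A * Z y A)
      pointwise A = begin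
        g A * U (Z y) A ≡⟨ cong (g A *_) (UZ A) ⟩
        g A * ((# A - + i) * Z y A) ≡⟨ ring₁ (# A) (+ i) (g A) (Z y A) ⟩
        (# A * g A) * Z y A - + i * (g A * Z y A) ≡⟨ cong (λ z → z * Z y A - + i * (g A * Z y A)) (at lg A) ⟩
        (+ (suc r ℕ.+ i) * g A) * Z y A - + i * (g A * Z y A) ≡⟨ ring₂ (+ r) (+ i) (g A) (Z y A) ⟩
        + suc r * (g A * Z y A) ∎

    -- On level r + i the functions U^r y are eigenvectors of the Kneser graph.
    Z-eigen : ∀ r m → n ≡ r ℕ.+ i ℕ.+ i ℕ.+ m → (g : Fn n) → Level (+ (r ℕ.+ i)) g →
      ⟪ g , Z (U^ r y) ⟫ ≡ sgn i * + bin m r * ⟪ U^ r y , g ⟫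
    Z-eigen r m refl g lg = begin
      ⟪ g , Z (U^ r y) ⟫ ≡⟨ trans (∑-cong pointwise) (∑-scale (+ bin m r * + (r !)) (λ A → g A * Z y A)) ⟩
      + bin m r * + (r !) * ⟪ g , Z y ⟫ ≡⟨ *-assoc (+ bin m r) (+ (r !)) ⟪ g , Z y ⟫ ⟩
      -- The r! coming from `falling-bin` pays for moving `D^ r` onto g. That brings the pairing
      -- down to the level of y, where the eigenvalue is only a sign.
      + bin m r * (+ (r !) * ⟪ g , Z y ⟫) ≡⟨ cong (+ bin m r *_) (sym (D^-Z r g lg)) ⟩
      + bin m r * ⟪ D^ r g , Z y ⟫ ≡⟨ cong (+ bin m r *_) (Z-harmonic-same (D^ r g) (Level-D^ r lg)) ⟩
      + bin m r * (sgn i * ⟪ D^ r g , y ⟫) ≡⟨ cong (λ z → + bin m r * (sgn i * z)) (trans (⟪⟫-comm (D^ r g) y) (sym (U^-adjoint r y g))) ⟩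
      + bin m r * (sgn i * ⟪ U^ r y , g ⟫) ≡⟨ ring (+ bin m r) (sgn i) ⟪ U^ r y , g ⟫ ⟩
      sgn i * + bin m r * ⟪ U^ r y , g ⟫ ∎
      where
      ring : ∀ a b c → a * (b * c) ≡ b * a * c
      ring = solve-∀
      ring₁ : ∀ a b c → a * (b * c) ≡ b * (a * c)
      ring₁ = solve-∀
      ring₀ : ∀ b c → b * (0ℤ * c) ≡ 0ℤ
      ring₀ = solve-∀
      offset : ∀ a i m → a + i + m - a - i ≡ m
      offset = solve-∀
      pointwise : ∀ A → g A * Z (U^ r y) A ≡ + bin m r * + (r !) * (g A * Z y A)
      pointwise A with ∣ A ∣ ℕ.≟ r ℕ.+ i
      ... | no ne = trans (cong (_* Z (U^ r y) A) (level-off lg A ne))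
            (sym (trans (cong (λ z → + bin m r * + (r !) * (z * Z y A)) (level-off lg A ne)) (ring₀ (+ bin m r * + (r !)) (Z y A))))
      ... | yes e = trans (cong (g A *_) (trans (Z-U^ r ly A)
              (cong (_* Z y A) (trans (cong (λ z → falling z r)
                (trans (cong (λ a → + n - + a - + i) e) (trans (cong (λ z → z - + (r ℕ.+ i) - + i) (trans (pos-+ (r ℕ.+ i ℕ.+ i) m) (cong (_+ + m) (pos-+ (r ℕ.+ i) i)))) (offset (+ (r ℕ.+ i)) (+ i) (+ m))))) (falling-bin m r)))))
              (ring₁ (g A) (+ bin m r * + (r !)) (Z y A))

  -- Level indicators and the constant eigenvector.

  ind : Bool → ℤ
  ind true = 1ℤ
  ind false = 0ℤ

  𝟙 : ℕ → Fn n
  𝟙 k A = ind (does (∣ A ∣ ℕ.≟ k))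

  ∑-𝟙 : ∀ n k → ∑ {n} (𝟙 k) ≡ + bin n k
  ∑-𝟙 zero zero = refl
  ∑-𝟙 zero (suc k) = refl
  ∑-𝟙 (suc n) zero = trans (cong₂ _+_ (∑-0 {n}) (∑-𝟙 n zero)) refl
  ∑-𝟙 (suc n) (suc k) = cong₂ _+_ (∑-𝟙 n k) (∑-𝟙 n (suc k))

  Z-𝟙 : ∀ k (A : Subset n) → Z (𝟙 k) A ≡ + bin (n ℕ.∸ ∣ A ∣) k
  Z-𝟙 zero [] = refl
  Z-𝟙 (suc k) [] = refl
  Z-𝟙 k (true ∷ A) = trans (cong (λ z → 0ℤ * Z (𝟙 k ₁) A + 1ℤ * z) (Z-𝟙 k A)) (ring (Z (𝟙 k ₁) A) (+ bin _ k))
    where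
    ring : ∀ x y → 0ℤ * x + 1ℤ * y ≡ y
    ring = solve-∀
  Z-𝟙 {suc n} zero (false ∷ A) =
    trans (cong₂ (λ x y → 1ℤ * x + 1ℤ * y) (T-0 _ A) (Z-𝟙 zero A)) refl
  Z-𝟙 {suc n} (suc k) (false ∷ A) rewrite ℕ.+-∸-assoc 1 (∣p∣≤n A) =
    trans (cong₂ (λ x y → 1ℤ * x + 1ℤ * y) (Z-𝟙 k A) (Z-𝟙 (suc k) A))
      (ring (+ bin (n ℕ.∸ ∣ A ∣) k) (+ bin (n ℕ.∸ ∣ A ∣) (suc k)))
    where
    ring : ∀ x y → 1ℤ * x + 1ℤ * y ≡ x + y
    ring = solve-∀

  ind-nonneg : ∀ b → 0ℤ ≤ ind b
  ind-nonneg true = +≤+ ℕ.z≤n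
  ind-nonneg false = ≤-refl

  ind-idem : ∀ b → ind b * ind b ≡ ind b
  ind-idem true = refl
  ind-idem false = refl

  Level-𝟙 : ∀ k → Level (+ k) (𝟙 {n} k)
  Level-𝟙 k = vanish-level λ A ne → cong ind (dec-false (∣ A ∣ ℕ.≟ k) ne)

  ⟪𝟙,⟫ : ∀ {k} {f : Fn n} → Level (+ k) f → ⟪ 𝟙 k , f ⟫ ≡ ∑ f
  ⟪𝟙,⟫ {k = k} {f} lf = ∑-cong pointwise
    where
    pointwise : ∀ A → 𝟙 k A * f A ≡ f A
    pointwise A with level-vanish lf A
    ... | inj₁ e = trans (cong (λ b → ind b * f A) (dec-true (∣ A ∣ ℕ.≟ k) e)) (*-identityˡ (f A))
    ... | inj₂ e = trans (cong (𝟙 k A *_) e) (trans (*-zeroʳ (𝟙 k A)) (sym e))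

  ⟪,Z𝟙⟫ : ∀ {k} {f : Fn n} → Level (+ k) f → ⟪ f , Z (𝟙 k) ⟫ ≡ + bin (n ℕ.∸ k) k * ∑ f
  ⟪,Z𝟙⟫ {n} {k} {f} lf = trans (∑-cong pointwise) (∑-scale (+ bin (n ℕ.∸ k) k) f)
    where
    pointwise : ∀ A → f A * Z (𝟙 k) A ≡ + bin (n ℕ.∸ k) k * f A
    pointwise A with level-vanish lf A
    ... | inj₁ e = trans (cong (f A *_) (trans (Z-𝟙 k A) (cong (λ z → + bin (n ℕ.∸ z) k) e))) (*-comm (f A) _)
    ... | inj₂ e = trans (cong (_* Z (𝟙 k) A) e) (sym (trans (cong (+ bin (n ℕ.∸ k) k *_) e) (*-zeroʳ (+ bin (n ℕ.∸ k) k))))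

  U-1 : ∀ (A : Subset n) → U (λ _ → 1ℤ) A ≡ # A
  U-1 [] = refl
  U-1 (true ∷ A) = trans (cong (_+ 1ℤ) (U-1 A)) (+-comm (# A) 1ℤ)
  U-1 (false ∷ A) = trans (cong (_+ 0ℤ) (U-1 A)) (+-identityʳ (# A))

  ∑-D : ∀ {l} {f : Fn n} → Level l f → ∑ (D f) ≡ l * ∑ f
  ∑-D {l = l} {f} lf = begin
    ∑ (D f) ≡⟨ ∑-cong (λ A → sym (*-identityˡ (D f A))) ⟩
    ⟪ (λ _ → 1ℤ) , D f ⟫ ≡⟨ sym (U-adjoint (λ _ → 1ℤ) f) ⟩
    ⟪ U (λ _ → 1ℤ) , f ⟫ ≡⟨ ∑-cong (λ A → trans (cong (_* f A) (U-1 A)) (at lf A)) ⟩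
    ∑ (λ A → l * f A) ≡⟨ ∑-scale l f ⟩
    l * ∑ f ∎

  level-0 : {f : Fn n} → Level 0ℤ f → ∑ f ≡ 0ℤ → f ≗ (λ _ → 0ℤ)
  level-0 {f = f} lf s A with level-vanish lf A
  ... | inj₂ e = e
  ... | inj₁ e = trans (go f lf A e) s
    where
    go : ∀ {n} (f : Fn n) → Level 0ℤ f → ∀ A → ∣ A ∣ ≡ 0 → f A ≡ ∑ f
    go f lf [] _ = refl
    go {suc n} f lf (false ∷ A) e = trans (go (f ₀) (level λ B → at lf (false ∷ B)) A e)
      (sym (trans (cong (_+ ∑ (f ₀)) (trans (∑-cong (λ B → level-off lf (true ∷ B) (λ ()))) (∑-0 {n}))) (+-identityˡ _)))

  -- The function `D^ k f` lives on the empty set, where its value is a multiple of `∑ f`. Through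
  -- this, orthogonality to the constants becomes the starting point of `B-nonneg`.
  D^-0 : ∀ k {f : Fn n} → Level (+ k) f → ∑ f ≡ 0ℤ → D^ k f ≗ (λ _ → 0ℤ)
  D^-0 zero lf s = level-0 lf s
  D^-0 (suc k) {f} lf s = D^-0 k (Level-D lf) (trans (∑-D lf) (trans (cong (+ suc k *_) s) (*-zeroʳ (+ suc k))))

  Level-lin : ∀ {l} a b {f g : Fn n} → Level l f → Level l g → Level l (λ A → a * f A + b * g A)
  Level-lin {l = l} a b {f} {g} lf lg = level λ A →
    trans (ring₁ (# A) a b (f A) (g A)) (trans (cong₂ (λ x y → a * x + b * y) (at lf A) (at lg A)) (sym (ring₁ l a b (f A) (g A))))
    where
    ring₁ : ∀ c a b x y → c * (a * x + b * y) ≡ a * (c * x) + b * (c * y)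
    ring₁ = solve-∀

  -- Nonnegativity of α + β·Z on the orthogonal complement of the constants, read off
  -- from its eigenvalues.
  module Spectral {n k : ℕ} (2k≤n : 2 ℕ.* k ℕ.≤ n) (α β : ℤ)
    (eigenvalue : ∀ i r m → r ℕ.+ suc i ≡ k → n ≡ k ℕ.+ suc i ℕ.+ m → 0ℤ ≤ α + β * (sgn (suc i) * + bin m r)) where

    B : Fn n → Fn n → ℤ
    B f g = α * ⟪ f , g ⟫ + β * ⟪ f , Z g ⟫

    B-comm : ∀ f g → B f g ≡ B g f
    B-comm f g = cong₂ (λ x y → α * x + β * y) (⟪⟫-comm f g) (trans (sym (Z-adjoint f g)) (⟪⟫-comm (Z f) g))

    B-linʳ : ∀ a b h f g → B h (λ A → a * f A + b * g A) ≡ a * B h f + b * B h g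
    B-linʳ a b h f g = trans
      (cong₂ (λ x y → α * x + β * y) (⟪⟫-linʳ a b h f g)
        (trans (⟪⟫-cong {f = h} (λ _ → refl) (T-lin _ a b f g)) (⟪⟫-linʳ a b h (Z f) (Z g))))
      (ring α β a b ⟪ h , f ⟫ ⟪ h , g ⟫ ⟪ h , Z f ⟫ ⟪ h , Z g ⟫)
      where
      ring : ∀ α β a b x y u v → α * (a * x + b * y) + β * (a * u + b * v) ≡ a * (α * x + β * u) + b * (α * y + β * v)
      ring = solve-∀

    B-lin² : ∀ a b f g → B (λ A → a * f A + b * g A) (λ A → a * f A + b * g A) ≡
      a * a * B f f + + 2 * a * b * B f g + b * b * B g g
    B-lin² a b f g = begin
      B h h ≡⟨ B-linʳ a b h f g ⟩
      a * B h f + b * B h g ≡⟨ cong₂ (λ x y → a * x + b * y) (trans (B-comm h f) (B-linʳ a b f f g)) (trans (B-comm h g) (B-linʳ a b g f g)) ⟩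
      a * (a * B f f + b * B f g) + b * (a * B g f + b * B g g) ≡⟨ cong (λ z → a * (a * B f f + b * B f g) + b * (a * z + b * B g g)) (B-comm g f) ⟩
      a * (a * B f f + b * B f g) + b * (a * B f g + b * B g g) ≡⟨ ring a b (B f f) (B f g) (B g g) ⟩
      a * a * B f f + + 2 * a * b * B f g + b * b * B g g ∎
      where
      h = λ A → a * f A + b * g A
      ring : ∀ a b x y z → a * (a * x + b * y) + b * (a * y + b * z) ≡ a * a * x + + 2 * a * b * y + b * b * z
      ring = solve-∀

    B-zero : ∀ f → f ≗ (λ _ → 0ℤ) → B f f ≡ 0ℤ
    B-zero f e = trans (cong₂ (λ x y → α * x + β * y) (zero-pair f) (zero-pair (Z f))) (ring α β)
      where
      zero-pair : ∀ g → ⟪ f , g ⟫ ≡ 0ℤ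
      zero-pair g = trans (∑-cong (λ A → cong (_* g A) (e A))) (∑-0 {n})
      ring : ∀ a b → a * 0ℤ + b * 0ℤ ≡ 0ℤ
      ring = solve-∀

    -- The hypothesis `D^ r f` = 0 says that the harmonic components of f of degree at most k - r
    -- vanish. In the induction step y = `D^ r f` is harmonic of degree i = k - r, and u = `U^ r y`
    -- is K times the component of f of that degree. So g = K f - u is killed by `D^ r`, while u
    -- contributes a nonnegative eigenvalue times a squared norm. Scaling f by K avoids a division.
    B-nonneg : ∀ r → r ℕ.≤ k → ∀ f → Level (+ k) f → D^ r f ≗ (λ _ → 0ℤ) → 0ℤ ≤ B f f
    B-nonneg zero _ f _ e = ≤-reflexive (sym (B-zero f e))
    B-nonneg (suc r) r<k f lf e with ℕ.m≤n⇒∃[o]m+o≡n r<k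
    ... | j , refl = cancel-nonneg (*-pos κ>0 κ>0) (subst (0ℤ ≤_) split (+-nonneg IH
            (*-nonneg (*-nonneg eig≥0 (<⇒≤ κ>0)) (∑-nonneg (λ A → square-nonneg (y A))))))
      where
      i = suc j
      r+i≡k : r ℕ.+ i ≡ k
      r+i≡k = ℕ.+-suc r j
      m = n ℕ.∸ (k ℕ.+ i)
      i≤k : i ℕ.≤ k
      i≤k = subst (i ℕ.≤_) r+i≡k (ℕ.m≤n+m i r)
      k+i≤n : k ℕ.+ i ℕ.≤ n
      k+i≤n = ℕ.≤-trans (ℕ.+-monoʳ-≤ k (ℕ.≤-trans i≤k (ℕ.≤-reflexive (sym (ℕ.+-identityʳ k))))) 2k≤n
      n≡ : n ≡ k ℕ.+ i ℕ.+ m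
      n≡ = sym (ℕ.m+[n∸m]≡n k+i≤n)
      n≡′ : n ≡ r ℕ.+ i ℕ.+ i ℕ.+ m
      n≡′ = trans n≡ (cong (λ z → z ℕ.+ i ℕ.+ m) (sym r+i≡k))
      y : Fn n
      y = D^ r f
      lf′ : Level (+ (r ℕ.+ i)) f
      lf′ = subst (λ z → Level (+ z) f) (sym r+i≡k) lf
      ly : Level (+ i) y
      ly = Level-D^ r lf′
      hy : Harmonic y
      hy A = trans (D-D^ r f A) (e A)
      K = κ ly hy r
      κ>0 : 0ℤ < K
      -- Positivity uses 2i + r = k + i ≤ 2k ≤ n.
      κ>0 = κ-pos ly hy r (ℕ.≤-trans (ℕ.≤-reflexive 2i+r) k+i≤n)
        where
        2i+r : 2 ℕ.* i ℕ.+ r ≡ k ℕ.+ i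
        2i+r = trans (cong (λ z → i ℕ.+ z ℕ.+ r) (ℕ.+-identityʳ i)) (trans (ℕ.+-comm (i ℕ.+ i) r) (trans (sym (ℕ.+-assoc r i i)) (cong (ℕ._+ i) r+i≡k)))
      u = U^ r y
      g : Fn n
      g A = K * f A + -1ℤ * u A
      lu : Level (+ k) u
      lu = subst (λ z → Level (+ z) u) r+i≡k (Level-U^ r ly)
      Dg : D^ r g ≗ (λ _ → 0ℤ)
      Dg A = trans (D^-lin r K -1ℤ f u A) (trans (cong (λ z → K * y A + -1ℤ * z) (D^-U^ ly hy r A)) (ring K (y A)))
        where
        ring : ∀ K y → K * y + -1ℤ * (K * y) ≡ 0ℤ
        ring = solve-∀
      IH : 0ℤ ≤ B g g
      IH = B-nonneg r (ℕ.<⇒≤ r<k) g (Level-lin K -1ℤ lf lu) Dg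
      eig = α + β * (sgn i * + bin m r)
      eig≥0 : 0ℤ ≤ eig
      eig≥0 = eigenvalue j r m r+i≡k n≡
      B-u : ∀ h → Level (+ (r ℕ.+ i)) h → B h u ≡ eig * ⟪ u , h ⟫
      B-u h lh = trans (cong₂ (λ x z → α * x + β * z) (⟪⟫-comm h u) (Z-eigen ly hy r m n≡′ h lh))
        (ring α β (sgn i * + bin m r) ⟪ u , h ⟫)
        where
        ring : ∀ α β s x → α * x + β * (s * x) ≡ (α + β * s) * x
        ring = solve-∀
      ⟪u,f⟫ : ⟪ u , f ⟫ ≡ ⟪ y , y ⟫
      ⟪u,f⟫ = U^-adjoint r y f
      ⟪u,u⟫ : ⟪ u , u ⟫ ≡ K * ⟪ y , y ⟫
      ⟪u,u⟫ = trans (U^-adjoint r y u) (trans (⟪⟫-cong {f = y} (λ _ → refl) (D^-U^ ly hy r)) (⟪⟫-scaleʳ K y y))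
      -- Pythagoras for f and its component: since u is an eigenvector, the cross term is -2K `eig`
      -- ⟨y,y⟩ and the square of u gives + K `eig` ⟨y,y⟩.
      split : B g g + eig * K * ⟪ y , y ⟫ ≡ K * K * B f f
      split = begin
        B g g + eig * K * ⟪ y , y ⟫ ≡⟨ cong (_+ eig * K * ⟪ y , y ⟫) (B-lin² K -1ℤ f u) ⟩
        K * K * B f f + + 2 * K * -1ℤ * B f u + -1ℤ * -1ℤ * B u u + eig * K * ⟪ y , y ⟫
          ≡⟨ cong₂ (λ x z → K * K * B f f + + 2 * K * -1ℤ * x + -1ℤ * -1ℤ * z + eig * K * ⟪ y , y ⟫)
               (trans (B-u f lf′) (cong (eig *_) ⟪u,f⟫)) (trans (B-u u (Level-U^ r ly)) (cong (eig *_) ⟪u,u⟫)) ⟩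
        K * K * B f f + + 2 * K * -1ℤ * (eig * ⟪ y , y ⟫) + -1ℤ * -1ℤ * (eig * (K * ⟪ y , y ⟫)) + eig * K * ⟪ y , y ⟫
          ≡⟨ ring K (B f f) eig ⟪ y , y ⟫ ⟩
        K * K * B f f ∎
        where
        ring : ∀ K b e x → K * K * b + + 2 * K * -1ℤ * (e * x) + -1ℤ * -1ℤ * (e * (K * x)) + e * K * x ≡ K * K * b
        ring = solve-∀

    d N : ℤ
    d = + bin (n ℕ.∸ k) k
    N = + bin n k

    -- Apply `B-nonneg` to N f - (∑ f) 𝟙, the projection of f away from the constants cleared of its
    -- denominator. Since 𝟙 is an eigenvector of eigenvalue d, the cross terms are multiples of (∑
    -- f)².
    spectral-bound : 0ℤ < N → ∀ f → Level (+ k) f → (α + β * d) * (∑ f * ∑ f) ≤ N * B f f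
    spectral-bound N>0 f lf = 0≤i-j⇒j≤i (cancel-nonneg N>0 (subst (0ℤ ≤_) split IH))
      where
      s = ∑ f
      g : Fn n
      g A = N * f A + (- s) * 𝟙 k A
      l𝟙 = Level-𝟙 {n} k
      lg : Level (+ k) g
      lg = Level-lin N (- s) lf l𝟙
      ∑g : ∑ g ≡ 0ℤ
      ∑g = trans (∑-lin N (- s) f (𝟙 k)) (trans (cong (λ z → N * s + (- s) * z) (∑-𝟙 n k)) (ring N s))
        where
        ring : ∀ N s → N * s + (- s) * N ≡ 0ℤ
        ring = solve-∀
      IH : 0ℤ ≤ B g g
      IH = B-nonneg k ℕ.≤-refl g lg (D^-0 k lg ∑g)
      B-1 : ∀ h → Level (+ k) h → B h (𝟙 k) ≡ (α + β * d) * ∑ h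
      B-1 h lh = trans (cong₂ (λ x z → α * x + β * z) (trans (⟪⟫-comm h (𝟙 k)) (⟪𝟙,⟫ lh)) (⟪,Z𝟙⟫ lh)) (ring α β d (∑ h))
        where
        ring : ∀ α β d s → α * s + β * (d * s) ≡ (α + β * d) * s
        ring = solve-∀
      split : B g g ≡ N * (N * B f f - (α + β * d) * (s * s))
      split = begin
        B g g ≡⟨ B-lin² N (- s) f (𝟙 k) ⟩
        N * N * B f f + + 2 * N * (- s) * B f (𝟙 k) + (- s) * (- s) * B (𝟙 k) (𝟙 k)
          ≡⟨ cong₂ (λ x z → N * N * B f f + + 2 * N * (- s) * x + (- s) * (- s) * z) (B-1 f lf)
               (trans (B-1 (𝟙 k) l𝟙) (cong ((α + β * d) *_) (∑-𝟙 n k))) ⟩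
        N * N * B f f + + 2 * N * (- s) * ((α + β * d) * s) + (- s) * (- s) * ((α + β * d) * N)
          ≡⟨ ring N (B f f) s (α + β * d) ⟩
        N * (N * B f f - (α + β * d) * (s * s)) ∎
        where
        ring : ∀ N b s e → N * N * b + + 2 * N * (- s) * (e * s) + (- s) * (- s) * (e * N) ≡ N * (N * b - e * (s * s))
        ring = solve-∀

  -- Counting neighbours

  private
    drop-ones : ∀ x y → 1ℤ * x + 1ℤ * y ≡ x + y
    drop-ones = solve-∀
    second : ∀ x y → 0ℤ * x + 1ℤ * y ≡ y
    second = solve-∀

  Z-true : (f : Fn (suc n)) (A : Subset n) → Z f (true ∷ A) ≡ Z (f ₀) A
  Z-true f A = second (Z (f ₁) A) (Z (f ₀) A)

  Z-false : (f : Fn (suc n)) (A : Subset n) → Z f (false ∷ A) ≡ Z (f ₁) A + Z (f ₀) A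
  Z-false f A = drop-ones (Z (f ₁) A) (Z (f ₀) A)

  Z-lin : ∀ a b (f g : Fn n) → Z (λ A → a * f A + b * g A) ≗ (λ A → a * Z f A + b * Z g A)
  Z-lin = T-lin (mat 0ℤ 1ℤ 1ℤ 1ℤ)

  Z-scale : ∀ a (f : Fn n) → Z (λ A → a * f A) ≗ (λ A → a * Z f A)
  Z-scale = T-scale (mat 0ℤ 1ℤ 1ℤ 1ℤ)

  NonNeg : Fn n → Set
  NonNeg f = ∀ A → 0ℤ ≤ f A

  Z-nonneg : {f : Fn n} → NonNeg f → NonNeg (Z f)
  Z-nonneg f≥0 [] = f≥0 []
  Z-nonneg {f = f} f≥0 (true ∷ A) = subst (0ℤ ≤_) (sym (Z-true f A)) (Z-nonneg (λ B → f≥0 (false ∷ B)) A)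
  Z-nonneg {f = f} f≥0 (false ∷ A) = subst (0ℤ ≤_) (sym (Z-false f A))
    (+-nonneg (Z-nonneg (λ B → f≥0 (true ∷ B)) A) (Z-nonneg (λ B → f≥0 (false ∷ B)) A))

  private
    ≤-+ˡ : ∀ {a b c} → a ≤ c → 0ℤ ≤ b → a ≤ b + c
    ≤-+ˡ {a} {b} {c} a≤c b≥0 = subst (_≤ b + c) (+-identityˡ a) (+-mono-≤ b≥0 a≤c)
    ≤-+ʳ : ∀ {a b c} → a ≤ b → 0ℤ ≤ c → a ≤ b + c
    ≤-+ʳ {a} {b} {c} a≤b c≥0 = subst (_≤ b + c) (+-identityʳ a) (+-mono-≤ a≤b c≥0)

  ≤-∑ : {f : Fn n} → NonNeg f → ∀ A → f A ≤ ∑ f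
  ≤-∑ f≥0 [] = ≤-refl
  ≤-∑ f≥0 (true ∷ A) = ≤-+ʳ (≤-∑ (λ B → f≥0 (true ∷ B)) A) (∑-nonneg (λ B → f≥0 (false ∷ B)))
  ≤-∑ f≥0 (false ∷ A) = ≤-+ˡ (≤-∑ (λ B → f≥0 (false ∷ B)) A) (∑-nonneg (λ B → f≥0 (true ∷ B)))

  Z≤∑ : {f : Fn n} → NonNeg f → ∀ A → Z f A ≤ ∑ f
  Z≤∑ f≥0 [] = ≤-refl
  Z≤∑ {f = f} f≥0 (true ∷ A) = subst (_≤ ∑ f) (sym (Z-true f A))
    (≤-+ˡ (Z≤∑ (λ B → f≥0 (false ∷ B)) A) (∑-nonneg (λ B → f≥0 (true ∷ B))))
  Z≤∑ {f = f} f≥0 (false ∷ A) = subst (_≤ ∑ f) (sym (Z-false f A))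
    (+-mono-≤ (Z≤∑ (λ B → f≥0 (true ∷ B)) A) (Z≤∑ (λ B → f≥0 (false ∷ B)) A))

  -- A nonempty A is not disjoint from itself, so f A is not among the terms of `Z f A`.
  Z+self≤∑ : {f : Fn n} → NonNeg f → ∀ A → 1 ℕ.≤ ∣ A ∣ → Z f A + f A ≤ ∑ f
  Z+self≤∑ {f = f} f≥0 (true ∷ A) _ = subst (_≤ ∑ f) (trans (+-comm (f (true ∷ A)) (Z (f ₀) A)) (cong (_+ f (true ∷ A)) (sym (Z-true f A))))
    (+-mono-≤ (≤-∑ (λ B → f≥0 (true ∷ B)) A) (Z≤∑ (λ B → f≥0 (false ∷ B)) A))
  Z+self≤∑ {f = f} f≥0 (false ∷ A) A≥1 = subst (_≤ ∑ f) (trans (sym (+-assoc (Z (f ₁) A) (Z (f ₀) A) _)) (cong (_+ f (false ∷ A)) (sym (Z-false f A))))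
    (+-mono-≤ (Z≤∑ (λ B → f≥0 (true ∷ B)) A) (Z+self≤∑ (λ B → f≥0 (false ∷ B)) A A≥1))

  -- Inclusion-exclusion: the sets disjoint from both A and B are those disjoint from A ∪ B.
  Z+Z≤∑ : {f : Fn n} → NonNeg f → ∀ A B → Z f A + Z f B ≤ ∑ f + Z f (A ∪ B)
  Z+Z≤∑ f≥0 [] [] = ≤-refl
  Z+Z≤∑ {f = f} f≥0 (true ∷ A) (true ∷ B) = subst₂ _≤_
    (cong₂ _+_ (sym (Z-true f A)) (sym (Z-true f B)))
    (trans (sym (+-assoc (∑ (f ₁)) (∑ (f ₀)) _)) (cong (λ z → ∑ f + z) (sym (Z-true f (A ∪ B)))))
    (≤-+ˡ (Z+Z≤∑ (λ C → f≥0 (false ∷ C)) A B) (∑-nonneg (λ C → f≥0 (true ∷ C))))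
  Z+Z≤∑ {f = f} f≥0 (true ∷ A) (false ∷ B) = subst₂ _≤_
    (trans (ring₁ (Z (f ₁) B) (Z (f ₀) A) (Z (f ₀) B)) (cong₂ _+_ (sym (Z-true f A)) (sym (Z-false f B))))
    (trans (sym (+-assoc (∑ (f ₁)) (∑ (f ₀)) _)) (cong (λ z → ∑ f + z) (sym (Z-true f (A ∪ B)))))
    (+-mono-≤ (Z≤∑ (λ C → f≥0 (true ∷ C)) B) (Z+Z≤∑ (λ C → f≥0 (false ∷ C)) A B))
    where
    ring₁ : ∀ x a b → x + (a + b) ≡ a + (x + b)
    ring₁ = solve-∀
  Z+Z≤∑ {f = f} f≥0 (false ∷ A) (true ∷ B) = subst₂ _≤_
    (trans (sym (+-assoc (Z (f ₁) A) (Z (f ₀) A) (Z (f ₀) B))) (cong₂ _+_ (sym (Z-false f A)) (sym (Z-true f B))))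
    (trans (sym (+-assoc (∑ (f ₁)) (∑ (f ₀)) _)) (cong (λ z → ∑ f + z) (sym (Z-true f (A ∪ B)))))
    (+-mono-≤ (Z≤∑ (λ C → f≥0 (true ∷ C)) A) (Z+Z≤∑ (λ C → f≥0 (false ∷ C)) A B))
  Z+Z≤∑ {f = f} f≥0 (false ∷ A) (false ∷ B) = subst₂ _≤_
    (trans (ring (Z (f ₁) A) (Z (f ₁) B) (Z (f ₀) A) (Z (f ₀) B)) (cong₂ _+_ (sym (Z-false f A)) (sym (Z-false f B))))
    (trans (ring (∑ (f ₁)) (Z (f ₁) (A ∪ B)) (∑ (f ₀)) (Z (f ₀) (A ∪ B))) (cong (λ z → ∑ f + z) (sym (Z-false f (A ∪ B)))))
    (+-mono-≤ (Z+Z≤∑ (λ C → f≥0 (true ∷ C)) A B) (Z+Z≤∑ (λ C → f≥0 (false ∷ C)) A B))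
    where
    ring : ∀ a b c d → (a + b) + (c + d) ≡ (a + c) + (b + d)
    ring = solve-∀

  Disjoint : Subset n → Subset n → Set
  Disjoint A B = Empty (A ∩ B)

  Empty-false : {C : Subset n} → Empty C → Empty (false ∷ C)
  Empty-false e (suc i , there p) = e (i , p)

  disjoint-comm : {A B : Subset n} → Disjoint A B → Disjoint B A
  disjoint-comm {A = A} {B} = subst Empty (∩-comm A B)

  disjoint-∪ : (A B : Subset n) → Disjoint A B → ∣ A ∪ B ∣ ≡ ∣ A ∣ ℕ.+ ∣ B ∣
  disjoint-∪ [] [] _ = refl
  disjoint-∪ (true ∷ A) (true ∷ B) dj = contradiction (zero , here) dj
  disjoint-∪ (true ∷ A) (false ∷ B) dj = cong suc (disjoint-∪ A B (drop-∷-Empty dj))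
  disjoint-∪ (false ∷ A) (true ∷ B) dj = trans (cong suc (disjoint-∪ A B (drop-∷-Empty dj))) (sym (ℕ.+-suc ∣ A ∣ ∣ B ∣))
  disjoint-∪ (false ∷ A) (false ∷ B) dj = disjoint-∪ A B (drop-∷-Empty dj)

  Z-cong-disjoint : ∀ {f g : Fn n} A → (∀ B → Disjoint A B → f B ≡ g B) → Z f A ≡ Z g A
  Z-cong-disjoint [] e = e [] (λ { (() , _) })
  Z-cong-disjoint {f = f} {g} (true ∷ A) e = trans (Z-true f A) (trans
    (Z-cong-disjoint A (λ B dj → e (false ∷ B) (Empty-false dj))) (sym (Z-true g A)))
  Z-cong-disjoint {f = f} {g} (false ∷ A) e = trans (Z-false f A) (trans (cong₂ _+_
    (Z-cong-disjoint A (λ B dj → e (true ∷ B) (Empty-false dj)))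
    (Z-cong-disjoint A (λ B dj → e (false ∷ B) (Empty-false dj)))) (sym (Z-false g A)))

  Z-vanish : ∀ {f : Fn n} A → (∀ B → Disjoint A B → f B ≡ 0ℤ) → Z f A ≡ 0ℤ
  Z-vanish A e = trans (Z-cong-disjoint A e) (T-0 (mat 0ℤ 1ℤ 1ℤ 1ℤ) A)

  ≤-Z : {f : Fn n} → NonNeg f → ∀ A B → Disjoint A B → f B ≤ Z f A
  ≤-Z f≥0 [] [] _ = ≤-refl
  ≤-Z f≥0 (true ∷ A) (true ∷ B) dj = contradiction (zero , here) dj
  ≤-Z {f = f} f≥0 (true ∷ A) (false ∷ B) dj = subst (f (false ∷ B) ≤_) (sym (Z-true f A)) (≤-Z (λ C → f≥0 (false ∷ C)) A B (drop-∷-Empty dj))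
  ≤-Z {f = f} f≥0 (false ∷ A) (true ∷ B) dj = subst (f (true ∷ B) ≤_) (sym (Z-false f A))
    (≤-+ʳ (≤-Z (λ C → f≥0 (true ∷ C)) A B (drop-∷-Empty dj)) (Z-nonneg (λ C → f≥0 (false ∷ C)) A))
  ≤-Z {f = f} f≥0 (false ∷ A) (false ∷ B) dj = subst (f (false ∷ B) ≤_) (sym (Z-false f A))
    (≤-+ˡ (≤-Z (λ C → f≥0 (false ∷ C)) A B (drop-∷-Empty dj)) (Z-nonneg (λ C → f≥0 (true ∷ C)) A))

  Z-witness : ∀ (f : Fn n) A → Z f A ≢ 0ℤ → ∃ λ B → Disjoint A B × f B ≢ 0ℤ
  Z-witness f [] ne = [] , (λ { (() , _) }) , ne
  Z-witness f (true ∷ A) ne with Z-witness (f ₀) A (λ e → ne (trans (Z-true f A) e))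
  ... | B , dj , p = false ∷ B , Empty-false dj , p
  Z-witness f (false ∷ A) ne with Z (f ₁) A ≟ 0ℤ
  ... | no ne₁ with Z-witness (f ₁) A ne₁
  ...   | B , dj , p = true ∷ B , Empty-false dj , p
  Z-witness f (false ∷ A) ne | yes e₁ with Z-witness (f ₀) A (λ e → ne (trans (Z-false f A) (cong₂ _+_ e₁ e)))
  ...   | B , dj , p = false ∷ B , Empty-false dj , p

  -- Two adjacent vertices of a Kneser graph with n < 3k have no common neighbour.
  Z+Z-adjacent : ∀ {k} {f : Fn n} → NonNeg f → Level (+ k) f → ∀ A B → Disjoint A B →
    n ℕ.< ∣ A ∣ ℕ.+ ∣ B ∣ ℕ.+ k → Z f A + Z f B ≤ ∑ f
  Z+Z-adjacent {n} {k} {f} f≥0 lf A B dj lt = subst (Z f A + Z f B ≤_)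
    (trans (cong (λ z → ∑ f + z) (Z-vanish (A ∪ B) none)) (+-identityʳ (∑ f))) (Z+Z≤∑ f≥0 A B)
    where
    none : ∀ C → Disjoint (A ∪ B) C → f C ≡ 0ℤ
    none C dj′ with level-vanish lf C
    ... | inj₂ e = e
    ... | inj₁ e = contradiction lt (ℕ.≤⇒≯ (ℕ.≤-trans (ℕ.≤-reflexive (sym (trans (disjoint-∪ (A ∪ B) C dj′) (cong₂ ℕ._+_ (disjoint-∪ A B dj) e)))) (∣p∣≤n ((A ∪ B) ∪ C))))

  -- Eigenvalue bounds and weights of components

  0<j-i⇒i<j : ∀ {i j} → 0ℤ < j - i → i < j
  0<j-i⇒i<j {i} {j} p = subst₂ _<_ (+-identityʳ i) (ring i j) (+-monoʳ-< i p)
    where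
    ring : ∀ i j → i + (j - i) ≡ j
    ring = solve-∀

  i<j⇒0<j-i : ∀ {i j} → i < j → 0ℤ < j - i
  i<j⇒0<j-i {i} {j} p = subst (_< j - i) (+-inverseʳ i) (+-monoˡ-< (- i) p)

  cancel-pos : ∀ {a b} → 0ℤ < a → 0ℤ < a * b → 0ℤ < b
  cancel-pos {a} {b} a>0 ab>0 = *-cancelˡ-<-nonNeg a {{nonNegative (<⇒≤ a>0)}} (subst (_< a * b) (sym (*-zeroʳ a)) ab>0)

  sgn-cases : ∀ i → sgn i ≡ 1ℤ ⊎ sgn i ≡ -1ℤ
  sgn-cases zero = inj₁ refl
  sgn-cases (suc i) with sgn-cases i
  ... | inj₁ e = inj₂ (cong -_ e)
  ... | inj₂ e = inj₁ (cong -_ e)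

  -- Up to sign the eigenvalues are the numbers C(n-k-i, k-i), which lie on one diagonal of Pascal's
  -- triangle; this orders them by the degree i.
  bin-diagonal : ∀ j m r → bin m r ℕ.≤ bin (j ℕ.+ m) (j ℕ.+ r)
  bin-diagonal zero m r = ℕ.≤-refl
  bin-diagonal (suc j) m r = ℕ.≤-trans (bin-diagonal j m r) (ℕ.m≤m+n _ _)

  bin-absorb′ : ∀ m r → + suc r * + bin (suc m) (suc r) ≡ + suc m * + bin m r
  bin-absorb′ m r = begin
    + suc r * (+ bin m r + + bin m (suc r)) ≡⟨ *-distribˡ-+ (+ suc r) (+ bin m r) (+ bin m (suc r)) ⟩
    + suc r * + bin m r + + suc r * + bin m (suc r) ≡⟨ cong (λ z → + suc r * + bin m r + z) (bin-absorb m r) ⟩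
    + suc r * + bin m r + (+ m - + r) * + bin m r ≡⟨ ring (+ m) (+ r) (+ bin m r) ⟩
    + suc m * + bin m r ∎
    where
    ring : ∀ m r x → (1ℤ + r) * x + (m - r) * x ≡ (1ℤ + m) * x
    ring = solve-∀

  bin-pos : ∀ m r → 1 ℕ.≤ bin (r ℕ.+ m) r
  bin-pos m zero = ℕ.≤-refl
  bin-pos m (suc r) = ℕ.≤-trans (bin-pos m r) (ℕ.m≤m+n _ _)

  -- The Kneser graph K(n,k) with k = 2 + K and n − k = 2 + p > k; d is its degree,
  -- −ℓ its least and θ its second largest eigenvalue.
  module Parameters (K p : ℕ) (K<p : K ℕ.< p) where

    k v : ℕ
    k = 2 ℕ.+ K
    v = k ℕ.+ (2 ℕ.+ p)

    w d ℓ θ N : ℤ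
    w = + (2 ℕ.+ p)
    d = + bin (2 ℕ.+ p) (2 ℕ.+ K)
    ℓ = + bin (1 ℕ.+ p) (1 ℕ.+ K)
    θ = + bin p K
    N = + bin v k

    kd≡wℓ : + k * d ≡ w * ℓ
    kd≡wℓ = bin-absorb′ (1 ℕ.+ p) (1 ℕ.+ K)

    [k-1]ℓ≡[w-1]θ : + (1 ℕ.+ K) * ℓ ≡ + (1 ℕ.+ p) * θ
    [k-1]ℓ≡[w-1]θ = bin-absorb′ p K

    N-pos : 0ℤ < N
    N-pos = +<+ (bin-pos (2 ℕ.+ p) k)

    ℓ-pos : 0ℤ < ℓ
    ℓ-pos = +<+ (ℕ.≤-trans (bin-pos (p ℕ.∸ K) (1 ℕ.+ K)) (ℕ.≤-reflexive (cong (λ z → bin (1 ℕ.+ z) (1 ℕ.+ K)) (ℕ.m+[n∸m]≡n (ℕ.<⇒≤ K<p)))))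

    private
      2k≤v : 2 ℕ.* k ℕ.≤ v
      2k≤v = ℕ.+-monoʳ-≤ k (ℕ.≤-trans (ℕ.≤-reflexive (ℕ.+-identityʳ k)) (ℕ.s≤s (ℕ.s≤s (ℕ.<⇒≤ K<p))))

      n∸k : v ℕ.∸ k ≡ 2 ℕ.+ p
      n∸k = ℕ.m+n∸m≡n k (2 ℕ.+ p)

      module _ {i r m : ℕ} (e : r ℕ.+ suc i ≡ k) (e′ : v ≡ k ℕ.+ suc i ℕ.+ m) where
        i+r : i ℕ.+ r ≡ 1 ℕ.+ K
        i+r = trans (ℕ.+-comm i r) (ℕ.suc-injective (trans (sym (ℕ.+-suc r i)) e))
        i+m : i ℕ.+ m ≡ 1 ℕ.+ p
        i+m = ℕ.suc-injective (sym (ℕ.+-cancelˡ-≡ k (2 ℕ.+ p) (suc i ℕ.+ m) (trans e′ (ℕ.+-assoc k (suc i) m))))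

    -- An eigenvalue of nonzero degree has absolute value at most ℓ, attained in degree 1, so ℓ + Z
    -- is nonnegative off the constants.
    lower-bound : ∀ f → Level (+ k) f → (ℓ + d) * (∑ f * ∑ f) ≤ N * (ℓ * ⟪ f , f ⟫ + ⟪ f , Z f ⟫)
    lower-bound f lf = subst₂ _≤_
      (cong (λ z → z * (∑ f * ∑ f)) (trans (cong (λ z → ℓ + 1ℤ * + bin z k) n∸k) (cong (λ z → ℓ + z) (*-identityˡ d))))
      (cong (λ z → N * (ℓ * ⟪ f , f ⟫ + z)) (*-identityˡ ⟪ f , Z f ⟫))
      (Spectral.spectral-bound {v} {k} 2k≤v ℓ 1ℤ eig N-pos f lf)
      where
      eig : ∀ i r m → r ℕ.+ suc i ≡ k → v ≡ k ℕ.+ suc i ℕ.+ m → 0ℤ ≤ ℓ + 1ℤ * (sgn (suc i) * + bin m r)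
      eig i r m e e′ with sgn-cases (suc i)
      ... | inj₁ s = subst (λ z → 0ℤ ≤ ℓ + 1ℤ * (z * + bin m r)) (sym s)
            (subst (0ℤ ≤_) (ring ℓ (+ bin m r)) (+-nonneg {ℓ} (+≤+ ℕ.z≤n) (+≤+ ℕ.z≤n)))
        where
        ring : ∀ a b → a + b ≡ a + 1ℤ * (1ℤ * b)
        ring = solve-∀
      ... | inj₂ s = subst (λ z → 0ℤ ≤ ℓ + 1ℤ * (z * + bin m r)) (sym s)
            (subst (0ℤ ≤_) (ring ℓ (+ bin m r)) (i≤j⇒0≤j-i (+≤+
              (subst₂ (λ x y → bin m r ℕ.≤ bin x y) (i+m e e′) (i+r e e′) (bin-diagonal i m r)))))
        where
        ring : ∀ a b → a - b ≡ a + 1ℤ * (-1ℤ * b)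
        ring = solve-∀

    -- Odd degrees have negative eigenvalues. Degree 0 is the constants, so the first positive
    -- eigenvalue to beat is θ in degree 2.
    upper-bound : ∀ f → Level (+ k) f → N * ⟪ f , Z f ⟫ ≤ N * θ * ⟪ f , f ⟫ + (d - θ) * (∑ f * ∑ f)
    upper-bound f lf = 0≤i-j⇒j≤i (subst (0ℤ ≤_) (ring N θ d (∑ f * ∑ f) ⟪ f , f ⟫ ⟪ f , Z f ⟫)
      (i≤j⇒0≤j-i (subst (λ z → (θ + -1ℤ * + bin z k) * (∑ f * ∑ f) ≤ N * (θ * ⟪ f , f ⟫ + -1ℤ * ⟪ f , Z f ⟫)) n∸k
        (Spectral.spectral-bound {v} {k} 2k≤v θ -1ℤ eig N-pos f lf))))
      where
      ring : ∀ N θ d s x z → N * (θ * x + -1ℤ * z) - (θ + -1ℤ * d) * s ≡ N * θ * x + (d - θ) * s - N * z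
      ring = solve-∀
      add : ∀ a b → a + b ≡ a + -1ℤ * (-1ℤ * b)
      add = solve-∀
      sub : ∀ a b → a - b ≡ a + -1ℤ * (1ℤ * b)
      sub = solve-∀
      eig : ∀ i r m → r ℕ.+ suc i ≡ k → v ≡ k ℕ.+ suc i ℕ.+ m → 0ℤ ≤ θ + -1ℤ * (sgn (suc i) * + bin m r)
      eig i r m e e′ with sgn-cases (suc i)
      ... | inj₂ s = subst (λ z → 0ℤ ≤ θ + -1ℤ * (z * + bin m r)) (sym s)
            (subst (0ℤ ≤_) (add θ (+ bin m r)) (+-nonneg {θ} (+≤+ ℕ.z≤n) (+≤+ ℕ.z≤n)))
      eig zero r m e e′ | inj₁ ()
      eig (suc i) r m e e′ | inj₁ s = subst (λ z → 0ℤ ≤ θ + -1ℤ * (z * + bin m r)) (sym s)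
            (subst (0ℤ ≤_) (sub θ (+ bin m r)) (i≤j⇒0≤j-i (+≤+
              (subst₂ (λ x y → bin m r ℕ.≤ bin x y) (ℕ.suc-injective (i+m e e′)) (ℕ.suc-injective (i+r e e′)) (bin-diagonal i m r)))))

    -- The first two inequalities of `generic` are equalities for K(10,4), where d, ℓ, θ are 15, 10,
    -- 6, and the third is one for K(8,3). They fail for n = 2k + 1 with k = 3, 4, whence the two
    -- numerical cases.
    data Regime : Set where
      generic : + 3 * ℓ ≤ + 2 * d → + 5 * θ ≤ + 3 * ℓ → + 6 ≤ ℓ → Regime
      seven : K ≡ 1 → p ≡ 2 → N ≡ + 35 → d ≡ + 4 → ℓ ≡ + 3 → θ ≡ + 2 → Regime
      nine : K ≡ 2 → p ≡ 3 → N ≡ + 126 → d ≡ + 5 → ℓ ≡ + 4 → θ ≡ + 3 → Regime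

  -- A class of m vertices spanning e ordered edges gets the value 1/b in the test
  -- function for the lower bound.
  record Weight (N ℓ n k w m e : ℤ) : Set where
    field
      b : ℤ
      positive-b : 0ℤ < b
      fits : N * (e + ℓ * m) ≤ m * b
      bound : b * (k * m + w) ≤ N * m * (n * ℓ)
      strict : + 2 ≤ m → b * (k * m + w) < N * m * (n * ℓ)

  module Arithmetic {N d ℓ θ k w : ℤ} (N>0 : 0ℤ < N) (ℓ>0 : 0ℤ < ℓ) (k>0 : 0ℤ < k) (kd≡wℓ : k * d ≡ w * ℓ) where

    -- A single vertex spans no edge, so b = N ℓ fits, and `bound` is then an equality. Singletons
    -- therefore cost nothing in the final sum.
    weight-singleton : ∀ {m e} → m ≡ 1ℤ → e ≤ m * (m - 1ℤ) → Weight N ℓ (k + w) k w m e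
    weight-singleton {m} {e} refl e≤ = record
      { b = N * ℓ
      ; positive-b = *-pos N>0 ℓ>0
      ; fits = 0≤i-j⇒j≤i (subst (0ℤ ≤_) (ring₁ N ℓ e) (*-nonneg (<⇒≤ N>0) (i≤j⇒0≤j-i e≤)))
      ; bound = ≤-reflexive (ring₂ N ℓ k w)
      ; strict = λ { (+≤+ (ℕ.s≤s ())) }
      }
      where
      ring₁ : ∀ N ℓ e → N * (0ℤ - e) ≡ 1ℤ * (N * ℓ) - N * (e + ℓ * 1ℤ)
      ring₁ = solve-∀
      ring₂ : ∀ N ℓ k w → N * ℓ * (k * 1ℤ + w) ≡ N * 1ℤ * ((k + w) * ℓ)
      ring₂ = solve-∀

    -- Bounding the average degree in the class by m − 1.
    weight-small : ∀ {m e} → + 2 ≤ m → e ≤ m * (m - 1ℤ) → k * m + w < k * d → Weight N ℓ (k + w) k w m e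
    weight-small {m} {e} m≥2 e≤ small = record
      { b = N * (ℓ + (m - 1ℤ))
      ; positive-b = *-pos N>0 (+-mono-<-≤ ℓ>0 (<⇒≤ m-1>0))
      ; fits = 0≤i-j⇒j≤i (subst (0ℤ ≤_) (ring₁ N ℓ m e) (*-nonneg (<⇒≤ N>0) (i≤j⇒0≤j-i e≤)))
      ; bound = <⇒≤ st
      ; strict = λ _ → st
      }
      where
      m-1>0 : 0ℤ < m - 1ℤ
      m-1>0 = i<j⇒0<j-i (<-≤-trans (+<+ (ℕ.s≤s (ℕ.s≤s ℕ.z≤n))) m≥2)
      ring₁ : ∀ N ℓ m e → N * (m * (m - 1ℤ) - e) ≡ m * (N * (ℓ + (m - 1ℤ))) - N * (e + ℓ * m)
      ring₁ = solve-∀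
      ring₂ : ∀ N ℓ m k w → N * (m - 1ℤ) * (w * ℓ - (k * m + w)) ≡
        N * m * ((k + w) * ℓ) - N * (ℓ + (m - 1ℤ)) * (k * m + w)
      ring₂ = solve-∀
      st : N * (ℓ + (m - 1ℤ)) * (k * m + w) < N * m * ((k + w) * ℓ)
      -- The slack factors as N (m - 1)(k d - (k m + w)), so `small` is exactly what strictness
      -- needs.
      st = 0<j-i⇒i<j (subst (0ℤ <_) (trans (cong (λ z → N * (m - 1ℤ) * (z - (k * m + w))) kd≡wℓ) (ring₂ N ℓ m k w))
        (*-pos (*-pos N>0 m-1>0) (i<j⇒0<j-i small)))

    -- Bounding it by the expander mixing lemma.
    weight-mixing : ∀ {m e} → 0ℤ < m → 0ℤ ≤ θ → θ ≤ d → N * e ≤ N * θ * m + (d - θ) * (m * m) →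
      (N * (ℓ + θ) + (d - θ) * m) * (k * m + w) < N * m * ((k + w) * ℓ) → Weight N ℓ (k + w) k w m e
    weight-mixing {m} {e} m>0 θ≥0 θ≤d mix st = record
      { b = N * (ℓ + θ) + (d - θ) * m
      ; positive-b = +-mono-<-≤ (*-pos N>0 (+-mono-<-≤ ℓ>0 θ≥0)) (*-nonneg (i≤j⇒0≤j-i θ≤d) (<⇒≤ m>0))
      ; fits = 0≤i-j⇒j≤i (subst (0ℤ ≤_) (ring N ℓ θ d m e) (i≤j⇒0≤j-i mix))
      ; bound = <⇒≤ st
      ; strict = λ _ → st
      }
      where
      ring : ∀ N ℓ θ d m e → N * θ * m + (d - θ) * (m * m) - N * e ≡ m * (N * (ℓ + θ) + (d - θ) * m) - N * (e + ℓ * m)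
      ring = solve-∀

    -- Multiplied by ℓ and simplified with `kd≡wℓ`, the required inequality reads k Y > 0, where Y
    -- is a concave quadratic in m. The hypotheses `large` and `m≤` place both m and N - m at or
    -- above d (ℓ - 1)/ℓ, and Y is positive on that range.
    weight-large : ∀ {m e} → 0ℤ < m → 0ℤ ≤ θ → + 3 * ℓ ≤ + 2 * d → + 5 * θ ≤ + 3 * ℓ → + 6 ≤ ℓ →
      k * d ≤ k * m + w → m + d + 1ℤ ≤ N → N * e ≤ N * θ * m + (d - θ) * (m * m) → Weight N ℓ (k + w) k w m e
    weight-large {m} {e} m>0 θ≥0 3ℓ≤2d 5θ≤3ℓ ℓ≥6 large m≤ mix = weight-mixing m>0 θ≥0 θ≤d mix
      (0<j-i⇒i<j (cancel-pos ℓ>0 (subst (0ℤ <_) final (*-pos k>0 Y>0))))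
      where
      g = N - m
      ℓ≥0 = <⇒≤ ℓ>0
      10[d-θ]-9ℓ : 0ℤ ≤ + 10 * d - + 10 * θ - + 9 * ℓ
      10[d-θ]-9ℓ = subst (0ℤ ≤_) (ring d θ ℓ) (+-nonneg (*-nonneg {+ 5} (+≤+ ℕ.z≤n) (i≤j⇒0≤j-i 3ℓ≤2d)) (*-nonneg {+ 2} (+≤+ ℕ.z≤n) (i≤j⇒0≤j-i 5θ≤3ℓ)))
        where
        ring : ∀ d θ ℓ → + 5 * (+ 2 * d - + 3 * ℓ) + + 2 * (+ 3 * ℓ - + 5 * θ) ≡ + 10 * d - + 10 * θ - + 9 * ℓ
        ring = solve-∀
      d-θ>0 : 0ℤ < d - θ
      d-θ>0 = cancel-pos {+ 10} (+<+ ℕ.z<s) (subst (0ℤ <_) (ring d θ ℓ) (+-mono-≤-< 10[d-θ]-9ℓ (*-pos {+ 9} (+<+ ℕ.z<s) ℓ>0)))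
        where
        ring : ∀ d θ ℓ → + 10 * d - + 10 * θ - + 9 * ℓ + + 9 * ℓ ≡ + 10 * (d - θ)
        ring = solve-∀
      d-θ≥0 : 0ℤ ≤ d - θ
      d-θ≥0 = <⇒≤ d-θ>0
      θ≤d : θ ≤ d
      θ≤d = 0≤i-j⇒j≤i d-θ≥0
      d≥0 : 0ℤ ≤ d
      d≥0 = ≤-trans θ≥0 θ≤d
      ℓ-1≥0 : 0ℤ ≤ ℓ - 1ℤ
      ℓ-1≥0 = i≤j⇒0≤j-i (≤-trans (+≤+ (ℕ.s≤s ℕ.z≤n)) ℓ≥6)
      a = (ℓ - 1ℤ) * (d - θ)
      a≥0 : 0ℤ ≤ a
      a≥0 = *-nonneg ℓ-1≥0 d-θ≥0
      -- From d - θ ≥ 9ℓ/10 and θ ≤ 3ℓ/5 this reduces to 9ℓ² - 50ℓ + 9 ≥ 0, which holds at ℓ = 6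
      -- (value 33) but not at ℓ = 5. The polynomial is expanded around 6.
      gap : 0ℤ ≤ (ℓ - 1ℤ) * (ℓ - 1ℤ) * (d - θ) - + 2 * ℓ * (ℓ + θ)
      gap = cancel-nonneg {+ 10} (+<+ ℕ.z<s) (subst (0ℤ ≤_) (ring d θ ℓ)
        (+-nonneg (+-nonneg (*-nonneg (square-nonneg (ℓ - 1ℤ)) 10[d-θ]-9ℓ) (*-nonneg (*-nonneg {+ 4} (+≤+ ℕ.z≤n) ℓ≥0) (i≤j⇒0≤j-i 5θ≤3ℓ)))
          (*-nonneg ℓ≥0 (+-nonneg (+-nonneg {+ 33} (+≤+ ℕ.z≤n) (*-nonneg {+ 58} (+≤+ ℕ.z≤n) (i≤j⇒0≤j-i ℓ≥6)))
            (*-nonneg {+ 9} (+≤+ ℕ.z≤n) (square-nonneg (ℓ - + 6)))))))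
        where
        ring : ∀ d θ ℓ → (ℓ - 1ℤ) * (ℓ - 1ℤ) * (+ 10 * d - + 10 * θ - + 9 * ℓ) + + 4 * ℓ * (+ 3 * ℓ - + 5 * θ)
          + ℓ * (+ 33 + + 58 * (ℓ - + 6) + + 9 * ((ℓ - + 6) * (ℓ - + 6)))
          ≡ + 10 * ((ℓ - 1ℤ) * (ℓ - 1ℤ) * (d - θ) - + 2 * ℓ * (ℓ + θ))
        ring = solve-∀
      big : ∀ x → 0ℤ ≤ ℓ * x - d * (ℓ - 1ℤ) → 0ℤ ≤ a * x - + 2 * d * (ℓ + θ)
      big x h = cancel-nonneg ℓ>0 (subst (0ℤ ≤_) (ring d θ ℓ x) (+-nonneg (*-nonneg a≥0 h) (*-nonneg d≥0 gap)))
        where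
        ring : ∀ d θ ℓ x → (ℓ - 1ℤ) * (d - θ) * (ℓ * x - d * (ℓ - 1ℤ)) + d * ((ℓ - 1ℤ) * (ℓ - 1ℤ) * (d - θ) - + 2 * ℓ * (ℓ + θ))
          ≡ ℓ * ((ℓ - 1ℤ) * (d - θ) * x - + 2 * d * (ℓ + θ))
        ring = solve-∀
      big-m : 0ℤ ≤ a * m - + 2 * d * (ℓ + θ)
      big-m = big m (cancel-nonneg k>0 (subst (0ℤ ≤_) (trans (ring₁ ℓ k d m w) (trans (cong (λ z → ℓ * (k * m) + z - ℓ * (k * d)) (sym kd≡wℓ)) (ring₂ ℓ k d m)))
        (*-nonneg ℓ≥0 (i≤j⇒0≤j-i large))))
        where
        ring₁ : ∀ ℓ k d m w → ℓ * (k * m + w - k * d) ≡ ℓ * (k * m) + w * ℓ - ℓ * (k * d)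
        ring₁ = solve-∀
        ring₂ : ∀ ℓ k d m → ℓ * (k * m) + k * d - ℓ * (k * d) ≡ k * (ℓ * m - d * (ℓ - 1ℤ))
        ring₂ = solve-∀
      g-d-1 : 0ℤ ≤ g - d - 1ℤ
      g-d-1 = subst (0ℤ ≤_) (ring N m d) (i≤j⇒0≤j-i m≤)
        where
        ring : ∀ N m d → N - (m + d + 1ℤ) ≡ N - m - d - 1ℤ
        ring = solve-∀
      big-g : 0ℤ ≤ a * g - + 2 * d * (ℓ + θ)
      big-g = big g (subst (0ℤ ≤_) (ring ℓ g d) (+-nonneg (+-nonneg (*-nonneg ℓ≥0 g-d-1) ℓ≥0) d≥0))
        where
        ring : ∀ ℓ g d → ℓ * (g - d - 1ℤ) + ℓ + d ≡ ℓ * g - d * (ℓ - 1ℤ)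
        ring = solve-∀
      g≥0 : 0ℤ ≤ g
      g≥0 = subst (0ℤ ≤_) (ring g d) (+-nonneg g-d-1 (+-nonneg d≥0 (+≤+ {0} {1} ℕ.z≤n)))
        where
        ring : ∀ g d → g - d - 1ℤ + (d + 1ℤ) ≡ g
        ring = solve-∀
      Y = ℓ * m * (d - θ) * g - d * (N * (ℓ + θ) + (d - θ) * m)
      Y>0 : 0ℤ < Y
      -- 2Y is written through `big-m` and `big-g`, so that m and N - m enter nearly symmetrically.
      -- Strictness comes from the remaining term 2 (d - θ) m (N - m - d).
      Y>0 = cancel-pos {+ 2} (+<+ ℕ.z<s) (subst (0ℤ <_) (ring d θ ℓ m N)
        (+-mono-<-≤ (*-pos {+ 2} (+<+ ℕ.z<s) (*-pos (*-pos d-θ>0 m>0) (+-mono-≤-< g-d-1 (+<+ {0} {1} ℕ.z<s))))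
          (+-nonneg (*-nonneg g≥0 big-m) (*-nonneg (<⇒≤ m>0) big-g))))
        where
        ring : ∀ d θ ℓ m N → + 2 * ((d - θ) * m * (N - m - d - 1ℤ + 1ℤ))
          + ((N - m) * ((ℓ - 1ℤ) * (d - θ) * m - + 2 * d * (ℓ + θ)) + m * ((ℓ - 1ℤ) * (d - θ) * (N - m) - + 2 * d * (ℓ + θ)))
          ≡ + 2 * (ℓ * m * (d - θ) * (N - m) - d * (N * (ℓ + θ) + (d - θ) * m))
        ring = solve-∀
      final : k * Y ≡ ℓ * (N * m * ((k + w) * ℓ) - (N * (ℓ + θ) + (d - θ) * m) * (k * m + w))
      final = begin
        k * Y ≡⟨ ring₁ k d θ ℓ m N ⟩
        N * m * (k * ℓ * ℓ) + (N * m * ℓ) * (k * d) - (N * (ℓ + θ) + (d - θ) * m) * (ℓ * k * m) - (N * (ℓ + θ) + (d - θ) * m) * (k * d)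
          ≡⟨ cong (λ z → N * m * (k * ℓ * ℓ) + (N * m * ℓ) * z - (N * (ℓ + θ) + (d - θ) * m) * (ℓ * k * m) - (N * (ℓ + θ) + (d - θ) * m) * z) kd≡wℓ ⟩
        N * m * (k * ℓ * ℓ) + (N * m * ℓ) * (w * ℓ) - (N * (ℓ + θ) + (d - θ) * m) * (ℓ * k * m) - (N * (ℓ + θ) + (d - θ) * m) * (w * ℓ)
          ≡⟨ ring₂ k d θ ℓ m N w ⟩
        ℓ * (N * m * ((k + w) * ℓ) - (N * (ℓ + θ) + (d - θ) * m) * (k * m + w)) ∎
        where
        ring₁ : ∀ k d θ ℓ m N → k * (ℓ * m * (d - θ) * (N - m) - d * (N * (ℓ + θ) + (d - θ) * m)) ≡
          N * m * (k * ℓ * ℓ) + (N * m * ℓ) * (k * d) - (N * (ℓ + θ) + (d - θ) * m) * (ℓ * k * m) - (N * (ℓ + θ) + (d - θ) * m) * (k * d)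
        ring₁ = solve-∀
        ring₂ : ∀ k d θ ℓ m N w →
          N * m * (k * ℓ * ℓ) + (N * m * ℓ) * (w * ℓ) - (N * (ℓ + θ) + (d - θ) * m) * (ℓ * k * m) - (N * (ℓ + θ) + (d - θ) * m) * (w * ℓ) ≡
          ℓ * (N * m * ((k + w) * ℓ) - (N * (ℓ + θ) + (d - θ) * m) * (k * m + w))
        ring₂ = solve-∀

  -- Summation over the components

  Σᶠ : ∀ {c} → (Fin c → ℤ) → ℤ
  Σᶠ {zero} g = 0ℤ
  Σᶠ {suc c} g = g zero + Σᶠ (λ i → g (suc i))

  Σᶠ-cong : ∀ {c} {g h : Fin c → ℤ} → g ≗ h → Σᶠ g ≡ Σᶠ h
  Σᶠ-cong {zero} e = refl
  Σᶠ-cong {suc c} e = cong₂ _+_ (e zero) (Σᶠ-cong (λ i → e (suc i)))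

  Σᶠ-lin : ∀ {c} a b (g h : Fin c → ℤ) → Σᶠ (λ i → a * g i + b * h i) ≡ a * Σᶠ g + b * Σᶠ h
  Σᶠ-lin {zero} a b g h = ring a b
    where
    ring : ∀ a b → 0ℤ ≡ a * 0ℤ + b * 0ℤ
    ring = solve-∀
  Σᶠ-lin {suc c} a b g h = trans (cong (λ z → a * g zero + b * h zero + z) (Σᶠ-lin a b (λ i → g (suc i)) (λ i → h (suc i))))
    (ring a b (g zero) (h zero) (Σᶠ (λ i → g (suc i))) (Σᶠ (λ i → h (suc i))))
    where
    ring : ∀ a b x y u v → a * x + b * y + (a * u + b * v) ≡ a * (x + u) + b * (y + v)
    ring = solve-∀

  Σᶠ-scale : ∀ {c} a (g : Fin c → ℤ) → Σᶠ (λ i → a * g i) ≡ a * Σᶠ g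
  Σᶠ-scale {zero} a g = sym (*-zeroʳ a)
  Σᶠ-scale {suc c} a g = trans (cong (λ z → a * g zero + z) (Σᶠ-scale a (λ i → g (suc i)))) (sym (*-distribˡ-+ a (g zero) _))

  Σᶠ-const : ∀ c a → Σᶠ {c} (λ _ → a) ≡ + c * a
  Σᶠ-const zero a = refl
  Σᶠ-const (suc c) a = trans (cong (λ z → a + z) (Σᶠ-const c a)) (ring a (+ c))
    where
    ring : ∀ a c → a + c * a ≡ (1ℤ + c) * a
    ring = solve-∀

  Σᶠ-mono : ∀ {c} {g h : Fin c → ℤ} → (∀ i → g i ≤ h i) → Σᶠ g ≤ Σᶠ h
  Σᶠ-mono {zero} le = ≤-refl
  Σᶠ-mono {suc c} le = +-mono-≤ (le zero) (Σᶠ-mono (λ i → le (suc i)))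

  Σᶠ-mono-< : ∀ {c} {g h : Fin c → ℤ} → (∀ i → g i ≤ h i) → ∀ j → g j < h j → Σᶠ g < Σᶠ h
  Σᶠ-mono-< {suc c} le zero lt = +-mono-<-≤ lt (Σᶠ-mono (λ i → le (suc i)))
  Σᶠ-mono-< {suc c} le (suc j) lt = +-mono-≤-< (le zero) (Σᶠ-mono-< (λ i → le (suc i)) j lt)

  ∑-Σᶠ : ∀ {c} (g : Fin c → Fn n) → ∑ (λ A → Σᶠ (λ i → g i A)) ≡ Σᶠ (λ i → ∑ (g i))
  ∑-Σᶠ {n} {zero} g = ∑-0 {n}
  ∑-Σᶠ {n} {suc c} g = begin
    ∑ (λ A → g zero A + Σᶠ (λ i → g (suc i) A)) ≡⟨ ∑-cong (λ A → ones (g zero A) (Σᶠ (λ i → g (suc i) A))) ⟩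
    ∑ (λ A → 1ℤ * g zero A + 1ℤ * Σᶠ (λ i → g (suc i) A)) ≡⟨ ∑-lin 1ℤ 1ℤ (g zero) (λ A → Σᶠ (λ i → g (suc i) A)) ⟩
    1ℤ * ∑ (g zero) + 1ℤ * ∑ (λ A → Σᶠ (λ i → g (suc i) A)) ≡⟨ sym (ones (∑ (g zero)) (∑ (λ A → Σᶠ (λ i → g (suc i) A)))) ⟩
    ∑ (g zero) + ∑ (λ A → Σᶠ (λ i → g (suc i) A)) ≡⟨ cong (λ z → ∑ (g zero) + z) (∑-Σᶠ (λ i → g (suc i))) ⟩
    ∑ (g zero) + Σᶠ (λ i → ∑ (g (suc i))) ∎
    where
    ones : ∀ x y → x + y ≡ 1ℤ * x + 1ℤ * y
    ones = solve-∀

  common-multiple : ∀ {c} (b : Fin c → ℤ) → (∀ i → 0ℤ < b i) →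
    ∃ λ M → 0ℤ < M × Σ (Fin c → ℤ) λ q → ∀ i → 0ℤ < q i × b i * q i ≡ M
  common-multiple {zero} b b>0 = 1ℤ , +<+ ℕ.z<s , (λ ()) , λ ()
  common-multiple {suc c} b b>0 with common-multiple (λ i → b (suc i)) (λ i → b>0 (suc i))
  ... | M , M>0 , q , qM = b zero * M , *-pos (b>0 zero) M>0 , q′ , q′M
    where
    q′ : Fin (suc c) → ℤ
    q′ zero = M
    q′ (suc i) = b zero * q i
    ring : ∀ a b c → a * (b * c) ≡ b * (a * c)
    ring = solve-∀
    q′M : ∀ i → 0ℤ < q′ i × b i * q′ i ≡ b zero * M
    q′M zero = M>0 , refl
    q′M (suc i) = *-pos (b>0 zero) (proj₁ (qM i)) ,
      trans (ring (b (suc i)) (b zero) (q i)) (cong (b zero *_) (proj₂ (qM i)))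

  -- In the application `nothing` labels whatever lies in no component: deleted vertices and sets of
  -- size other than k.
  δ : ∀ {c} → Maybe (Fin c) → Fin c → ℤ
  δ nothing i = 0ℤ
  δ (just j) i = ind (does (j Fin.≟ i))

  Σᶠ-δ : ∀ {c} (g : Fin c → ℤ) j → Σᶠ (λ i → g i * δ (just j) i) ≡ g j
  Σᶠ-δ {suc c} g zero = trans (cong (λ z → g zero * 1ℤ + z) (trans (Σᶠ-cong (λ i → *-zeroʳ (g (suc i)))) (trans (Σᶠ-const c 0ℤ) (*-zeroʳ (+ c))))) (ring (g zero))
    where
    ring : ∀ x → x * 1ℤ + 0ℤ ≡ x
    ring = solve-∀
  Σᶠ-δ {suc c} g (suc j) = trans (cong₂ _+_ (*-zeroʳ (g zero)) (Σᶠ-δ (λ i → g (suc i)) j)) (+-identityˡ (g (suc j)))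

  δ-nonneg : ∀ {c} x (i : Fin c) → 0ℤ ≤ δ x i
  δ-nonneg nothing i = ≤-refl
  δ-nonneg (just j) i with does (j Fin.≟ i)
  ... | true = +≤+ ℕ.z≤n
  ... | false = ≤-refl

  δ-just : ∀ {c} (i : Fin c) → δ (just i) i ≡ 1ℤ
  δ-just i = cong ind (dec-true (i Fin.≟ i) refl)

  δ-cases : ∀ {c} x (i : Fin c) → x ≡ just i ⊎ δ x i ≡ 0ℤ
  δ-cases nothing i = inj₂ refl
  δ-cases (just j) i with j Fin.≟ i
  ... | yes refl = inj₁ refl
  ... | no _ = inj₂ refl

  ∑-mono : {f g : Fn n} → (∀ A → f A ≤ g A) → ∑ f ≤ ∑ g
  ∑-mono {zero} le = le []
  ∑-mono {suc n} le = +-mono-≤ (∑-mono (λ A → le (true ∷ A))) (∑-mono (λ A → le (false ∷ A)))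

  private
    pos-by : ∀ {x y} → 0ℤ ≤ x → 1ℤ + x ≡ y → 0ℤ < y
    pos-by x≥0 refl = +-mono-<-≤ (+<+ {0} {1} ℕ.z<s) x≥0

    next : ∀ {i j} → i ≤ j → i ≢ j → 1ℤ + i ≤ j
    next i≤j ne = i<j⇒suc[i]≤j (≤∧≢⇒< i≤j ne)

  -- The exceptional graphs K(7,3) and K(9,4).

  module Weight₇ where
    open Arithmetic {+ 35} {+ 4} {+ 3} {+ 2} {+ 3} {+ 4} (+<+ ℕ.z<s) (+<+ ℕ.z<s) (+<+ ℕ.z<s) refl

    -- The degree bound suffices only for m = 2, and mixing alone only for 4 ≤ m ≤ 29. For m = 3 the
    -- class is not a triangle; for m = 30, the largest size possible, a second class of m′ vertices
    -- sharpens the mixing bound.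
    weight₇ : ∀ {m e m′ e′} → + 2 ≤ m → e ≤ m * (m - 1ℤ) → (+ 3 ≤ m → e ≤ m * (m - 1ℤ) - 1ℤ) →
      + 35 * e ≤ + 35 * + 2 * m + (+ 4 - + 2) * (m * m) → m + + 4 + 1ℤ ≤ + 35 → 1ℤ ≤ m′ → 0ℤ ≤ e′ → m + m′ ≤ + 35 →
      + 35 * (+ 36 * e + + 25 * e′) ≤ + 35 * + 2 * (+ 36 * m + + 25 * m′) + (+ 4 - + 2) * ((+ 6 * m - + 5 * m′) * (+ 6 * m - + 5 * m′)) →
      Weight (+ 35) (+ 3) (+ 3 + + 4) (+ 3) (+ 4) m e
    weight₇ {m} {e} {m′} {e′} m≥2 e₁ e₂ mix m≤30 m′≥1 e′≥0 sum≤ mix₂ with + 2 ≟ m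
    ... | yes refl = weight-small m≥2 e₁ (+<+ (ℕ.<ᵇ⇒< 10 12 _))
    ... | no ne₂ with + 3 ≟ m
    ...   | yes refl = record
            -- The least integer with 35 (5 + 9) ≤ 3b, since e ≤ 5.
            { b = + 164
            ; positive-b = +<+ ℕ.z<s
            ; fits = 0≤i-j⇒j≤i (subst (0ℤ ≤_) (ring e) (+-nonneg (*-nonneg {+ 35} (+≤+ ℕ.z≤n) (i≤j⇒0≤j-i (e₂ ≤-refl))) (+≤+ {0} {2} ℕ.z≤n)))
            ; bound = +≤+ (ℕ.≤ᵇ⇒≤ 2132 2205 _)
            ; strict = λ _ → +<+ (ℕ.<ᵇ⇒< 2132 2205 _)
            }
      where
      ring : ∀ e → + 35 * (+ 5 - e) + + 2 ≡ + 3 * + 164 - + 35 * (e + + 9)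
      ring = solve-∀
    ...   | no ne₃ with + 30 ≟ m
    ...     | yes refl = record
            -- The least integer with 35 (110 + 90) ≤ 30b. It is also the largest one that `bound`
            -- allows, as 94 · 235 > 22050.
            { b = + 234
            ; positive-b = +<+ ℕ.z<s
            ; fits = 0≤i-j⇒j≤i (subst (0ℤ ≤_) (ring e) (+-nonneg (*-nonneg {+ 35} (+≤+ ℕ.z≤n) e≤110) (+≤+ {0} {20} ℕ.z≤n)))
            ; bound = +≤+ (ℕ.≤ᵇ⇒≤ 21996 22050 _)
            ; strict = λ _ → +<+ (ℕ.<ᵇ⇒< 21996 22050 _)
            }
      where
      ring : ∀ e → + 35 * (+ 110 - e) + + 20 ≡ + 30 * + 234 - + 35 * (e + + 90)
      ring = solve-∀
      ring₂ : ∀ e m′ e′ → + 35 * + 2 * (+ 36 * + 30 + + 25 * m′) + (+ 4 - + 2) * ((+ 6 * + 30 - + 5 * m′) * (+ 6 * + 30 - + 5 * m′))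
        - + 35 * (+ 36 * e + + 25 * e′) + + 875 * e′ + + 50 * ((m′ - 1ℤ) * (+ 35 - (+ 30 + m′) + + 31))
        ≡ + 1260 * (+ 110 - e)
      ring₂ = solve-∀
      -- With e′ ≥ 0, `mixing₂` gives 1260 e ≤ 138600 + 50 (m′ - 1)(m′ - 36). The product is
      -- nonpositive for 1 ≤ m′ ≤ 36, and 138600 = 1260 · 110.
      e≤110 : 0ℤ ≤ + 110 - e
      e≤110 = cancel-nonneg {+ 1260} (+<+ ℕ.z<s) (subst (0ℤ ≤_) (ring₂ e m′ e′)
        (+-nonneg (+-nonneg (i≤j⇒0≤j-i mix₂) (*-nonneg {+ 875} (+≤+ ℕ.z≤n) e′≥0))
          (*-nonneg {+ 50} (+≤+ ℕ.z≤n) (*-nonneg (i≤j⇒0≤j-i m′≥1) (+-nonneg (i≤j⇒0≤j-i sum≤) (+≤+ {0} {31} ℕ.z≤n))))))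
    ...     | no ne₃₀ = weight-mixing (<-≤-trans (+<+ ℕ.z<s) m≥2) (+≤+ ℕ.z≤n) (+≤+ (ℕ.≤ᵇ⇒≤ 2 4 _)) mix
            (0<j-i⇒i<j (pos-by (+-nonneg (+-nonneg (*-nonneg {+ 6} (+≤+ ℕ.z≤n) (*-nonneg m-4 29-m)) (*-nonneg {+ 4} (+≤+ ℕ.z≤n) m-4)) (+≤+ {0} {11} ℕ.z≤n)) (ring m)))
      where
      m-4 : 0ℤ ≤ m - + 4
      m-4 = i≤j⇒0≤j-i (next (next m≥2 ne₂) ne₃)
      29-m : 0ℤ ≤ + 29 - m
      29-m = subst (0ℤ ≤_) (ring′ m) (i≤j⇒0≤j-i (next (0≤i-j⇒j≤i (subst (0ℤ ≤_) (ring″ m) (i≤j⇒0≤j-i m≤30))) (λ eq → ne₃₀ (sym eq))))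
        where
        ring′ : ∀ m → + 30 - (1ℤ + m) ≡ + 29 - m
        ring′ = solve-∀
        ring″ : ∀ m → + 35 - (m + + 4 + 1ℤ) ≡ + 30 - m
        ring″ = solve-∀
      ring : ∀ m → 1ℤ + (+ 6 * ((m - + 4) * (+ 29 - m)) + + 4 * (m - + 4) + + 11)
        ≡ + 35 * m * (+ 7 * + 3) - (+ 35 * (+ 3 + + 2) + (+ 4 - + 2) * m) * (+ 3 * m + + 4)
      ring = solve-∀

  module Weight₉ where
    open Arithmetic {+ 126} {+ 5} {+ 4} {+ 3} {+ 4} {+ 5} (+<+ ℕ.z<s) (+<+ ℕ.z<s) (+<+ ℕ.z<s) refl

    -- The degree bound covers m = 2, 3 and mixing covers every m from 5 to 120. Only m = 4 is left,
    -- where it is enough that the class is not complete.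
    weight₉ : ∀ {m e} → + 2 ≤ m → e ≤ m * (m - 1ℤ) → (+ 3 ≤ m → e ≤ m * (m - 1ℤ) - 1ℤ) →
      + 126 * e ≤ + 126 * + 3 * m + (+ 5 - + 3) * (m * m) → m + + 5 + 1ℤ ≤ + 126 →
      Weight (+ 126) (+ 4) (+ 4 + + 5) (+ 4) (+ 5) m e
    weight₉ {m} {e} m≥2 e₁ e₂ mix m≤120 with + 2 ≟ m
    ... | yes refl = weight-small m≥2 e₁ (+<+ (ℕ.<ᵇ⇒< 13 20 _))
    ... | no ne₂ with + 3 ≟ m
    ...   | yes refl = weight-small m≥2 e₁ (+<+ (ℕ.<ᵇ⇒< 17 20 _))
    ...   | no ne₃ with + 4 ≟ m
    ...     | yes refl = record
            -- The least integer with 126 (11 + 16) ≤ 4b, since e ≤ 11.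
            { b = + 851
            ; positive-b = +<+ ℕ.z<s
            ; fits = 0≤i-j⇒j≤i (subst (0ℤ ≤_) (ring e) (+-nonneg (*-nonneg {+ 126} (+≤+ ℕ.z≤n) (i≤j⇒0≤j-i (e₂ (+≤+ (ℕ.≤ᵇ⇒≤ 3 4 _))))) (+≤+ {0} {2} ℕ.z≤n)))
            ; bound = +≤+ (ℕ.≤ᵇ⇒≤ 17871 18144 _)
            ; strict = λ _ → +<+ (ℕ.<ᵇ⇒< 17871 18144 _)
            }
      where
      ring : ∀ e → + 126 * (+ 11 - e) + + 2 ≡ + 4 * + 851 - + 126 * (e + + 16)
      ring = solve-∀
    ...     | no ne₄ = weight-mixing (<-≤-trans (+<+ ℕ.z<s) m≥2) (+≤+ ℕ.z≤n) (+≤+ (ℕ.≤ᵇ⇒≤ 3 5 _)) mix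
            (0<j-i⇒i<j (pos-by (+-nonneg (+-nonneg (*-nonneg {+ 8} (+≤+ ℕ.z≤n) (*-nonneg m-5 120-m)) (*-nonneg {+ 2} (+≤+ ℕ.z≤n) 120-m)) (+≤+ {0} {149} ℕ.z≤n)) (ring m)))
      where
      m-5 : 0ℤ ≤ m - + 5
      m-5 = i≤j⇒0≤j-i (next (next (next m≥2 ne₂) ne₃) ne₄)
      120-m : 0ℤ ≤ + 120 - m
      120-m = subst (0ℤ ≤_) (ring″ m) (i≤j⇒0≤j-i m≤120)
        where
        ring″ : ∀ m → + 126 - (m + + 5 + 1ℤ) ≡ + 120 - m
        ring″ = solve-∀
      ring : ∀ m → 1ℤ + (+ 8 * ((m - + 5) * (+ 120 - m)) + + 2 * (+ 120 - m) + + 149)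
        ≡ + 126 * m * (+ 9 * + 4) - (+ 126 * (+ 4 + + 3) + (+ 5 - + 3) * m) * (+ 4 * m + + 5)
      ring = solve-∀

  -- Sizes and edge counts of the components of a cut.

  module Classes (K p : ℕ) (K<p : K ℕ.< p) {c : ℕ}
    (label : Subset (2 ℕ.+ K ℕ.+ (2 ℕ.+ p)) → Maybe (Fin c))
    (vertex : ∀ {A i} → label A ≡ just i → ∣ A ∣ ≡ 2 ℕ.+ K)
    (separate : ∀ {A B i j} → label A ≡ just i → label B ≡ just j → Disjoint A B → i ≡ j)
    (inhabited : ∀ i → ∃ λ A → label A ≡ just i) where
    open Parameters K p K<p

    χ : Fin c → Fn v
    χ i A = δ (label A) i

    m e : Fin c → ℤ
    m i = ∑ (χ i)
    e i = ⟪ χ i , Z (χ i) ⟫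

    χ≥0 : ∀ i → NonNeg (χ i)
    χ≥0 i A = δ-nonneg (label A) i

    χ-in : ∀ {A i} → label A ≡ just i → χ i A ≡ 1ℤ
    χ-in {i = i} eq = trans (cong (λ x → δ x i) eq) (δ-just i)

    Level-χ : ∀ i → Level (+ k) (χ i)
    Level-χ i = vanish-level off
      where
      off : ∀ A → ∣ A ∣ ≢ k → χ i A ≡ 0ℤ
      off A ne with δ-cases (label A) i
      ... | inj₁ eq = contradiction (vertex eq) ne
      ... | inj₂ z = z

    m≥1 : ∀ i → 1ℤ ≤ m i
    m≥1 i with inhabited i
    ... | A , eq = subst (_≤ m i) (χ-in eq) (≤-∑ (χ≥0 i) A)

    m>0 : ∀ i → 0ℤ < m i
    m>0 i = <-≤-trans (+<+ ℕ.z<s) (m≥1 i)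

    χ² : ∀ i A → χ i A * χ i A ≡ χ i A
    χ² i A with δ-cases (label A) i
    ... | inj₁ eq = trans (cong (_* χ i A) (χ-in eq)) (*-identityˡ (χ i A))
    ... | inj₂ z = trans (cong (_* χ i A) z) (sym z)

    ⟪χ,χ⟫ : ∀ i → ⟪ χ i , χ i ⟫ ≡ m i
    ⟪χ,χ⟫ i = ∑-cong (χ² i)

    ⟪χ,χ⟫-≢ : ∀ {i j} → i ≢ j → ⟪ χ i , χ j ⟫ ≡ 0ℤ
    ⟪χ,χ⟫-≢ {i} {j} ne = trans (∑-cong pointwise) (∑-0 {v})
      where
      pointwise : ∀ A → χ i A * χ j A ≡ 0ℤ
      pointwise A with δ-cases (label A) i | δ-cases (label A) j
      ... | inj₂ z | _ = cong (_* χ j A) z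
      ... | inj₁ _ | inj₂ z = trans (cong (χ i A *_) z) (*-zeroʳ (χ i A))
      ... | inj₁ eq | inj₁ eq′ with trans (sym eq) eq′
      ...   | refl = contradiction refl ne

    Zχ-other : ∀ {A i j} → label A ≡ just i → i ≢ j → Z (χ j) A ≡ 0ℤ
    Zχ-other {A} {i} {j} eq ne = Z-vanish A none
      where
      none : ∀ B → Disjoint A B → χ j B ≡ 0ℤ
      none B dj with δ-cases (label B) j
      ... | inj₁ eq′ = contradiction (separate eq eq′ dj) ne
      ... | inj₂ z = z

    ⟪χ,Zχ⟫-≢ : ∀ {i j} → i ≢ j → ⟪ χ i , Z (χ j) ⟫ ≡ 0ℤ
    ⟪χ,Zχ⟫-≢ {i} {j} ne = trans (∑-cong pointwise) (∑-0 {v})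
      where
      pointwise : ∀ A → χ i A * Z (χ j) A ≡ 0ℤ
      pointwise A with δ-cases (label A) i
      ... | inj₂ z = cong (_* Z (χ j) A) z
      ... | inj₁ eq = trans (cong (χ i A *_) (Zχ-other eq ne)) (*-zeroʳ (χ i A))

    Zχ<m : ∀ {A i} → label A ≡ just i → Z (χ i) A + 1ℤ ≤ m i
    Zχ<m {A} {i} eq = subst (λ z → Z (χ i) A + z ≤ m i) (χ-in eq)
      (Z+self≤∑ (χ≥0 i) A (subst (1 ℕ.≤_) (sym (vertex eq)) (ℕ.s≤s ℕ.z≤n)))

    -- The number of vertices of the class, other than A, that are not adjacent to A; it is zero off
    -- the class.
    deficit : Fin c → Fn v
    deficit i A = χ i A * (m i - 1ℤ - Z (χ i) A)

    ∑-deficit : ∀ i → ∑ (deficit i) ≡ m i * (m i - 1ℤ) - e i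
    ∑-deficit i = trans (∑-cong (λ A → ring₁ (m i - 1ℤ) (χ i A) (Z (χ i) A)))
      (trans (∑-lin (m i - 1ℤ) -1ℤ (χ i) (λ A → χ i A * Z (χ i) A)) (ring₂ (m i) (e i)))
      where
      ring₁ : ∀ a x z → x * (a - z) ≡ a * x + -1ℤ * (x * z)
      ring₁ = solve-∀
      ring₂ : ∀ m e → (m - 1ℤ) * m + -1ℤ * e ≡ m * (m - 1ℤ) - e
      ring₂ = solve-∀

    deficit≥0 : ∀ i → NonNeg (deficit i)
    deficit≥0 i A with δ-cases (label A) i
    ... | inj₂ z = ≤-reflexive (sym (cong (_* (m i - 1ℤ - Z (χ i) A)) z))
    ... | inj₁ eq = *-nonneg (χ≥0 i A) (subst (0ℤ ≤_) (ring (m i) (Z (χ i) A)) (i≤j⇒0≤j-i (Zχ<m eq)))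
      where
      ring : ∀ m z → m - (z + 1ℤ) ≡ m - 1ℤ - z
      ring = solve-∀

    e≤m[m-1] : ∀ i → e i ≤ m i * (m i - 1ℤ)
    e≤m[m-1] i = 0≤i-j⇒j≤i (subst (0ℤ ≤_) (∑-deficit i) (∑-nonneg (deficit≥0 i)))

    e≥0 : ∀ i → 0ℤ ≤ e i
    e≥0 i = ∑-nonneg (λ A → *-nonneg (χ≥0 i A) (Z-nonneg (χ≥0 i) A))

    -- For n < 3k there are no triangles. If A is adjacent to all others of its class, a neighbour B
    -- has at most one neighbour there, and 1 ≤ m - 2. So A or B misses some vertex, and its deficit
    -- is positive.
    e<m[m-1] : v ℕ.< 3 ℕ.* k → ∀ i → + 3 ≤ m i → e i ≤ m i * (m i - 1ℤ) - 1ℤ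
    e<m[m-1] v<3k i m≥3 with non-dominating
      where
      non-dominating : ∃ λ A → label A ≡ just i × Z (χ i) A ≤ m i - + 2
      non-dominating with inhabited i
      ... | A , eq with Z (χ i) A ≤? m i - + 2
      ...   | yes le = A , eq , le
      ...   | no gt with Z-witness (χ i) A (λ z → gt (subst (_≤ m i - + 2) (sym z) (i≤j⇒0≤j-i (≤-trans (+≤+ (ℕ.s≤s (ℕ.s≤s ℕ.z≤n))) m≥3))))
      ...     | B , dj , χB≢0 with δ-cases (label B) i
      ...       | inj₂ z = contradiction z χB≢0
      ...       | inj₁ eq′ = B , eq′ , 0≤i-j⇒j≤i (subst (0ℤ ≤_) (ring (m i) (Z (χ i) A) (Z (χ i) B))
                    (+-nonneg (+-nonneg (i≤j⇒0≤j-i sum) (i≤j⇒0≤j-i (i<j⇒suc[i]≤j (≰⇒> gt)))) (i≤j⇒0≤j-i m≥3)))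
        where
        sum : Z (χ i) A + Z (χ i) B ≤ m i
        sum = Z+Z-adjacent (χ≥0 i) (Level-χ i) A B dj
          (subst (v ℕ.<_) (trans (cong (λ z → k ℕ.+ (k ℕ.+ z)) (ℕ.+-identityʳ k)) (trans (sym (ℕ.+-assoc k k k)) (sym (cong₂ (λ x y → x ℕ.+ y ℕ.+ k) (vertex eq) (vertex eq′))))) v<3k)
        ring : ∀ m a b → m - (a + b) + (a - (1ℤ + (m - + 2))) + (m - + 3) ≡ m - + 2 - b
        ring = solve-∀
    ... | A , eq , le = 0≤i-j⇒j≤i (subst (0ℤ ≤_) (trans (cong (_- 1ℤ) (∑-deficit i)) (ring (m i) (e i)))
            (i≤j⇒0≤j-i (≤-trans one≤ (≤-∑ (deficit≥0 i) A))))
      where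
      ring : ∀ m e → m * (m - 1ℤ) - e - 1ℤ ≡ m * (m - 1ℤ) - 1ℤ - e
      ring = solve-∀
      ring₂ : ∀ m z → m - + 2 - z ≡ m - 1ℤ - z - 1ℤ
      ring₂ = solve-∀
      one≤ : 1ℤ ≤ deficit i A
      one≤ = subst (1ℤ ≤_) (sym (trans (cong (_* (m i - 1ℤ - Z (χ i) A)) (χ-in eq)) (*-identityˡ (m i - 1ℤ - Z (χ i) A))))
        (0≤i-j⇒j≤i (subst (0ℤ ≤_) (ring₂ (m i) (Z (χ i) A)) (i≤j⇒0≤j-i le)))

    mixing : ∀ i → N * e i ≤ N * θ * m i + (d - θ) * (m i * m i)
    mixing i = subst (λ z → N * e i ≤ N * θ * z + (d - θ) * (m i * m i)) (⟪χ,χ⟫ i) (upper-bound (χ i) (Level-χ i))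

    𝟙-in : ∀ {A i} → label A ≡ just i → 𝟙 k A ≡ 1ℤ
    𝟙-in {A} eq = cong ind (dec-true (∣ A ∣ ℕ.≟ k) (vertex eq))

    -- A vertex B of another class and its d neighbours all lie outside class i; the complement of
    -- the class is therefore summed around B.
    m+d<N : ∀ {i j} → i ≢ j → m i + d + 1ℤ ≤ N
    m+d<N {i} {j} ne with inhabited j
    ... | B , eq = 0≤i-j⇒j≤i (subst (0ℤ ≤_) (trans (cong₂ _-_ ∑g (cong₂ _+_ Zg gB)) (ring N (m i) d))
        (i≤j⇒0≤j-i (Z+self≤∑ g≥0 B (subst (1 ℕ.≤_) (sym (vertex eq)) (ℕ.s≤s ℕ.z≤n)))))
      where
      g : Fn v
      g A = 1ℤ * 𝟙 k A + -1ℤ * χ i A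
      g≥0 : NonNeg g
      g≥0 A with δ-cases (label A) i
      ... | inj₁ eq = ≤-reflexive (sym (cong₂ (λ x y → 1ℤ * x + -1ℤ * y) (𝟙-in eq) (χ-in eq)))
      ... | inj₂ z = subst (λ x → 0ℤ ≤ 1ℤ * 𝟙 k A + -1ℤ * x) (sym z)
            (subst (0ℤ ≤_) (ring₀ (𝟙 k A)) (ind-nonneg _))
        where
        ring₀ : ∀ x → x ≡ 1ℤ * x + -1ℤ * 0ℤ
        ring₀ = solve-∀
      χB : χ i B ≡ 0ℤ
      χB with δ-cases (label B) i
      ... | inj₂ z = z
      ... | inj₁ eq′ with trans (sym eq) eq′
      ...   | refl = contradiction refl ne
      gB : g B ≡ 1ℤ
      gB = cong₂ (λ x y → 1ℤ * x + -1ℤ * y) (𝟙-in eq) χB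
      ∑g : ∑ g ≡ 1ℤ * N + -1ℤ * m i
      ∑g = trans (∑-lin 1ℤ -1ℤ (𝟙 k) (χ i)) (cong (λ z → 1ℤ * z + -1ℤ * m i) (∑-𝟙 v k))
      Z𝟙 : Z (𝟙 k) B ≡ d
      Z𝟙 = trans (Z-𝟙 k B) (cong (λ z → + bin z k) (trans (cong (v ℕ.∸_) (vertex eq)) (ℕ.m+n∸m≡n k (2 ℕ.+ p))))
      Zg : Z g B ≡ 1ℤ * d + -1ℤ * 0ℤ
      Zg = trans (Z-lin 1ℤ -1ℤ (𝟙 k) (χ i) B) (cong₂ (λ x y → 1ℤ * x + -1ℤ * y) Z𝟙 (Zχ-other eq (λ e → ne (sym e))))
      ring : ∀ N m d → 1ℤ * N + -1ℤ * m - (1ℤ * d + -1ℤ * 0ℤ + 1ℤ) ≡ N - (m + d + 1ℤ)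
      ring = solve-∀

    m+m≤N : ∀ {i j} → i ≢ j → m i + m j ≤ N
    m+m≤N {i} {j} ne = subst₂ _≤_ (trans (∑-lin 1ℤ 1ℤ (χ i) (χ j)) (ring (m i) (m j))) (∑-𝟙 v k) (∑-mono le)
      where
      ring : ∀ x y → 1ℤ * x + 1ℤ * y ≡ x + y
      ring = solve-∀
      le : ∀ A → 1ℤ * χ i A + 1ℤ * χ j A ≤ 𝟙 k A
      le A with δ-cases (label A) i | δ-cases (label A) j
      ... | inj₁ eq | inj₁ eq′ with trans (sym eq) eq′
      ...   | refl = contradiction refl ne
      le A | inj₁ eq | inj₂ z = ≤-reflexive (trans (cong₂ (λ x y → 1ℤ * x + 1ℤ * y) (χ-in eq) z) (sym (𝟙-in eq)))
      le A | inj₂ z | inj₁ eq = ≤-reflexive (trans (cong₂ (λ x y → 1ℤ * x + 1ℤ * y) z (χ-in eq)) (sym (𝟙-in eq)))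
      le A | inj₂ z | inj₂ z′ = subst (_≤ 𝟙 k A) (sym (cong₂ (λ x y → 1ℤ * x + 1ℤ * y) z z′)) (ind-nonneg _)

    -- The upper bound for 6 χᵢ − 5 χⱼ: in K(7,3) with mᵢ = 30, χᵢ alone falls just short.
    mixing₂ : ∀ {i j} → i ≢ j → N * (+ 36 * e i + + 25 * e j) ≤
      N * θ * (+ 36 * m i + + 25 * m j) + (d - θ) * ((+ 6 * m i - + 5 * m j) * (+ 6 * m i - + 5 * m j))
    mixing₂ {i} {j} ne = subst₂ _≤_ (cong (N *_) ⟪f,Zf⟫) (cong₂ (λ x y → N * θ * x + (d - θ) * (y * y)) ⟪f,f⟫ ∑f)
        (upper-bound f (Level-lin (+ 6) (- + 5) (Level-χ i) (Level-χ j)))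
      where
      f : Fn v
      -- For mᵢ = 30, mⱼ = 1 and eⱼ = 0, the bound on eᵢ obtained from χᵢ - t χⱼ in K(7,3) is
      -- smallest at t = 5/6.
      f A = + 6 * χ i A + (- + 5) * χ j A
      ne′ : j ≢ i
      ne′ e = ne (sym e)
      ∑f : ∑ f ≡ + 6 * m i - + 5 * m j
      ∑f = trans (∑-lin (+ 6) (- + 5) (χ i) (χ j)) (ring (m i) (m j))
        where
        ring : ∀ x y → + 6 * x + (- + 5) * y ≡ + 6 * x - + 5 * y
        ring = solve-∀
      expand : ∀ g h → ⟪ f , (λ A → + 6 * g A + (- + 5) * h A) ⟫ ≡
        + 6 * (+ 6 * ⟪ χ i , g ⟫ + (- + 5) * ⟪ χ j , g ⟫) + (- + 5) * (+ 6 * ⟪ χ i , h ⟫ + (- + 5) * ⟪ χ j , h ⟫)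
      expand g h = trans (⟪⟫-linʳ (+ 6) (- + 5) f g h)
        (cong₂ (λ x y → + 6 * x + (- + 5) * y) (⟪⟫-linˡ (+ 6) (- + 5) (χ i) (χ j) g) (⟪⟫-linˡ (+ 6) (- + 5) (χ i) (χ j) h))
      ring : ∀ x y → + 6 * (+ 6 * x + (- + 5) * 0ℤ) + (- + 5) * (+ 6 * 0ℤ + (- + 5) * y) ≡ + 36 * x + + 25 * y
      ring = solve-∀
      collapse : ∀ {x₁ x₂ x₃ x₄} a b → x₁ ≡ a → x₂ ≡ 0ℤ → x₃ ≡ 0ℤ → x₄ ≡ b →
        + 6 * (+ 6 * x₁ + (- + 5) * x₂) + (- + 5) * (+ 6 * x₃ + (- + 5) * x₄) ≡ + 36 * a + + 25 * b
      collapse a b refl refl refl refl = ring a b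
      ⟪f,f⟫ : ⟪ f , f ⟫ ≡ + 36 * m i + + 25 * m j
      ⟪f,f⟫ = trans (expand (χ i) (χ j)) (collapse (m i) (m j) (⟪χ,χ⟫ i) (⟪χ,χ⟫-≢ ne′) (⟪χ,χ⟫-≢ ne) (⟪χ,χ⟫ j))
      ⟪f,Zf⟫ : ⟪ f , Z f ⟫ ≡ + 36 * e i + + 25 * e j
      ⟪f,Zf⟫ = trans (⟪⟫-cong {f = f} (λ _ → refl) (Z-lin (+ 6) (- + 5) (χ i) (χ j)))
        (trans (expand (Z (χ i)) (Z (χ j))) (collapse (e i) (e j) refl (⟪χ,Zχ⟫-≢ ne′) (⟪χ,Zχ⟫-≢ ne) refl))

    weight : Regime → ∀ {i j} → i ≢ j → Weight N ℓ (+ k + w) (+ k) w (m i) (e i)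
    weight regime {i} {j} ne with 1ℤ ≟ m i
    ... | yes m≡1 = weight-singleton (sym m≡1) (e≤m[m-1] i)
      where open Arithmetic {N} {d} {ℓ} {θ} {+ k} {w} N-pos ℓ-pos (+<+ ℕ.z<s) kd≡wℓ
    ... | no m≢1 = go regime
      where
      open Arithmetic {N} {d} {ℓ} {θ} {+ k} {w} N-pos ℓ-pos (+<+ ℕ.z<s) kd≡wℓ
      m≥2 : + 2 ≤ m i
      m≥2 = i<j⇒suc[i]≤j (≤∧≢⇒< (m≥1 i) m≢1)
      go : Regime → Weight N ℓ (+ k + w) (+ k) w (m i) (e i)
      go (generic a b c) with + k * m i + w <? + k * d
      ... | yes small = weight-small m≥2 (e≤m[m-1] i) small
      ... | no large = weight-large (m>0 i) (+≤+ ℕ.z≤n) a b c (≮⇒≥ large) (m+d<N ne) (mixing i)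
      go (seven K≡1 p≡2 N≡ d≡ ℓ≡ θ≡) = reconcile K≡1 p≡2 N≡ d≡ ℓ≡ θ≡ m≥2 (e≤m[m-1] i)
          (e<m[m-1] (v<3k K≡1 p≡2) i) (mixing i) (m+d<N ne) (m≥1 j) (e≥0 j) (m+m≤N ne) (mixing₂ ne)
        where
        v<3k : ∀ {K p} → K ≡ 1 → p ≡ 2 → 2 ℕ.+ K ℕ.+ (2 ℕ.+ p) ℕ.< 3 ℕ.* (2 ℕ.+ K)
        v<3k refl refl = ℕ.<ᵇ⇒< 7 9 _
        reconcile : ∀ {K p N d ℓ θ m e m′ e′} → K ≡ 1 → p ≡ 2 → N ≡ + 35 → d ≡ + 4 → ℓ ≡ + 3 → θ ≡ + 2 →
          + 2 ≤ m → e ≤ m * (m - 1ℤ) → (+ 3 ≤ m → e ≤ m * (m - 1ℤ) - 1ℤ) →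
          N * e ≤ N * θ * m + (d - θ) * (m * m) → m + d + 1ℤ ≤ N → 1ℤ ≤ m′ → 0ℤ ≤ e′ → m + m′ ≤ N →
          N * (+ 36 * e + + 25 * e′) ≤ N * θ * (+ 36 * m + + 25 * m′) + (d - θ) * ((+ 6 * m - + 5 * m′) * (+ 6 * m - + 5 * m′)) →
          Weight N ℓ (+ (2 ℕ.+ K) + + (2 ℕ.+ p)) (+ (2 ℕ.+ K)) (+ (2 ℕ.+ p)) m e
        reconcile refl refl refl refl refl refl = Weight₇.weight₇
      go (nine K≡2 p≡3 N≡ d≡ ℓ≡ θ≡) = reconcile K≡2 p≡3 N≡ d≡ ℓ≡ θ≡ m≥2 (e≤m[m-1] i)
          (e<m[m-1] (v<3k K≡2 p≡3) i) (mixing i) (m+d<N ne)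
        where
        v<3k : ∀ {K p} → K ≡ 2 → p ≡ 3 → 2 ℕ.+ K ℕ.+ (2 ℕ.+ p) ℕ.< 3 ℕ.* (2 ℕ.+ K)
        v<3k refl refl = ℕ.<ᵇ⇒< 9 12 _
        reconcile : ∀ {K p N d ℓ θ m e} → K ≡ 2 → p ≡ 3 → N ≡ + 126 → d ≡ + 5 → ℓ ≡ + 4 → θ ≡ + 3 →
          + 2 ≤ m → e ≤ m * (m - 1ℤ) → (+ 3 ≤ m → e ≤ m * (m - 1ℤ) - 1ℤ) →
          N * e ≤ N * θ * m + (d - θ) * (m * m) → m + d + 1ℤ ≤ N →
          Weight N ℓ (+ (2 ℕ.+ K) + + (2 ℕ.+ p)) (+ (2 ℕ.+ K)) (+ (2 ℕ.+ p)) m e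
        reconcile refl refl refl refl refl refl = Weight₉.weight₉

    -- The test function taking the value M / b on a class of weight b, for a common
    -- multiple M of the b's, is fed into the lower bound.
    module Summation (weights : ∀ i → Weight N ℓ (+ k + w) (+ k) w (m i) (e i)) (nonempty : Fin c) where
      open Weight

      β : Fin c → ℤ
      β i = b (weights i)

      multiple = common-multiple β (λ i → positive-b (weights i))
      M = proj₁ multiple
      M>0 = proj₁ (proj₂ multiple)
      q = proj₁ (proj₂ (proj₂ multiple))
      q>0 : ∀ i → 0ℤ < q i
      q>0 i = proj₁ (proj₂ (proj₂ (proj₂ multiple)) i)
      βq : ∀ i → β i * q i ≡ M
      βq i = proj₂ (proj₂ (proj₂ (proj₂ multiple)) i)

      value : Maybe (Fin c) → ℤ
      value nothing = 0ℤ
      value (just i) = q i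

      f : Fn v
      f A = value (label A)

      f-in : ∀ {A i} → label A ≡ just i → f A ≡ q i
      f-in eq = cong value eq

      label-cases : ∀ A → label A ≡ nothing ⊎ ∃ λ i → label A ≡ just i
      label-cases A with label A
      ... | nothing = inj₁ refl
      ... | just i = inj₂ (i , refl)

      private
        none : (g : Fin c → ℤ) → Σᶠ (λ i → g i * 0ℤ) ≡ 0ℤ
        none g = trans (Σᶠ-cong (λ i → *-zeroʳ (g i))) (trans (Σᶠ-const c 0ℤ) (*-zeroʳ (+ c)))

        sum-out : ∀ {A} → label A ≡ nothing → (g : Fin c → ℤ) → Σᶠ (λ i → g i * χ i A) ≡ 0ℤ
        sum-out {A} eq g = trans (Σᶠ-cong (λ i → cong (λ x → g i * δ x i) eq)) (none g)

        sum-in : ∀ {A j} → label A ≡ just j → (g : Fin c → ℤ) → Σᶠ (λ i → g i * χ i A) ≡ g j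
        sum-in {A} {j} eq g = trans (Σᶠ-cong (λ i → cong (λ x → g i * δ x i) eq)) (Σᶠ-δ g j)

      Level-f : Level (+ k) f
      Level-f = vanish-level off
        where
        off : ∀ A → ∣ A ∣ ≢ k → f A ≡ 0ℤ
        off A ne with label-cases A
        ... | inj₁ eq = cong value eq
        ... | inj₂ (i , eq) = contradiction (vertex eq) ne

      f≗ : ∀ A → f A ≡ Σᶠ (λ i → q i * χ i A)
      f≗ A with label-cases A
      ... | inj₁ eq = trans (cong value eq) (sym (sum-out eq q))
      ... | inj₂ (j , eq) = trans (f-in eq) (sym (sum-in eq q))

      f²≗ : ∀ A → f A * f A ≡ Σᶠ (λ i → q i * q i * χ i A)
      f²≗ A with label-cases A
      ... | inj₁ eq = trans (cong (λ x → value x * value x) eq) (sym (sum-out eq (λ i → q i * q i)))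
      ... | inj₂ (j , eq) = trans (cong (λ x → value x * value x) eq) (sym (sum-in eq (λ i → q i * q i)))

      -- Every labelled neighbour of A is in the class of A, so around A the function f agrees with
      -- q j times the indicator of that class.
      Zf-in : ∀ {A j} → label A ≡ just j → Z f A ≡ q j * Z (χ j) A
      Zf-in {A} {j} eq = trans (Z-cong-disjoint A same) (Z-scale (q j) (χ j) A)
        where
        same : ∀ B → Disjoint A B → f B ≡ q j * χ j B
        same B dj with label-cases B
        ... | inj₁ eq′ = trans (cong value eq′) (sym (trans (cong (λ x → q j * δ x j) eq′) (*-zeroʳ (q j))))
        ... | inj₂ (j′ , eq′) with separate eq eq′ dj
        ...   | refl = trans (f-in eq′) (sym (trans (cong (q j *_) (χ-in eq′)) (*-identityʳ (q j))))

      fZf≗ : ∀ A → f A * Z f A ≡ Σᶠ (λ i → q i * q i * (χ i A * Z (χ i) A))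
      fZf≗ A with label-cases A
      ... | inj₁ eq = trans (cong (λ x → value x * Z f A) eq) (sym (trans
              (Σᶠ-cong (λ i → ring (q i * q i) (χ i A) (Z (χ i) A))) (sum-out eq (λ i → q i * q i * Z (χ i) A))))
        where
        ring : ∀ q x z → q * (x * z) ≡ q * z * x
        ring = solve-∀
      ... | inj₂ (j , eq) = trans (cong₂ _*_ (f-in eq) (Zf-in eq)) (trans (ring′ (q j) (Z (χ j) A)) (sym (trans
              (Σᶠ-cong (λ i → ring (q i * q i) (χ i A) (Z (χ i) A))) (sum-in eq (λ i → q i * q i * Z (χ i) A)))))
        where
        ring : ∀ q x z → q * (x * z) ≡ q * z * x
        ring = solve-∀
        ring′ : ∀ q z → q * (q * z) ≡ q * q * z
        ring′ = solve-∀

      integrate : (g : Fn v) (a : Fin c → ℤ) (h : Fin c → Fn v) → (∀ A → g A ≡ Σᶠ (λ i → a i * h i A)) → ∑ g ≡ Σᶠ (λ i → a i * ∑ (h i))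
      integrate g a h eq = trans (∑-cong eq) (trans (∑-Σᶠ (λ i A → a i * h i A)) (Σᶠ-cong (λ i → ∑-scale (a i) (h i))))

      total : ℤ
      total = Σᶠ (λ i → q i * m i)

      ∑f : ∑ f ≡ total
      ∑f = integrate f q χ f≗

      total>0 : 0ℤ < total
      total>0 = subst (_< total) (trans (Σᶠ-const c 0ℤ) (*-zeroʳ (+ c)))
        (Σᶠ-mono-< (λ i → <⇒≤ (*-pos (q>0 i) (m>0 i))) nonempty (*-pos (q>0 nonempty) (m>0 nonempty)))

      -- By `fits` the i-th term is at most q² m b, and b q = M makes this M q m. The quadratic
      -- quantity is thereby bounded by a multiple of `∑ f`.
      energy : N * (ℓ * ⟪ f , f ⟫ + ⟪ f , Z f ⟫) ≤ M * total
      energy = subst₂ _≤_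
        (sym (trans (cong (N *_) (trans (cong₂ (λ x y → ℓ * x + y) (integrate _ (λ i → q i * q i) χ f²≗) (integrate _ (λ i → q i * q i) (λ i A → χ i A * Z (χ i) A) fZf≗))
          (trans (ring₀ ℓ (Σᶠ (λ i → q i * q i * m i)) (Σᶠ (λ i → q i * q i * e i))) (sym (Σᶠ-lin ℓ 1ℤ (λ i → q i * q i * m i) (λ i → q i * q i * e i))))))
          (sym (Σᶠ-scale N (λ i → ℓ * (q i * q i * m i) + 1ℤ * (q i * q i * e i))))))
        (Σᶠ-scale M (λ i → q i * m i))
        (Σᶠ-mono termwise)
        where
        ring₀ : ∀ l x y → l * x + y ≡ l * x + 1ℤ * y
        ring₀ = solve-∀
        ring₁ : ∀ q m e b N l → q * q * (m * b - N * (e + l * m)) ≡ b * q * (q * m) - N * (l * (q * q * m) + 1ℤ * (q * q * e))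
        ring₁ = solve-∀
        termwise : ∀ i → N * (ℓ * (q i * q i * m i) + 1ℤ * (q i * q i * e i)) ≤ M * (q i * m i)
        termwise i = 0≤i-j⇒j≤i (subst (0ℤ ≤_)
          (trans (ring₁ (q i) (m i) (e i) (β i) N ℓ) (cong (λ z → z * (q i * m i) - N * (ℓ * (q i * q i * m i) + 1ℤ * (q i * q i * e i))) (βq i)))
          (*-nonneg (square-nonneg (q i)) (i≤j⇒0≤j-i (fits (weights i)))))

      -- Hoffman's inequality has total² on the left and `energy` is linear in total, so one factor
      -- cancels. Divided by M, this is Σ m/b ≤ 1/(ℓ + d).
      [ℓ+d]total≤M : (ℓ + d) * total ≤ M
      [ℓ+d]total≤M = 0≤i-j⇒j≤i (cancel-nonneg total>0 (subst (0ℤ ≤_) (ring M total (ℓ + d))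
        (i≤j⇒0≤j-i (≤-trans (subst (λ z → (ℓ + d) * (z * z) ≤ N * (ℓ * ⟪ f , f ⟫ + ⟪ f , Z f ⟫)) ∑f (lower-bound f Level-f)) energy))))
        where
        ring : ∀ M t a → M * t - a * (t * t) ≡ t * (M - a * t)
        ring = solve-∀

      vℓtotal≤kM : (+ k + w) * ℓ * total ≤ + k * M
      vℓtotal≤kM = 0≤i-j⇒j≤i (subst (0ℤ ≤_) (trans (ring₁ (+ k) M ℓ d total)
          (trans (cong (λ z → + k * M - (+ k * ℓ + z) * total) kd≡wℓ) (ring₂ (+ k) w M ℓ total)))
        (*-nonneg {+ k} (+≤+ ℕ.z≤n) (i≤j⇒0≤j-i [ℓ+d]total≤M)))
        where
        ring₁ : ∀ k M ℓ d t → k * (M - (ℓ + d) * t) ≡ k * M - (k * ℓ + k * d) * t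
        ring₁ = solve-∀
        ring₂ : ∀ k w M ℓ t → k * M - (k * ℓ + w * ℓ) * t ≡ k * M - (k + w) * ℓ * t
        ring₂ = solve-∀

      -- Added up, the budgets give k (N - |S|) + c w, so their being at most k N is the inequality
      -- c w ≤ k |S|.
      budget : Fin c → ℤ
      budget i = + k * m i + w

      private
        scaled : ∀ i → q i * (β i * (+ k * m i + w)) ≡ M * budget i
        scaled i = trans (ring (q i) (β i) (budget i)) (cong (_* budget i) (βq i))
          where
          ring : ∀ q b x → q * (b * x) ≡ b * q * x
          ring = solve-∀

        supply : Σᶠ (λ i → q i * (N * m i * ((+ k + w) * ℓ))) ≤ M * (+ k * N)
        supply = subst₂ _≤_ (trans (ring N ((+ k + w) * ℓ) total) (trans (sym (Σᶠ-scale (N * ((+ k + w) * ℓ)) (λ i → q i * m i)))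
            (Σᶠ-cong (λ i → ring′ N ((+ k + w) * ℓ) (q i) (m i))))) (ring″ N (+ k) M)
          (*-monoˡ-≤-nonNeg N {{nonNegative (<⇒≤ N-pos)}} vℓtotal≤kM)
          where
          ring : ∀ N x t → N * (x * t) ≡ N * x * t
          ring = solve-∀
          ring′ : ∀ N x q m → N * x * (q * m) ≡ q * (N * m * x)
          ring′ = solve-∀
          ring″ : ∀ N k M → N * (k * M) ≡ M * (k * N)
          ring″ = solve-∀

      budget-bound : Σᶠ budget ≤ + k * N
      budget-bound = *-cancelˡ-≤-pos (Σᶠ budget) (+ k * N) M {{positive M>0}} (≤-trans (≤-reflexive (sym (Σᶠ-scale M budget)))
        (≤-trans (Σᶠ-mono (λ i → ≤-trans (≤-reflexive (sym (scaled i))) (*-monoˡ-≤-nonNeg (q i) {{nonNegative (<⇒≤ (q>0 i))}} (bound (weights i))))) supply))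

      budget-strict : ∀ i → + 2 ≤ m i → Σᶠ budget < + k * N
      budget-strict j m≥2 = *-cancelˡ-<-nonNeg M {{nonNegative (<⇒≤ M>0)}} (≤-<-trans (≤-reflexive (sym (Σᶠ-scale M budget)))
        (<-≤-trans (Σᶠ-mono-< (λ i → ≤-trans (≤-reflexive (sym (scaled i))) (*-monoˡ-≤-nonNeg (q i) {{nonNegative (<⇒≤ (q>0 i))}} (bound (weights i))))
          j (≤-<-trans (≤-reflexive (sym (scaled j))) (*-monoˡ-<-pos (q j) {{positive (q>0 j)}} (strict (weights j) m≥2)))) supply))

  -- Vertex cuts of Kneser graphs

  fraction-minus-one : ∀ k-1 w → frac (suc k-1 ℕ.+ w) (suc k-1) -ℚ 1ℚ ≡ fromℚᵘ (mkℚᵘ (+ w) k-1)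
  fraction-minus-one k-1 w = trans (sym (ℚ.fromℚᵘ-toℚᵘ (fromℚᵘ x -ℚ 1ℚ))) (ℚ.fromℚᵘ-cong {toℚᵘ (fromℚᵘ x -ℚ 1ℚ)} {mkℚᵘ (+ w) k-1}
    (ℚᵘ.≃-trans (ℚ.toℚᵘ-homo-+ (fromℚᵘ x) (-ℚ 1ℚ))
    (ℚᵘ.≃-trans (ℚᵘ.+-cong (ℚ.toℚᵘ-fromℚᵘ x) (ℚ.toℚᵘ-homo‿- 1ℚ)) (*≡* {x ℚᵘ.+ ℚᵘ.- toℚᵘ 1ℚ} {mkℚᵘ (+ w) k-1} cross))))
    where
    x : ℚᵘ
    x = mkℚᵘ (+ (suc k-1 ℕ.+ w)) k-1
    ring : ∀ w k → ((1ℤ + (k + w)) * 1ℤ + -1ℤ * (1ℤ + k)) * (1ℤ + k) ≡ w * (1ℤ + k)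
    ring = solve-∀
    cross : (+ (suc k-1 ℕ.+ w) * 1ℤ + -1ℤ * + suc k-1) * + suc k-1 ≡ + w * + (suc k-1 ℕ.* 1)
    cross = trans (ring (+ w) (+ k-1)) (cong (λ z → + w * + z) (sym (ℕ.*-identityʳ (suc k-1))))

  fraction-≤ : ∀ a b c d → + a * + suc d ≤ + c * + suc b → fromℚᵘ (mkℚᵘ (+ a) b) ≤ℚ fromℚᵘ (mkℚᵘ (+ c) d)
  fraction-≤ a b c d le = ℚ.toℚᵘ-cancel-≤ (ℚᵘ.≤-respˡ-≃ (ℚᵘ.≃-sym (ℚ.toℚᵘ-fromℚᵘ (mkℚᵘ (+ a) b)))
    (ℚᵘ.≤-respʳ-≃ (ℚᵘ.≃-sym (ℚ.toℚᵘ-fromℚᵘ (mkℚᵘ (+ c) d))) (*≤* le)))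

  fraction-≡ : ∀ a b c d → + a * + suc d ≡ + c * + suc b → fromℚᵘ (mkℚᵘ (+ a) b) ≡ fromℚᵘ (mkℚᵘ (+ c) d)
  fraction-≡ a b c d eq = ℚ.fromℚᵘ-cong {mkℚᵘ (+ a) b} {mkℚᵘ (+ c) d} (*≡* eq)

  fraction-≡⁻¹ : ∀ a b c d → fromℚᵘ (mkℚᵘ (+ a) b) ≡ fromℚᵘ (mkℚᵘ (+ c) d) → + a * + suc d ≡ + c * + suc b
  fraction-≡⁻¹ a b c d eq with ℚᵘ.≃-trans (ℚᵘ.≃-sym (ℚ.toℚᵘ-fromℚᵘ (mkℚᵘ (+ a) b))) (ℚᵘ.≃-trans (ℚ.toℚᵘ-cong eq) (ℚ.toℚᵘ-fromℚᵘ (mkℚᵘ (+ c) d)))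
  ... | *≡* e = e

  -- Translating lists of subsets into sums.

  sumL : {X : Set} → (X → ℤ) → List X → ℤ
  sumL g [] = 0ℤ
  sumL g (x ∷ xs) = g x + sumL g xs

  length-filter : {X : Set} {P : X → Set} (P? : Decidable P) (xs : List X) →
    + length (filter P? xs) ≡ sumL (λ x → ind (does (P? x))) xs
  length-filter P? [] = refl
  length-filter P? (x ∷ xs) with does (P? x)
  ... | true = cong (λ z → 1ℤ + z) (length-filter P? xs)
  ... | false = trans (length-filter P? xs) (sym (+-identityˡ _))

  sumL-filter : {X : Set} {P : X → Set} (P? : Decidable P) (g : X → ℤ) (xs : List X) →
    sumL g (filter P? xs) ≡ sumL (λ x → ind (does (P? x)) * g x) xs
  sumL-filter P? g [] = refl
  sumL-filter P? g (x ∷ xs) with does (P? x)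
  ... | true = cong₂ _+_ (sym (*-identityˡ (g x))) (sumL-filter P? g xs)
  ... | false = trans (sumL-filter P? g xs) (sym (+-identityˡ _))

  sumL-++ : {X : Set} (g : X → ℤ) (xs ys : List X) → sumL g (xs ++ ys) ≡ sumL g xs + sumL g ys
  sumL-++ g [] ys = sym (+-identityˡ _)
  sumL-++ g (x ∷ xs) ys = trans (cong (λ z → g x + z) (sumL-++ g xs ys)) (sym (+-assoc (g x) _ _))

  sumL-map : {X Y : Set} (g : Y → ℤ) (h : X → Y) (xs : List X) → sumL g (map h xs) ≡ sumL (λ x → g (h x)) xs
  sumL-map g h [] = refl
  sumL-map g h (x ∷ xs) = cong (λ z → g (h x) + z) (sumL-map g h xs)

  sumL-allSubsets : ∀ n (g : Fn n) → sumL g (allSubsets n) ≡ ∑ g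
  sumL-allSubsets zero g = +-identityʳ (g [])
  sumL-allSubsets (suc n) g = trans (sumL-++ g (map (true ∷_) (allSubsets n)) (map (false ∷_) (allSubsets n)))
    (cong₂ _+_ (trans (sumL-map g (true ∷_) (allSubsets n)) (sumL-allSubsets n (g ₁)))
               (trans (sumL-map g (false ∷_) (allSubsets n)) (sumL-allSubsets n (g ₀))))

  ∈-allSubsets : (A : Subset n) → A ∈ allSubsets n
  ∈-allSubsets [] = here refl
  ∈-allSubsets (true ∷ A) = ∈-++⁺ˡ (∈-map⁺ (true ∷_) (∈-allSubsets A))
  ∈-allSubsets {suc n} (false ∷ A) = ∈-++⁺ʳ (map (true ∷_) (allSubsets n)) (∈-map⁺ (false ∷_) (∈-allSubsets A))

  allSubsets-unique : ∀ n → Unique (allSubsets n)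
  allSubsets-unique zero = [] ∷ []
  allSubsets-unique (suc n) = Unique.++⁺
    (Unique.map⁺ ∷-injectiveʳ (allSubsets-unique n)) (Unique.map⁺ ∷-injectiveʳ (allSubsets-unique n)) apart
    where
    apart : ∀ {A} → A ∈ map (true ∷_) (allSubsets n) × A ∈ map (false ∷_) (allSubsets n) → ⊥
    apart (p , q) with ∈-map⁻ (true ∷_) p | ∈-map⁻ (false ∷_) q
    ... | _ , _ , refl | _ , _ , ()

  lookup-AllPairs : {X : Set} {R : X → X → Set} → (∀ {x y} → R x y → R y x) → {xs : List X} → AllPairs R xs →
    ∀ i j → i ≢ j → R (lookup xs i) (lookup xs j)
  lookup-AllPairs sy (x ∷ ps) zero zero ne = contradiction refl ne
  lookup-AllPairs sy {xs = _ ∷ xs} (x ∷ ps) zero (suc j) ne = All.lookup x (∈-lookup {xs = xs} j)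
  lookup-AllPairs sy {xs = _ ∷ xs} (x ∷ ps) (suc i) zero ne = sy (All.lookup x (∈-lookup {xs = xs} i))
  lookup-AllPairs sy (x ∷ ps) (suc i) (suc j) ne = lookup-AllPairs sy ps i j (λ e → ne (cong suc e))

  -- Labelling the remaining vertices by their components.

  module Components (n k : ℕ) where
    open Kneser n k

    -- The factor `𝟙 k` discards the values of S on sets that are not vertices.
    selected : VSet → Fn n
    selected S A = 𝟙 k A * ind (S A)

    card≡∑ : ∀ S → + card S ≡ ∑ (selected S)
    card≡∑ S = trans (length-filter (λ A → S A Bool.≟ true) vertices)
      (trans (sumL-filter (λ A → ∣ A ∣ ℕ.≟ k) (λ A → ind (does (S A Bool.≟ true))) (allSubsets n))
      (trans (sumL-allSubsets n _) (∑-cong (λ A → cong (λ b → 𝟙 k A * ind b) (does-≟-true (S A))))))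
      where
      does-≟-true : ∀ b → does (b Bool.≟ true) ≡ b
      does-≟-true true = refl
      does-≟-true false = refl

    module _ (S : VSet) where

      Conn-source : ∀ {A B} → Conn S A B → Remaining S A
      Conn-source (here r) = r
      Conn-source (step p _ _) = Conn-source p

      Conn-target : ∀ {A B} → Conn S A B → Remaining S B
      Conn-target (here r) = r
      Conn-target (step _ r _) = r

      Conn-trans : ∀ {A B C} → Conn S A B → Conn S B C → Conn S A C
      Conn-trans p (here _) = p
      Conn-trans p (step q r adj) = step (Conn-trans p q) r adj

      Conn-sym : ∀ {A B} → Conn S A B → Conn S B A
      Conn-sym (here r) = here r
      Conn-sym (step {B = B} {C} p r adj) =
        Conn-trans (step (here r) (Conn-target p) (disjoint-comm {A = B} {C} adj)) (Conn-sym p)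

      remaining? : ∀ A → Dec (Remaining S A)
      remaining? A = (∣ A ∣ ℕ.≟ k) ×-dec (S A Bool.≟ false)

      module Labelled (reps : List (Subset n)) (remains : All (Remaining S) reps)
        (apart : AllPairs (λ A B → ¬ Conn S A B) reps)
        (cover : ∀ A → Remaining S A → Any (λ R → Conn S R A) reps) where

        label : Subset n → Maybe (Fin (length reps))
        label A with remaining? A
        ... | yes r = just (index (cover A r))
        ... | no _ = nothing

        label-remaining : ∀ {A i} → label A ≡ just i → Remaining S A × Conn S (lookup reps i) A
        label-remaining {A} eq with remaining? A | eq
        ... | yes r | refl = r , lookup-index (cover A r)

        remaining-label : ∀ {A} → Remaining S A → ∃ λ i → label A ≡ just i
        remaining-label {A} r with remaining? A
        ... | yes r′ = index (cover A r′) , refl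
        ... | no ¬r = contradiction r ¬r

        same : ∀ {i j} → Conn S (lookup reps i) (lookup reps j) → i ≡ j
        same {i} {j} p with i Fin.≟ j
        ... | yes e = e
        ... | no ne = contradiction p (lookup-AllPairs (λ np q → np (Conn-sym q)) apart i j ne)

        vertex : ∀ {A i} → label A ≡ just i → ∣ A ∣ ≡ k
        vertex eq = proj₁ (proj₁ (label-remaining eq))

        separate : ∀ {A B i j} → label A ≡ just i → label B ≡ just j → Disjoint A B → i ≡ j
        separate eq eq′ dj = same (Conn-trans (step (proj₂ (label-remaining eq)) (proj₁ (label-remaining eq′)) dj)
          (Conn-sym (proj₂ (label-remaining eq′))))

        inhabited : ∀ i → ∃ λ A → label A ≡ just i
        inhabited i with remaining-label (All.lookup remains (∈-lookup {xs = reps} i))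
        ... | j , eq = lookup reps i , trans eq (cong just (same (proj₂ (label-remaining eq))))

        ∑-class : ∀ A → Σᶠ (λ i → δ (label A) i) + selected S A ≡ 𝟙 k A
        ∑-class A with remaining? A
        ... | yes r@(v , s) = trans (cong₂ _+_
              (trans (Σᶠ-cong (λ i → sym (*-identityˡ (δ (just (index (cover A r))) i)))) (Σᶠ-δ (λ _ → 1ℤ) (index (cover A r))))
              (trans (cong (λ b → 𝟙 k A * ind b) s) (*-zeroʳ (𝟙 k A))))
              (sym (cong ind (dec-true (∣ A ∣ ℕ.≟ k) v)))
        ... | no ¬r = trans (cong (_+ selected S A) (trans (Σᶠ-const (length reps) 0ℤ) (*-zeroʳ (+ length reps))))
              (trans (+-identityˡ (selected S A)) outside)
          where
          outside : selected S A ≡ 𝟙 k A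
          outside with ∣ A ∣ ℕ.≟ k
          ... | no ne = trans (cong (λ b → ind b * ind (S A)) (dec-false (∣ A ∣ ℕ.≟ k) ne)) (sym (cong ind (dec-false (∣ A ∣ ℕ.≟ k) ne)))
          ... | yes v = trans (cong (λ b → 𝟙 k A * ind b) (Bool.¬-not (λ s → ¬r (v , s)))) (*-identityʳ (𝟙 k A))

        N≡classes+card : ∑ {n} (𝟙 k) ≡ Σᶠ (λ i → ∑ (λ A → δ (label A) i)) + + card S
        N≡classes+card = begin
          ∑ {n} (𝟙 k) ≡⟨ ∑-cong (λ A → trans (sym (∑-class A)) (ones (Σᶠ (λ i → δ (label A) i)) (selected S A))) ⟩
          ∑ (λ A → 1ℤ * Σᶠ (λ i → δ (label A) i) + 1ℤ * selected S A) ≡⟨ ∑-lin 1ℤ 1ℤ (λ A → Σᶠ (λ i → δ (label A) i)) (selected S) ⟩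
          1ℤ * ∑ (λ A → Σᶠ (λ i → δ (label A) i)) + 1ℤ * ∑ (selected S) ≡⟨ sym (ones (∑ (λ A → Σᶠ (λ i → δ (label A) i))) (∑ (selected S))) ⟩
          ∑ (λ A → Σᶠ (λ i → δ (label A) i)) + ∑ (selected S) ≡⟨ cong₂ _+_ (∑-Σᶠ (λ i A → δ (label A) i)) (sym (card≡∑ S)) ⟩
          Σᶠ (λ i → ∑ (λ A → δ (label A) i)) + + card S ∎
          where
          ones : ∀ x y → x + y ≡ 1ℤ * x + 1ℤ * y
          ones = solve-∀

  other : ∀ {c} → 2 ℕ.≤ c → (i : Fin c) → ∃ λ j → i ≢ j
  other (ℕ.s≤s (ℕ.s≤s _)) zero = suc zero , λ ()
  other (ℕ.s≤s (ℕ.s≤s _)) (suc i) = zero , λ ()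

  some : ∀ {c} → 2 ℕ.≤ c → Fin c
  some (ℕ.s≤s _) = zero

  -- The toughness bound and its equality case.

  module Toughness (K p : ℕ) (K<p : K ℕ.< p) where
    open Parameters K p K<p
    open Kneser v k
    open Components v k

    -- Hoffman's ratio bound, here the Erdős-Ko-Rado theorem: with no edges inside J, `lower-bound`
    -- reads (ℓ + d) j² ≤ N ℓ j. The empty J is treated apart so that j can be cancelled.
    independent-bound : ∀ J → Independent J → (+ k + w) * + card J ≤ + k * N
    independent-bound J ind-J with card J ℕ.≟ 0
    ... | yes z = subst (λ x → (+ k + w) * + x ≤ + k * N) (sym z) (subst (_≤ + k * N) (sym (*-zeroʳ (+ k + w))) (*-nonneg {+ k} (+≤+ ℕ.z≤n) (<⇒≤ N-pos)))
    ... | no nz = 0≤i-j⇒j≤i (cancel-nonneg j>0 (cancel-nonneg ℓ-pos (subst (0ℤ ≤_)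
          (trans (ring₁ (+ k) ℓ d N j) (trans (cong (λ z → + k * N * ℓ * j - (+ k * ℓ + z) * (j * j)) kd≡wℓ) (ring₂ (+ k) w ℓ N j)))
          (*-nonneg {+ k} (+≤+ ℕ.z≤n) (i≤j⇒0≤j-i bound)))))
      where
      j = + card J
      j>0 : 0ℤ < j
      j>0 = +<+ (ℕ.n≢0⇒n>0 nz)
      g : Fn v
      g = selected J
      g≢0 : ∀ {A} → g A ≢ 0ℤ → IsVertex A × J A ≡ true
      g≢0 {A} ne with ∣ A ∣ ℕ.≟ k | J A Bool.≟ true
      ... | yes e | yes e′ = e , e′
      ... | no e | _ = contradiction (cong (λ b → ind b * ind (J A)) (dec-false (∣ A ∣ ℕ.≟ k) e)) ne
      ... | yes _ | no e = contradiction (trans (cong (λ b → 𝟙 k A * ind b) (Bool.¬-not e)) (*-zeroʳ (𝟙 k A))) ne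
      Level-g : Level (+ k) g
      Level-g = vanish-level λ A ne → trans (cong (λ b → ind b * ind (J A)) (dec-false (∣ A ∣ ℕ.≟ k) ne)) refl
      idem : ∀ A → g A * g A ≡ g A
      idem A = trans (ring (𝟙 k A) (ind (J A))) (cong₂ _*_ (ind-idem (does (∣ A ∣ ℕ.≟ k))) (ind-idem (J A)))
        where
        ring : ∀ x y → x * y * (x * y) ≡ x * x * (y * y)
        ring = solve-∀
      gZg : ∀ A → g A * Z g A ≡ 0ℤ
      gZg A with g A ℤ.≟ 0ℤ
      ... | yes z = cong (_* Z g A) z
      ... | no ne = trans (cong (g A *_) (Z-vanish A isolated)) (*-zeroʳ (g A))
        where
        isolated : ∀ B → Disjoint A B → g B ≡ 0ℤ
        isolated B dj with g B ℤ.≟ 0ℤ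
        ... | yes z = z
        ... | no ne′ = contradiction dj (ind-J A B (proj₁ (g≢0 {A} ne)) (proj₁ (g≢0 {B} ne′)) (proj₂ (g≢0 {A} ne)) (proj₂ (g≢0 {B} ne′)))
      bound : (ℓ + d) * (j * j) ≤ N * (ℓ * j + 0ℤ)
      bound = subst₂ _≤_ (cong (λ z → (ℓ + d) * (z * z)) (sym (card≡∑ J)))
        (cong₂ (λ x y → N * (ℓ * x + y)) (trans (∑-cong idem) (sym (card≡∑ J))) (trans (∑-cong gZg) (∑-0 {v})))
        (lower-bound g Level-g)
      ring₁ : ∀ k ℓ d N j → k * (N * (ℓ * j + 0ℤ) - (ℓ + d) * (j * j)) ≡ k * N * ℓ * j - (k * ℓ + k * d) * (j * j)
      ring₁ = solve-∀
      ring₂ : ∀ k w ℓ N j → k * N * ℓ * j - (k * ℓ + w * ℓ) * (j * j) ≡ ℓ * (j * (k * N - (k + w) * j))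
      ring₂ = solve-∀

    module Cut (regime : Regime) (S : VSet) (reps : List (Subset v)) (remains : All (Remaining S) reps)
      (apart : AllPairs (λ A B → ¬ Conn S A B) reps)
      (cover : ∀ A → Remaining S A → Any (λ R → Conn S R A) reps)
      (c≥2 : 2 ℕ.≤ length reps) where

      open Labelled S reps remains apart cover
      open Classes K p K<p label vertex separate inhabited
      open Summation (λ i → weight regime (proj₂ (other c≥2 i))) (some c≥2)

      c s : ℤ
      c = + length reps
      s = + card S

      private
        N≡ : N ≡ Σᶠ m + s
        N≡ = trans (sym (∑-𝟙 v k)) N≡classes+card

        ∑budget : Σᶠ budget ≡ + k * Σᶠ m + c * w
        ∑budget = trans (Σᶠ-cong (λ i → ring (+ k * m i) w)) (trans (Σᶠ-lin 1ℤ 1ℤ (λ i → + k * m i) (λ _ → w))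
          (trans (cong₂ (λ x y → 1ℤ * x + 1ℤ * y) (Σᶠ-scale (+ k) m) (Σᶠ-const (length reps) w)) (sym (ring (+ k * Σᶠ m) (c * w)))))
          where
          ring : ∀ x y → x + y ≡ 1ℤ * x + 1ℤ * y
          ring = solve-∀

        slack : + k * N - Σᶠ budget ≡ s * + k - w * c
        slack = trans (cong₂ (λ x y → + k * x - y) N≡ ∑budget) (ring (+ k) (Σᶠ m) s c w)
          where
          ring : ∀ k x s c w → k * (x + s) - (k * x + c * w) ≡ s * k - w * c
          ring = solve-∀

      tough : w * c ≤ s * + k
      tough = 0≤i-j⇒j≤i (subst (0ℤ ≤_) slack (i≤j⇒0≤j-i budget-bound))

      module Equality (tight : w * c ≡ s * + k) where

        m≡1 : ∀ i → m i ≡ 1ℤ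
        m≡1 i with m i ℤ.≟ 1ℤ
        ... | yes e = e
        ... | no ne = contradiction tight (<⇒≢ (0<j-i⇒i<j (subst (0ℤ <_) slack (i<j⇒0<j-i
                (budget-strict i (i<j⇒suc[i]≤j (≤∧≢⇒< (m≥1 i) (λ e → ne (sym e)))))))))

        I : VSet
        I A = not (S A)

        I-independent : Independent I
        I-independent A B vA vB IA IB adj with remaining-label (vA , Bool.not-injective IA) | remaining-label (vB , Bool.not-injective IB)
        ... | i , eq | j , eq′ with separate eq eq′ adj
        ...   | refl = contradiction (subst (+ 2 ≤_) (m≡1 i) (≤-trans (+-monoˡ-≤ 1ℤ (subst (_≤ Z (χ i) A) (χ-in eq′) (≤-Z (χ≥0 i) A B adj))) (Zχ<m eq)))
                  (λ { (+≤+ (ℕ.s≤s ())) })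

        complement : + card S + + card I ≡ N
        complement = trans (cong₂ _+_ (card≡∑ S) (card≡∑ I)) (trans (ones (∑ (selected S)) (∑ (selected I)))
          (trans (sym (∑-lin 1ℤ 1ℤ (selected S) (selected I))) (trans (∑-cong pointwise) (∑-𝟙 v k))))
          where
          ones : ∀ x y → x + y ≡ 1ℤ * x + 1ℤ * y
          ones = solve-∀
          ring : ∀ x y → x * y + x * (1ℤ + -1ℤ * y) ≡ x
          ring = solve-∀
          ind-not : ∀ b → ind (not b) ≡ 1ℤ + -1ℤ * ind b
          ind-not true = refl
          ind-not false = refl
          pointwise : ∀ A → 1ℤ * selected S A + 1ℤ * selected I A ≡ 𝟙 k A
          pointwise A = trans (sym (ones (selected S A) (selected I A)))
            (trans (cong (λ z → 𝟙 k A * ind (S A) + 𝟙 k A * z) (ind-not (S A))) (ring (𝟙 k A) (ind (S A))))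

        card-I : + card I ≡ c
        card-I = +-cancelˡ-≡ s (+ card I) c (trans complement (trans N≡ (trans (cong (_+ s) (trans (Σᶠ-cong m≡1) (trans (Σᶠ-const (length reps) 1ℤ) (*-identityʳ c)))) (+-comm c s))))
          where
          +-cancelˡ-≡ : ∀ a b c → a + b ≡ a + c → b ≡ c
          +-cancelˡ-≡ a b c e = trans (ring a b) (trans (cong (λ z → - a + z) e) (sym (ring a c)))
            where
            ring : ∀ a b → b ≡ - a + (a + b)
            ring = solve-∀

        -- Tightness w c = k |S| together with |S| + c = N gives n c = k N, so I attains
        -- `independent-bound`.
        I-maximum : MaximumIndependent I
        I-maximum = I-independent , λ J ind-J → drop‿+≤+ (*-cancelˡ-≤-pos (+ card J) (+ card I) (+ k + w)
          (≤-trans (independent-bound J ind-J) (≤-reflexive (trans (cong (+ k *_) (sym complement))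
            (trans (ring₁ (+ k) s (+ card I)) (trans (cong (λ z → z + + k * + card I) (trans (sym tight) (cong (w *_) (sym card-I)))) (ring₂ (+ k) w (+ card I))))))))
          where
          ring₁ : ∀ k s x → k * (s + x) ≡ s * k + k * x
          ring₁ = solve-∀
          ring₂ : ∀ k w x → w * x + k * x ≡ (k + w) * x
          ring₂ = solve-∀

        maximum-complement : ∃ λ I → MaximumIndependent I × ComplementOf S I
        maximum-complement = I , I-maximum , λ A _ → sym (Bool.not-involutive (S A))

    -- A cut attaining the bound.

    module Star where
      v-1 : ℕ
      v-1 = suc K ℕ.+ (2 ℕ.+ p)

      -- The sets that avoid the first element are deleted. The remaining ones share that element,
      -- so no two are adjacent and each is a component.
      S : VSet
      S (b ∷ _) = not b

      links : List (Subset v-1)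
      links = filter (λ A → ∣ A ∣ ℕ.≟ suc K) (allSubsets v-1)

      reps : List (Subset v)
      reps = map (true ∷_) links

      length-reps : + length reps ≡ + bin v-1 (suc K)
      length-reps = trans (cong +_ (length-map (true ∷_) links)) (trans (length-filter _ (allSubsets v-1)) (trans (sumL-allSubsets v-1 _) (∑-𝟙 v-1 (suc K))))

      card-S : + card S ≡ + bin v-1 (suc (suc K))
      card-S = trans (card≡∑ S) (trans (cong₂ _+_ (trans (∑-cong {v-1} {selected S ₁} (λ A → *-zeroʳ (𝟙 (suc K) A))) (∑-0 {v-1}))
        (trans (∑-cong {v-1} {selected S ₀} (λ A → *-identityʳ (𝟙 k A))) (∑-𝟙 v-1 k))) (+-identityˡ (+ bin v-1 k)))

      -- This is k C(n-1, k) = (n - k) C(n-1, k-1).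
      equality : w * + length reps ≡ + card S * + k
      equality = trans (cong (w *_) length-reps) (trans (sym (trans (bin-absorb v-1 (suc K)) (cong (_* + bin v-1 (suc K)) (index-difference))))
        (trans (*-comm (+ k) (+ bin v-1 k)) (cong (_* + k) (sym card-S))))
        where
        ring : ∀ a b → a + b - a ≡ b
        ring = solve-∀
        index-difference : + v-1 - + suc K ≡ w
        index-difference = trans (cong (λ z → z - + suc K) (pos-+ (suc K) (2 ℕ.+ p))) (ring (+ suc K) w)

      c≥2 : 2 ℕ.≤ length reps
      c≥2 = subst (2 ℕ.≤_) (sym (+-injective length-reps)) (ℕ.+-mono-≤ (bin-pos (2 ℕ.+ p) K)
        (ℕ.≤-trans (bin-pos (1 ℕ.+ p) (suc K)) (ℕ.≤-reflexive (cong (λ z → bin z (suc K)) (sym (ℕ.+-suc K (suc p)))))))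

      remaining-head : ∀ {A} → Remaining S A → ∃ λ A′ → A ≡ true ∷ A′ × ∣ A′ ∣ ≡ suc K
      remaining-head {true ∷ A} (v , _) = A , refl , ℕ.suc-injective v

      Conn⇒≡ : ∀ {A B} → Conn S A B → A ≡ B
      Conn⇒≡ (here _) = refl
      Conn⇒≡ (step {B = B} {C} q r adj) with remaining-head {B} (Conn-target S q) | remaining-head {C} r
      ... | _ , refl , _ | _ , refl , _ = contradiction (zero , here) adj

      components : HasComponents S (length reps)
      components = reps , refl ,
        All.map⁺ (All.map (λ e → cong suc e , refl) (All.all-filter (λ A → ∣ A ∣ ℕ.≟ suc K) (allSubsets v-1))) ,
        AllPairs.map (λ ne q → ne (Conn⇒≡ q)) (Unique.map⁺ ∷-injectiveʳ (Unique.filter⁺ (λ A → ∣ A ∣ ℕ.≟ suc K) (allSubsets-unique v-1))) ,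
        covered
        where
        covered : ∀ A → Remaining S A → Any (λ R → Conn S R A) reps
        covered A r with remaining-head {A} r
        ... | A′ , refl , e = Any.map (λ { refl → here r }) (∈-map⁺ (true ∷_) (∈-filter⁺ (λ A → ∣ A ∣ ℕ.≟ suc K) (∈-allSubsets A′) e))

    Conclusion : ℕ → ℕ → Set
    Conclusion n k = IsToughness n k (frac n k -ℚ 1ℚ) ×
      (∀ S c → Kneser.VertexCut n k S c →
        frac n k -ℚ 1ℚ ≡ frac (Kneser.card n k S) c →
        ∃ λ I → Kneser.MaximumIndependent n k I × Kneser.ComplementOf n k S I)

    conclusion : Regime → Conclusion v k
    conclusion regime = (lower , attained) , extremal
      where
      value : frac v k -ℚ 1ℚ ≡ fromℚᵘ (mkℚᵘ w (suc K))
      value = fraction-minus-one (suc K) (2 ℕ.+ p)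

      lower : ∀ S c → VertexCut S c → (frac v k -ℚ 1ℚ) ≤ℚ frac (card S) c
      -- A cut has c ≥ 2, so the default value of `frac` at denominator zero never enters.
      lower S (suc c) ((reps , len , remains , apart , cover) , c≥2) = subst (_≤ℚ frac (card S) (suc c)) (sym value)
        (fraction-≤ (2 ℕ.+ p) (suc K) (card S) c (subst (λ z → w * + z ≤ + card S * + k) len
          (Cut.tough regime S reps remains apart cover (subst (2 ℕ.≤_) (sym len) c≥2))))

      attained : ∃ λ S → ∃ λ c → VertexCut S c × frac v k -ℚ 1ℚ ≡ frac (card S) c
      attained = Star.S , length Star.reps , (Star.components , Star.c≥2) , at-star (length Star.reps) Star.c≥2 Star.equality
        where
        at-star : ∀ c → 2 ℕ.≤ c → w * + c ≡ + card Star.S * + k → frac v k -ℚ 1ℚ ≡ frac (card Star.S) c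
        at-star (suc c) _ eq = trans value (fraction-≡ (2 ℕ.+ p) (suc K) (card Star.S) c eq)

      extremal : ∀ S c → VertexCut S c → frac v k -ℚ 1ℚ ≡ frac (card S) c → ∃ λ I → MaximumIndependent I × ComplementOf S I
      extremal S (suc c) ((reps , len , remains , apart , cover) , c≥2) eq =
        Cut.Equality.maximum-complement regime S reps remains apart cover (subst (2 ℕ.≤_) (sym len) c≥2)
          (subst (λ z → w * + z ≡ + card S * + k) (sym len) (fraction-≡⁻¹ (2 ℕ.+ p) (suc K) (card S) c (trans (sym value) eq)))

  -- The regimes for k = 3 and k = 4.

  bin-mono : ∀ t m r → bin m r ℕ.≤ bin (t ℕ.+ m) r
  bin-mono zero m r = ℕ.≤-refl
  bin-mono (suc t) m zero = ℕ.≤-refl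
  bin-mono (suc t) m (suc r) = ℕ.≤-trans (bin-mono t m (suc r)) (ℕ.m≤n+m _ _)

  -- Beyond n = 7, with n = 8 + t, the absorption identities are 3d = (5 + t) ℓ and 2ℓ = (4 + t) θ.
  -- They give 3 (2d - 3ℓ) = (1 + 2t) ℓ and 2 (3ℓ - 5θ) = (2 + 3t) θ, while ℓ ≥ C(4,2) = 6.
  regime₃ : ∀ t → Parameters.Regime 1 (2 ℕ.+ t) (ℕ.s≤s (ℕ.s≤s ℕ.z≤n))
  regime₃ zero = Parameters.seven refl refl refl refl refl refl
  regime₃ (suc t) = Parameters.generic
    (0≤i-j⇒j≤i (cancel-nonneg {+ 3} (+<+ ℕ.z<s) (subst (0ℤ ≤_) eq₁ (*-nonneg {+ 1 + + 2 * + t} {ℓ} (+-nonneg {+ 1} (+≤+ ℕ.z≤n) (*-nonneg {+ 2} {+ t} (+≤+ ℕ.z≤n) (+≤+ ℕ.z≤n))) (+≤+ ℕ.z≤n)))))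
    (0≤i-j⇒j≤i (cancel-nonneg {+ 2} (+<+ ℕ.z<s) (subst (0ℤ ≤_) eq₂ (*-nonneg {+ 2 + + 3 * + t} {θ} (+-nonneg {+ 2} (+≤+ ℕ.z≤n) (*-nonneg {+ 3} {+ t} (+≤+ ℕ.z≤n) (+≤+ ℕ.z≤n))) (+≤+ ℕ.z≤n)))))
    (+≤+ (subst (λ z → 6 ℕ.≤ bin z 2) (ℕ.+-comm t 4) (bin-mono t 4 2)))
    where
    open Parameters 1 (2 ℕ.+ suc t) (ℕ.s≤s (ℕ.s≤s ℕ.z≤n))
    ring₁ : ∀ t d ℓ → (+ 1 + + 2 * t) * ℓ ≡ + 3 * (+ 2 * d - + 3 * ℓ) + + 2 * ((+ 5 + t) * ℓ - + 3 * d)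
    ring₁ = solve-∀
    tidy : ∀ x c → x + c * 0ℤ ≡ x
    tidy = solve-∀
    eq₁ : (+ 1 + + 2 * + t) * ℓ ≡ + 3 * (+ 2 * d - + 3 * ℓ)
    eq₁ = trans (ring₁ (+ t) d ℓ) (trans (cong (λ z → + 3 * (+ 2 * d - + 3 * ℓ) + + 2 * z) (i≡j⇒i-j≡0 (sym kd≡wℓ))) (tidy (+ 3 * (+ 2 * d - + 3 * ℓ)) (+ 2)))
    ring₂ : ∀ t ℓ θ → (+ 2 + + 3 * t) * θ ≡ + 2 * (+ 3 * ℓ - + 5 * θ) + + 3 * ((+ 4 + t) * θ - + 2 * ℓ)
    ring₂ = solve-∀
    eq₂ : (+ 2 + + 3 * + t) * θ ≡ + 2 * (+ 3 * ℓ - + 5 * θ)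
    eq₂ = trans (ring₂ (+ t) ℓ θ) (trans (cong (λ z → + 2 * (+ 3 * ℓ - + 5 * θ) + + 3 * z) (i≡j⇒i-j≡0 (sym [k-1]ℓ≡[w-1]θ))) (tidy (+ 2 * (+ 3 * ℓ - + 5 * θ)) (+ 3)))

  -- Beyond n = 9, with n = 10 + t, the identities are 4d = (6 + t) ℓ and 3ℓ = (5 + t) θ. Both
  -- slacks are multiples of t, so they vanish for K(10,4).
  regime₄ : ∀ t → Parameters.Regime 2 (3 ℕ.+ t) (ℕ.s≤s (ℕ.s≤s (ℕ.s≤s ℕ.z≤n)))
  regime₄ zero = Parameters.nine refl refl refl refl refl refl
  regime₄ (suc t) = Parameters.generic
    (0≤i-j⇒j≤i (cancel-nonneg {+ 4} (+<+ ℕ.z<s) (subst (0ℤ ≤_) eq₁ (*-nonneg {+ 2 * + t} {ℓ} (*-nonneg {+ 2} {+ t} (+≤+ ℕ.z≤n) (+≤+ ℕ.z≤n)) (+≤+ ℕ.z≤n)))))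
    (0≤i-j⇒j≤i (subst (0ℤ ≤_) eq₂ (*-nonneg {+ t} {θ} (+≤+ ℕ.z≤n) (+≤+ ℕ.z≤n))))
    (+≤+ (ℕ.≤-trans (ℕ.≤ᵇ⇒≤ 6 10 _) (subst (λ z → 10 ℕ.≤ bin z 3) (ℕ.+-comm t 5) (bin-mono t 5 3))))
    where
    open Parameters 2 (3 ℕ.+ suc t) (ℕ.s≤s (ℕ.s≤s (ℕ.s≤s ℕ.z≤n)))
    ring₁ : ∀ t d ℓ → + 2 * t * ℓ ≡ + 4 * (+ 2 * d - + 3 * ℓ) + + 2 * ((+ 6 + t) * ℓ - + 4 * d)
    ring₁ = solve-∀
    tidy : ∀ x c → x + c * 0ℤ ≡ x
    tidy = solve-∀
    eq₁ : + 2 * + t * ℓ ≡ + 4 * (+ 2 * d - + 3 * ℓ)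
    eq₁ = trans (ring₁ (+ t) d ℓ) (trans (cong (λ z → + 4 * (+ 2 * d - + 3 * ℓ) + + 2 * z) (i≡j⇒i-j≡0 (sym kd≡wℓ))) (tidy (+ 4 * (+ 2 * d - + 3 * ℓ)) (+ 2)))
    ring₂ : ∀ t ℓ θ → t * θ ≡ (+ 3 * ℓ - + 5 * θ) + 1ℤ * ((+ 5 + t) * θ - + 3 * ℓ)
    ring₂ = solve-∀
    eq₂ : + t * θ ≡ + 3 * ℓ - + 5 * θ
    eq₂ = trans (ring₂ (+ t) ℓ θ) (trans (cong (λ z → (+ 3 * ℓ - + 5 * θ) + 1ℤ * z) (i≡j⇒i-j≡0 (sym [k-1]ℓ≡[w-1]θ))) (tidy (+ 3 * ℓ - + 5 * θ) 1ℤ))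

open import Data.Nat using (ℕ; _≤_; _+_; _*_)
open import Data.Nat.Properties using (m≤n⇒∃[o]m+o≡n)
open import Data.Sum using (_⊎_; inj₁; inj₂)
open import Data.Product using (_×_; ∃; _,_)
open import Data.Rational using (1ℚ; _-_)
open import Relation.Binary.PropositionalEquality using (_≡_; refl)
open Development using (module Toughness; regime₃; regime₄)

theorem2 : (n k : ℕ) → (k ≡ 3 ⊎ k ≡ 4) → 2 * k + 1 ≤ n →
    IsToughness n k (frac n k - 1ℚ) ×
    (∀ S c → Kneser.VertexCut n k S c →
    frac n k - 1ℚ ≡ frac (Kneser.card n k S) c →
    ∃ λ I → Kneser.MaximumIndependent n k I × Kneser.ComplementOf n k S I)
theorem2 n _ (inj₁ refl) 7≤n with m≤n⇒∃[o]m+o≡n 7≤n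
... | t , refl = Toughness.conclusion 1 (2 + t) _ (regime₃ t)
theorem2 n _ (inj₂ refl) 9≤n with m≤n⇒∃[o]m+o≡n 9≤n
... | t , refl = Toughness.conclusion 2 (3 + t) _ (regime₄ t)
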